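{- Let $Q$ be a quiver containing an oriented $k$-cycle on vertices labelled $1,\dots,k$, with arrows $k\to1$ and $i\to i+1$ for $1\le i\le k-1$, such that each vertex $1,\dots,k-1$ is incident to exactly two arrows of $Q$: the single arrow from the preceding vertex of the cycle and the single arrow to the next vertex of the cycle. Let $C=Q[Q_0\setminus\{1,\dots,k-1\}]$ be the induced subquiver obtained by removing the vertices $1,\dots,k-1$ (vertex $k$ is kept). Then $Q$ has a maximal green sequence if and only if $C$ has a maximal green sequence. In particular, when $k=3$, if $\mathbf{i}_C$ is a maximal green sequence for $C$, then $(2,\mathbf{i}_C,1,2)$ is a maximal green sequence for $Q$.
   Context: A quiver is a finite directed multigraph with no loops and no oriented 2-cycles; $Q_0$ denotes its vertex set and $Q[V]$ the induced subquiver on $V\subseteq Q_0$ (all arrows of $Q$ between vertices of $V$). Mutation $\mu_k$: for every path $i\to k\to j$ add an arrow $i\to j$, reverse all arrows at $k$, delete a maximal collection of oriented 2-cycles (and arrows between frozen vertices). The framed quiver $\hat Q$ adds a frozen (never mutated) vertex $i'$ and an arrow $i\to i'$ for each vertex $i$. A non-frozen vertex is green if it has no incoming arrow from a frozen vertex and red if it has no outgoing arrow to a frozen vertex. $(i_1,\dots,i_l)$ is a maximal green sequence if each $i_t$ is green in $\mu_{i_{t-1}}\cdots\mu_{i_1}(\hat Q)$ and every non-frozen vertex of $\mu_{i_l}\cdots\mu_{i_1}(\hat Q)$ is red. -}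

module Defs where

open import Data.Nat using (ℕ; zero; suc; _+_; _*_; _∸_; _<?_)
open import Data.Fin using (Fin; zero; suc; inject₁; _↑ˡ_; _↑ʳ_; fromℕ<; toℕ; _≟_)
open import Data.Sum using (_⊎_; inj₁; inj₂)
open import Data.Product using (_×_; Σ; ∃; _,_)
open import Data.List using (List; []; _∷_)
open import Relation.Binary.PropositionalEquality using (_≡_)
open import Relation.Nullary using (Dec; yes; no)

record Quiver (n : ℕ) : Set where
  field
    arr    : Fin n → Fin n → ℕ
    noLoop : ∀ i → arr i i ≡ 0
    no2cyc : ∀ i j → arr i j ≡ 0 ⊎ arr j i ≡ 0
open Quiver public

-- Ice quiver on non-frozen vertices inj₁ i and frozen vertices inj₂ i
-- (arrow counts).
Vtx : ℕ → Set
Vtx n = Fin n ⊎ Fin n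

IceQuiver : ℕ → Set
IceQuiver n = Vtx n → Vtx n → ℕ

indic : ∀ {A : Set} {a b : A} → Dec (a ≡ b) → ℕ
indic (yes _) = 1
indic (no _)  = 0

framed : ∀ {n} → Quiver n → IceQuiver n
framed Q (inj₁ i) (inj₁ j) = arr Q i j
framed Q (inj₁ i) (inj₂ j) = indic (i ≟ j)
framed Q (inj₂ i) (inj₁ j) = 0
framed Q (inj₂ i) (inj₂ j) = 0

-- arrows x → y after adding arrows x → y for each path x → k → y and
-- cancelling a maximal collection of 2-cycles between x and y
-- (for x, y ≠ k)
composeCancel : ∀ {n} → Fin n → IceQuiver n → Vtx n → Vtx n → ℕ
composeCancel k A x y =
  (A x y + A x (inj₁ k) * A (inj₁ k) y) ∸ (A y x + A y (inj₁ k) * A (inj₁ k) x)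

mutate : ∀ {n} → Fin n → IceQuiver n → IceQuiver n
mutate k A (inj₁ x) (inj₁ y) with x ≟ k | y ≟ k
... | yes _ | _     = A (inj₁ y) (inj₁ x)
... | no _  | yes _ = A (inj₁ y) (inj₁ x)
... | no _  | no _  = composeCancel k A (inj₁ x) (inj₁ y)
mutate k A (inj₁ x) (inj₂ f) with x ≟ k
... | yes _ = A (inj₂ f) (inj₁ x)
... | no _  = composeCancel k A (inj₁ x) (inj₂ f)
mutate k A (inj₂ f) (inj₁ y) with y ≟ k
... | yes _ = A (inj₁ y) (inj₂ f)
... | no _  = composeCancel k A (inj₂ f) (inj₁ y)
mutate k A (inj₂ f) (inj₂ g) = 0

Green : ∀ {n} → IceQuiver n → Fin n → Set
Green A k = ∀ f → A (inj₂ f) (inj₁ k) ≡ 0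

Red : ∀ {n} → IceQuiver n → Fin n → Set
Red A k = ∀ f → A (inj₁ k) (inj₂ f) ≡ 0

GreenSeqToRed : ∀ {n} → IceQuiver n → List (Fin n) → Set
GreenSeqToRed A []       = ∀ i → Red A i
GreenSeqToRed A (k ∷ ks) = Green A k × GreenSeqToRed (mutate k A) ks

IsMaximalGreenSequence : ∀ {n} → Quiver n → List (Fin n) → Set
IsMaximalGreenSequence Q s = GreenSeqToRed (framed Q) s

HasMGS : ∀ {n} → Quiver n → Set
HasMGS Q = ∃ λ s → IsMaximalGreenSequence Q s

-- Setting of the theorem.  Q has vertex set Fin (j + m), j = k - 1 ≥ 2.
-- Cycle vertex t (1 ≤ t ≤ k-1) is  ((t-1 : Fin j) ↑ˡ m);  cycle vertex k
-- is  (j ↑ʳ v)  for a chosen v : Fin m;  the remaining vertices of C are the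
-- (j ↑ʳ _) ones.

prevV : ∀ {j} m → Fin m → Fin j → Fin (j + m)
prevV {suc j} m v zero    = suc j ↑ʳ v
prevV {suc j} m v (suc i) = ((inject₁ i) ↑ˡ m)

nextV : ∀ {j} m → Fin m → Fin j → Fin (j + m)
nextV {j} m v i with suc (toℕ i) <? j
... | yes p = ((fromℕ< p) ↑ˡ m)
... | no _  = (j ↑ʳ v)

induced : ∀ j {m} → Quiver (j + m) → Quiver m
induced j Q = record
  { arr    = λ a b → arr Q ((j ↑ʳ a)) ((j ↑ʳ b))
  ; noLoop = λ a → noLoop Q ((j ↑ʳ a))
  ; no2cyc = λ a b → no2cyc Q ((j ↑ʳ a)) ((j ↑ʳ b))
  }

CycleHyp : ∀ j m → Fin m → Quiver (j + m) → Set
CycleHyp j m v Q = ∀ (i : Fin j) (x : Fin (j + m)) →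
  (arr Q x ((i ↑ˡ m)) ≡ indic (x ≟ prevV m v i)) ×
  (arr Q ((i ↑ˡ m)) x ≡ indic (x ≟ nextV m v i))

{-# OPTIONS --safe #-}
-- Both implications are proved for c-vectors in the lattice N = ℤ^{Q₀} with the Euler form ω, where a
-- green mutation at k sends c_k to -c_k and c_j to c_j + max(ω(c_j,c_k),0) c_k.
--
-- From C to Q: mutating at k-1, …, 2 opens the cycle.  Afterwards the c-vectors of the vertices 1, …, k-1
-- pair non-positively with every c ≥ 0 of C, so a maximal green sequence of C runs unchanged, and the
-- mutations at 1, 2, …, k-1 turn the remaining vertices red.
--
-- From Q to C, for any induced subquiver: let Θ be the Donaldson–Thomas element of Q in the quantum torus,
-- determined by its incoming walls.  A green mutation with c-vector β splits a quantum dilogarithm E(y^β)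
-- off Θ, and the quotient is supported both in the old and in the new cone of c-vectors: by induction on
-- the degree, the incoming condition forbids a first term outside.  Hence along a green path Θ = S R in
-- every seed, with S supported in -N⁺ and R in N⁺; since every c-vector lies in the support of S or R,
-- c-vectors are sign-coherent.  Restricting S and R to the sublattice of C gives the same data for a path
-- in C that mutates exactly when β lies in the sublattice.  When all vertices of Q are red, R = 1, so C is
-- red too.
module Submission where

open import Defs
open import Data.Nat as ℕ using (ℕ; zero; suc; _+_; z≤n; s≤s)
import Data.Nat.Properties as ℕP
open import Data.Integer as ℤ using (ℤ; +_; -[1+_]; 0ℤ; 1ℤ; ∣_∣)
import Data.Integer.Properties as ℤP
open import Data.Rational as ℚ using (ℚ; 0ℚ; 1ℚ)
import Data.Rational.Properties as ℚP
open import Data.Fin as Fin using (Fin; zero; suc)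
import Data.Fin.Properties as FinP
open import Data.Vec as Vec using (Vec; []; _∷_; lookup)
import Data.Vec.Properties as VecP
open import Data.List as List using (List; []; _∷_; _++_)
open import Data.List.Membership.Propositional using (_∈_; _∉_)
import Data.List.Membership.Propositional.Properties as ∈P
open import Data.List.Relation.Unary.Any using (here; there)
import Data.List.Relation.Unary.All as All
open import Data.List.Relation.Unary.Unique.Propositional using (Unique)
import Data.List.Relation.Unary.Unique.DecPropositional.Properties as UniqueP
open import Data.List.Relation.Unary.AllPairs using ([]; _∷_)
open import Data.Product using (Σ; ∃; ∃₂; _×_; _,_; proj₁; proj₂)
open import Data.Sum using (_⊎_; inj₁; inj₂)
open import Data.Empty using (⊥; ⊥-elim)
open import Function using (_∘_; id; case_of_)
open import Relation.Nullary using (¬_; Dec; yes; no)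
open import Relation.Nullary.Decidable using (from-yes; from-no; ¬?)
open import Relation.Binary.PropositionalEquality
open import Data.Integer.Tactic.RingSolver using () renaming (solve-∀ to solveℤ)
open import Algebra.Bundles using (CommutativeRing)
open import Algebra.Structures using (IsCommutativeRing)
import Algebra.Solver.Ring.NaturalCoefficients.Default
open import Data.Fin using (_↑ˡ_; _↑ʳ_)
open import Data.List using (map)
open import Function.Bundles using (_⇔_; mk⇔)

-- A mutation of Q whose c-vector lies outside the sublattice of C changes the seed of Q but not
-- that of C, so no combinatorial relation between the two seeds can be carried along. What does
-- restrict is the pair (S, R): at degrees of the sublattice, products of series supported in the
-- positive orthant involve only the sublattice, and the incoming condition restricts as well. The
-- path in C is therefore tracked through the series, and c-vectors are matched through their cones.
-- Over the quantum torus, products and the one functional equation E(t⁻¹z) = (1 + z) E(tz) take the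
-- place of Lie algebras and exponentials. Any rational t other than 0, 1, -1 would serve; t = 2
-- keeps all coefficients in ℚ. Two obstacles shape the definitions. In general ω(n, ·) vanishes on
-- far more than the line of n and has to be perturbed inside n^⊥, which lexicographic signs
-- achieve. And S and R live in opposite orthants, so sums over the lattice are not finite for
-- obvious reasons: a product is a relation whose witnesses are finite lists.

-- The field operations are opaque so that unification treats them as injective.
infixl 6 _⊞_
infixl 7 _⊠_

opaque
  _⊞_ _⊠_ : ℚ → ℚ → ℚ
  _⊞_ = ℚ._+_
  _⊠_ = ℚ._*_

  neg : ℚ → ℚ
  neg = ℚ.-_

  isCommutativeRing : IsCommutativeRing _≡_ _⊞_ _⊠_ neg 0ℚ 1ℚ
  isCommutativeRing = ℚP.+-*-isCommutativeRing

  inverse : (p : ℚ) → p ≢ 0ℚ → ∃ λ q → p ⊠ q ≡ 1ℚ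
  inverse p ne = ℚ.1/ p , ℚP.*-inverseʳ p
    where
    instance
      nz : ℚ.NonZero p
      nz = ℚ.≢-nonZero ne

coefficients : CommutativeRing _ _
coefficients = record { isCommutativeRing = isCommutativeRing }

module 𝔽 = CommutativeRing coefficients

module RingS = Algebra.Solver.Ring.NaturalCoefficients.Default 𝔽.commutativeSemiring
open RingS public using (solve; _:=_; con) renaming (_:+_ to _:⊞_; _:*_ to _:⊠_)

⊠-zeroˡ : ∀ {p q} → p ≡ 0ℚ → p ⊠ q ≡ 0ℚ
⊠-zeroˡ {q = q} e = trans (cong (_⊠ q) e) (𝔽.zeroˡ q)

⊠-zeroʳ : ∀ {p q} → q ≡ 0ℚ → p ⊠ q ≡ 0ℚ
⊠-zeroʳ {p} e = trans (cong (p ⊠_) e) (𝔽.zeroʳ p)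

-- Integer lattices with a solver for linear identities, additive functionals and skew forms.

Lattice : ℕ → Set
Lattice r = Vec ℤ r

infixl 6 _⊕_ _⊝_
infix  8 ⊖_
infixr 7 _·_
infix  4 _≟ᴸ_

_⊕_ : ∀ {r} → Lattice r → Lattice r → Lattice r
_⊕_ = Vec.zipWith ℤ._+_

⊖_ : ∀ {r} → Lattice r → Lattice r
⊖_ = Vec.map (ℤ.-_)

_⊝_ : ∀ {r} → Lattice r → Lattice r → Lattice r
x ⊝ y = x ⊕ ⊖ y

𝟎 : ∀ {r} → Lattice r
𝟎 {r} = Vec.replicate r 0ℤ

_·_ : ∀ {r} → ℕ → Lattice r → Lattice r
zero  · x = 𝟎
suc l · x = x ⊕ l · x

_≟ᴸ_ : ∀ {r} (x y : Lattice r) → Dec (x ≡ y)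
_≟ᴸ_ = VecP.≡-dec ℤP._≟_

lattice-ext : ∀ {r} {x y : Lattice r} → (∀ i → lookup x i ≡ lookup y i) → x ≡ y
lattice-ext {x = []}    {[]}    h = refl
lattice-ext {x = a ∷ x} {b ∷ y} h = cong₂ _∷_ (h zero) (lattice-ext (h ∘ suc))

lookup-⊕ : ∀ {r} (i : Fin r) (x y : Lattice r) → lookup (x ⊕ y) i ≡ lookup x i ℤ.+ lookup y i
lookup-⊕ i x y = VecP.lookup-zipWith ℤ._+_ i x y

lookup-⊖ : ∀ {r} (i : Fin r) (x : Lattice r) → lookup (⊖ x) i ≡ ℤ.- lookup x i
lookup-⊖ i x = VecP.lookup-map i ℤ.-_ x

lookup-𝟎 : ∀ {r} (i : Fin r) → lookup (𝟎 {r}) i ≡ 0ℤ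
lookup-𝟎 i = VecP.lookup-replicate i 0ℤ

data Expr (n : ℕ) : Set where
  var  : Fin n → Expr n
  :0   : Expr n
  _∔_ : Expr n → Expr n → Expr n
  :-_  : Expr n → Expr n

infixl 6 _∔_ _:-_
infix  8 :-_

_:-_ : ∀ {n} → Expr n → Expr n → Expr n
e :- f = e ∔ :- f

v₀ : ∀ {n} → Expr (1 ℕ.+ n)
v₀ = var zero
v₁ : ∀ {n} → Expr (2 ℕ.+ n)
v₁ = var (suc zero)
v₂ : ∀ {n} → Expr (3 ℕ.+ n)
v₂ = var (suc (suc zero))
v₃ : ∀ {n} → Expr (4 ℕ.+ n)
v₃ = var (suc (suc (suc zero)))

⟦_⟧ : ∀ {n r} → Expr n → Vec (Lattice r) n → Lattice r
⟦ var i ⟧  ρ = lookup ρ i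
⟦ :0 ⟧     ρ = 𝟎
⟦ e ∔ f ⟧ ρ = ⟦ e ⟧ ρ ⊕ ⟦ f ⟧ ρ
⟦ :- e ⟧   ρ = ⊖ ⟦ e ⟧ ρ

coeffs : ∀ {n} → Expr n → Lattice n
coeffs (var i)  = 𝟎 Vec.[ i ]≔ 1ℤ
coeffs :0       = 𝟎
coeffs (e ∔ f) = coeffs e ⊕ coeffs f
coeffs (:- e)   = ⊖ coeffs e

dot : ∀ {n} → Vec ℤ n → Vec ℤ n → ℤ
dot []       []       = 0ℤ
dot (a ∷ as) (b ∷ bs) = a ℤ.* b ℤ.+ dot as bs

dot-𝟎 : ∀ {n} (y : Vec ℤ n) → dot 𝟎 y ≡ 0ℤ
dot-𝟎 []      = refl
dot-𝟎 (a ∷ y) = trans (cong₂ ℤ._+_ (ℤP.*-zeroˡ a) (dot-𝟎 y)) refl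

dot-⊕ : ∀ {n} (x z y : Vec ℤ n) → dot (x ⊕ z) y ≡ dot x y ℤ.+ dot z y
dot-⊕ []      []      []      = refl
dot-⊕ (a ∷ x) (c ∷ z) (b ∷ y) = trans (cong (λ t → (a ℤ.+ c) ℤ.* b ℤ.+ t) (dot-⊕ x z y)) (aux a c b _ _)
  where
  aux : ∀ a c b s t → (a ℤ.+ c) ℤ.* b ℤ.+ (s ℤ.+ t) ≡ a ℤ.* b ℤ.+ s ℤ.+ (c ℤ.* b ℤ.+ t)
  aux = solveℤ

dot-⊖ : ∀ {n} (x y : Vec ℤ n) → dot (⊖ x) y ≡ ℤ.- dot x y
dot-⊖ []      []      = refl
dot-⊖ (a ∷ x) (b ∷ y) = trans (cong (λ t → (ℤ.- a) ℤ.* b ℤ.+ t) (dot-⊖ x y)) (aux a b _)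
  where
  aux : ∀ a b s → (ℤ.- a) ℤ.* b ℤ.+ (ℤ.- s) ≡ ℤ.- (a ℤ.* b ℤ.+ s)
  aux = solveℤ

dot-unit : ∀ {n} (i : Fin n) (y : Vec ℤ n) → dot (𝟎 Vec.[ i ]≔ 1ℤ) y ≡ lookup y i
dot-unit zero    (b ∷ y) = trans (cong₂ ℤ._+_ (ℤP.*-identityˡ b) (dot-𝟎 y)) (ℤP.+-identityʳ b)
dot-unit (suc i) (b ∷ y) = trans (cong₂ ℤ._+_ (ℤP.*-zeroˡ b) (dot-unit i y)) (ℤP.+-identityˡ _)

lookup-⟦⟧ : ∀ {n r} (e : Expr n) (ρ : Vec (Lattice r) n) (p : Fin r) →
  lookup (⟦ e ⟧ ρ) p ≡ dot (coeffs e) (Vec.map (λ x → lookup x p) ρ)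
lookup-⟦⟧ (var i)  ρ p = sym (trans (dot-unit i _) (VecP.lookup-map i _ ρ))
lookup-⟦⟧ :0       ρ p = trans (lookup-𝟎 p) (sym (dot-𝟎 (Vec.map (λ x → lookup x p) ρ)))
lookup-⟦⟧ (e ∔ f) ρ p = trans (lookup-⊕ p (⟦ e ⟧ ρ) (⟦ f ⟧ ρ))
  (trans (cong₂ ℤ._+_ (lookup-⟦⟧ e ρ p) (lookup-⟦⟧ f ρ p)) (sym (dot-⊕ (coeffs e) (coeffs f) _)))
lookup-⟦⟧ (:- e)   ρ p = trans (lookup-⊖ p (⟦ e ⟧ ρ))
  (trans (cong ℤ.-_ (lookup-⟦⟧ e ρ p)) (sym (dot-⊖ (coeffs e) _)))

-- In each coordinate both expressions are dot products of their coefficient vectors with the values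
-- of the variables. For closed expressions these vectors compute, so `refl` decides the identity.
solveᴸ : ∀ {n r} (ρ : Vec (Lattice r) n) (e f : Expr n) → coeffs e ≡ coeffs f → ⟦ e ⟧ ρ ≡ ⟦ f ⟧ ρ
solveᴸ ρ e f h = lattice-ext λ p →
  trans (lookup-⟦⟧ e ρ p) (trans (cong (λ c → dot c (Vec.map (λ x → lookup x p) ρ)) h) (sym (lookup-⟦⟧ f ρ p)))

⊕-identityʳ : ∀ {r} (x : Lattice r) → x ⊕ 𝟎 ≡ x
⊕-identityʳ x = solveᴸ (x ∷ []) (v₀ ∔ :0) v₀ refl

⊝-𝟎 : ∀ {r} (x : Lattice r) → x ⊝ 𝟎 ≡ x
⊝-𝟎 x = solveᴸ (x ∷ []) (v₀ :- :0) v₀ refl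

⊝-self : ∀ {r} (x : Lattice r) → x ⊝ x ≡ 𝟎
⊝-self x = solveᴸ (x ∷ []) (v₀ :- v₀) :0 refl

⊝-⊕ : ∀ {r} (x y : Lattice r) → (x ⊝ y) ⊕ y ≡ x
⊝-⊕ x y = solveᴸ (x ∷ y ∷ []) ((v₀ :- v₁) ∔ v₁) v₀ refl

⊕-⊝ : ∀ {r} (x y : Lattice r) → (x ⊕ y) ⊝ y ≡ x
⊕-⊝ x y = solveᴸ (x ∷ y ∷ []) ((v₀ ∔ v₁) :- v₁) v₀ refl

⊝-suc : ∀ {r} (x d : Lattice r) l → x ⊝ suc l · d ≡ (x ⊝ d) ⊝ l · d
⊝-suc x d l = solveᴸ (x ∷ d ∷ l · d ∷ []) (v₀ :- (v₁ ∔ v₂)) ((v₀ :- v₁) :- v₂) refl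

+-· : ∀ {r} k l (d : Lattice r) → (k ℕ.+ l) · d ≡ k · d ⊕ l · d
+-· zero    l d = sym (solveᴸ (l · d ∷ []) (:0 ∔ v₀) v₀ refl)
+-· (suc k) l d = trans (cong (d ⊕_) (+-· k l d))
  (solveᴸ (d ∷ k · d ∷ l · d ∷ []) (v₀ ∔ (v₁ ∔ v₂)) ((v₀ ∔ v₁) ∔ v₂) refl)

·-⊖ : ∀ {r} l (d : Lattice r) → l · (⊖ d) ≡ ⊖ (l · d)
·-⊖ zero    d = solveᴸ [] :0 (:- :0) refl
·-⊖ (suc l) d = trans (cong (⊖ d ⊕_) (·-⊖ l d)) (solveᴸ (d ∷ l · d ∷ []) (:- v₀ ∔ :- v₁) (:- (v₀ ∔ v₁)) refl)

ℤ-cancelˡ : ∀ a b c → a ℤ.+ b ≡ a ℤ.+ c → b ≡ c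
ℤ-cancelˡ a b c h = trans (aux a b) (trans (cong (λ t → (ℤ.- a) ℤ.+ t) h) (sym (aux a c)))
  where
  aux : ∀ a b → b ≡ (ℤ.- a) ℤ.+ (a ℤ.+ b)
  aux = solveℤ

record Additive (r : ℕ) : Set where
  field
    fun : Lattice r → ℤ
    add : ∀ x y → fun (x ⊕ y) ≡ fun x ℤ.+ fun y

  zeroᶠ : fun 𝟎 ≡ 0ℤ
  zeroᶠ = ℤ-cancelˡ (fun 𝟎) _ _ (trans (sym (add 𝟎 𝟎)) (trans (cong fun (⊕-identityʳ 𝟎)) (sym (ℤP.+-identityʳ _))))

  negᶠ : ∀ x → fun (⊖ x) ≡ ℤ.- fun x
  negᶠ x = ℤ-cancelˡ (fun x) _ _ (trans (sym (add x (⊖ x)))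
    (trans (cong fun (⊝-self x)) (trans zeroᶠ (sym (ℤP.+-inverseʳ (fun x))))))

  subᶠ : ∀ x y → fun (x ⊝ y) ≡ fun x ℤ.- fun y
  subᶠ x y = trans (add x (⊖ y)) (cong (λ t → fun x ℤ.+ t) (negᶠ y))

  mulᶠ : ∀ l x → fun (l · x) ≡ + l ℤ.* fun x
  mulᶠ zero    x = trans zeroᶠ (sym (ℤP.*-zeroˡ (fun x)))
  mulᶠ (suc l) x = trans (add x (l · x)) (trans (cong (λ t → fun x ℤ.+ t) (mulᶠ l x)) (sym (ℤP.suc-* (+ l) (fun x))))

  sub-mulᶠ : ∀ x l d → fun (x ⊝ l · d) ≡ fun x ℤ.- + l ℤ.* fun d
  sub-mulᶠ x l d = trans (subᶠ x (l · d)) (cong (λ t → fun x ℤ.- t) (mulᶠ l d))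

open Additive public

record SkewForm (r : ℕ) : Set where
  field
    ω     : Lattice r → Lattice r → ℤ
    ω-add : ∀ x y z → ω (x ⊕ y) z ≡ ω x z ℤ.+ ω y z
    skew  : ∀ x y → ω x y ≡ ℤ.- ω y x
    alt   : ∀ x → ω x x ≡ 0ℤ

  ωˡ : Lattice r → Additive r
  ωˡ z = record { fun = λ x → ω x z ; add = λ x y → ω-add x y z }

  ωʳ : Lattice r → Additive r
  ωʳ z = record { fun = ω z ; add = λ x y → trans (skew z (x ⊕ y)) (trans (cong ℤ.-_ (ω-add x y z))
    (trans (ℤP.neg-distrib-+ (ω x z) (ω y z)) (cong₂ ℤ._+_ (sym (skew z x)) (sym (skew z y))))) }

-- Finite sums

sumL : {A : Set} → List A → (A → ℚ) → ℚ
sumL []       F = 0ℚ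
sumL (a ∷ as) F = F a ⊞ sumL as F

sumL-cong : {A : Set} (as : List A) {F G : A → ℚ} → (∀ a → F a ≡ G a) → sumL as F ≡ sumL as G
sumL-cong []       h = refl
sumL-cong (a ∷ as) h = cong₂ _⊞_ (h a) (sumL-cong as h)

sumL-zero : {A : Set} (as : List A) {F : A → ℚ} → (∀ a → a ∈ as → F a ≡ 0ℚ) → sumL as F ≡ 0ℚ
sumL-zero []       h = refl
sumL-zero (a ∷ as) h = trans (cong₂ _⊞_ (h a (here refl)) (sumL-zero as (λ b m → h b (there m)))) (𝔽.+-identityˡ 0ℚ)

sumL-add : {A : Set} (as : List A) (F G : A → ℚ) → sumL as (λ a → F a ⊞ G a) ≡ sumL as F ⊞ sumL as G
sumL-add []       F G = sym (𝔽.+-identityˡ 0ℚ)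
sumL-add (a ∷ as) F G = trans (cong ((F a ⊞ G a) ⊞_) (sumL-add as F G)) (aux _ _ _ _)
  where
  aux : ∀ p q s t → (p ⊞ q) ⊞ (s ⊞ t) ≡ (p ⊞ s) ⊞ (q ⊞ t)
  aux = solve 4 (λ p q s t → (p :⊞ q) :⊞ (s :⊞ t) := (p :⊞ s) :⊞ (q :⊞ t)) refl

sumL-scale : {A : Set} (as : List A) (k : ℚ) (F : A → ℚ) → sumL as (λ a → k ⊠ F a) ≡ k ⊠ sumL as F
sumL-scale []       k F = sym (𝔽.zeroʳ k)
sumL-scale (a ∷ as) k F = trans (cong (k ⊠ F a ⊞_) (sumL-scale as k F)) (sym (𝔽.distribˡ k _ _))

sumL-swap : {A B : Set} (as : List A) (bs : List B) (F : A → B → ℚ) →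
  sumL as (λ a → sumL bs (F a)) ≡ sumL bs (λ b → sumL as (λ a → F a b))
sumL-swap []       bs F = sym (sumL-zero bs (λ _ _ → refl))
sumL-swap (a ∷ as) bs F = trans (cong (sumL bs (F a) ⊞_) (sumL-swap as bs F)) (sym (sumL-add bs (F a) _))

at : {r : ℕ} → Lattice r → ℚ → Lattice r → ℚ
at a p b with a ≟ᴸ b
... | yes _ = p
... | no _  = 0ℚ

at-≡ : ∀ {r} (a : Lattice r) p → at a p a ≡ p
at-≡ a p with a ≟ᴸ a
... | yes _ = refl
... | no ne = ⊥-elim (ne refl)

at-≢ : ∀ {r} {a b : Lattice r} p → a ≢ b → at a p b ≡ 0ℚ
at-≢ {a = a} {b} p ne with a ≟ᴸ b
... | yes e = ⊥-elim (ne e)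
... | no _  = refl

sumL-at : ∀ {r} (a : Lattice r) p as → Unique as → (a ∉ as → p ≡ 0ℚ) → sumL as (at a p) ≡ p
sumL-at a p []       u h = sym (h (λ ()))
sumL-at a p (b ∷ as) (b∉ ∷ u) h with a ≟ᴸ b
... | yes refl = trans (cong (p ⊞_) (sumL-zero as λ c m → at-≢ p (All.lookup b∉ m))) (𝔽.+-identityʳ p)
... | no ne    = trans (𝔽.+-identityˡ _) (sumL-at a p as u (λ a∉ → h λ { (here e) → ne e ; (there m) → a∉ m }))

-- Sums range over an infinite lattice and finiteness of a support is not decidable, so the support
-- comes as data: a repetition-free list outside which `F` vanishes. The value does not depend on
-- the list (`hasSum-unique`).
record HasSum {r : ℕ} (F : Lattice r → ℚ) (s : ℚ) : Set where
  field
    supp   : List (Lattice r)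
    unique : Unique supp
    vanish : ∀ a → a ∉ supp → F a ≡ 0ℚ
    value  : sumL supp F ≡ s

open HasSum public

dedup : ∀ {r} → List (Lattice r) → List (Lattice r)
dedup = List.deduplicate _≟ᴸ_

dedup-unique : ∀ {r} (as : List (Lattice r)) → Unique (dedup as)
dedup-unique as = UniqueP.deduplicate-! _≟ᴸ_ as

∈-dedup : ∀ {r} {as : List (Lattice r)} {a} → a ∈ as → a ∈ dedup as
∈-dedup = ∈P.∈-deduplicate⁺ _≟ᴸ_

-- Double counting over the graph {(a , ι b)} compares the two sums.
sumL-pull : ∀ {r t} (ι : Lattice t → Lattice r) (π : Lattice r → Lattice t) → (∀ b → π (ι b) ≡ b) →
  (F : Lattice r → ℚ) → (∀ a → ι (π a) ≢ a → F a ≡ 0ℚ) →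
  ∀ as bs → Unique as → Unique bs → (∀ a → a ∉ as → F a ≡ 0ℚ) → (∀ b → b ∉ bs → F (ι b) ≡ 0ℚ) →
  sumL bs (F ∘ ι) ≡ sumL as F
sumL-pull ι π πι F off as bs ua ub va vb =
  trans (sumL-cong bs (λ b → sym (sumL-at (ι b) (F (ι b)) as ua (va (ι b)))))
  (trans (sumL-swap bs as (λ b a → at (ι b) (F (ι b)) a))
         (sumL-cong as column))
  where
  column : ∀ a → sumL bs (λ b → at (ι b) (F (ι b)) a) ≡ F a
  column a with ι (π a) ≟ᴸ a
  ... | no ne = trans (sumL-zero bs λ b _ → at-≢ _ λ e → ne (trans (cong ι (trans (cong π (sym e)) (πι b))) e)) (sym (off a ne))
  ... | yes e = trans (sumL-cong bs cell) (sumL-at (π a) (F a) bs ub (λ n → trans (cong F (sym e)) (vb (π a) n)))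
    where
    cell : ∀ b → at (ι b) (F (ι b)) a ≡ at (π a) (F a) b
    cell b with ι b ≟ᴸ a
    ... | yes refl = sym (trans (cong (λ z → at z (F (ι b)) b) (πι b)) (at-≡ b _))
    ... | no ne    = sym (at-≢ _ λ e′ → ne (trans (cong ι (sym e′)) e))

-- `sumL-pull` with both maps the identity; every list that covers the support thus computes the
-- same sum.
hasSum-list : ∀ {r} {F : Lattice r → ℚ} {s} → HasSum F s → ∀ as → Unique as → (∀ a → a ∉ as → F a ≡ 0ℚ) → sumL as F ≡ s
hasSum-list {F = F} h as u v =
  trans (sumL-pull id id (λ _ → refl) F (λ a ne → ⊥-elim (ne refl)) (supp h) as (unique h) u (vanish h) v) (value h)

hasSum-unique : ∀ {r} {F : Lattice r → ℚ} {s t} → HasSum F s → HasSum F t → s ≡ t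
hasSum-unique h k = trans (sym (value h)) (hasSum-list k (supp h) (unique h) (vanish h))

hasSum-cong : ∀ {r} {F G : Lattice r → ℚ} {s} → (∀ a → F a ≡ G a) → HasSum F s → HasSum G s
hasSum-cong e h = record { supp = supp h ; unique = unique h
  ; vanish = λ a n → trans (sym (e a)) (vanish h a n)
  ; value = trans (sumL-cong (supp h) (λ a → sym (e a))) (value h) }

hasSum-zero : ∀ {r} {F : Lattice r → ℚ} → (∀ a → F a ≡ 0ℚ) → HasSum F 0ℚ
hasSum-zero e = record { supp = [] ; unique = [] ; vanish = λ a _ → e a ; value = refl }

hasSum-at : ∀ {r} (a : Lattice r) p → HasSum (at a p) p
hasSum-at a p = record { supp = a ∷ [] ; unique = [] ∷ []
  ; vanish = λ b n → at-≢ p (λ e → n (here (sym e)))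
  ; value = trans (𝔽.+-identityʳ _) (at-≡ a p) }
  where open import Data.List.Relation.Unary.All using ([])

hasSum-scale : ∀ {r} {F : Lattice r → ℚ} {s} k → HasSum F s → HasSum (λ a → k ⊠ F a) (k ⊠ s)
hasSum-scale {F = F} k h = record { supp = supp h ; unique = unique h
  ; vanish = λ a n → trans (cong (k ⊠_) (vanish h a n)) (𝔽.zeroʳ k)
  ; value = trans (sumL-scale (supp h) k F) (cong (k ⊠_) (value h)) }

hasSum-add : ∀ {r} {F G : Lattice r → ℚ} {s t} → HasSum F s → HasSum G t → HasSum (λ a → F a ⊞ G a) (s ⊞ t)
hasSum-add {F = F} {G} h k = record { supp = L ; unique = dedup-unique _
  ; vanish = λ a n → trans (cong₂ _⊞_ (vF a n) (vG a n)) (𝔽.+-identityˡ 0ℚ)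
  ; value = trans (sumL-add L F G) (cong₂ _⊞_ (hasSum-list h L (dedup-unique _) vF) (hasSum-list k L (dedup-unique _) vG)) }
  where
  L = dedup (supp h ++ supp k)
  vF : ∀ a → a ∉ L → F a ≡ 0ℚ
  vF a n = vanish h a (λ m → n (∈-dedup (∈P.∈-++⁺ˡ m)))
  vG : ∀ a → a ∉ L → G a ≡ 0ℚ
  vG a n = vanish k a (λ m → n (∈-dedup (∈P.∈-++⁺ʳ (supp h) m)))

-- The change of variables behind translations by `l · d`, the transvection `T` and the inclusion of
-- the sublattice of C: a function that vanishes off the image of `ι` loses nothing when pulled
-- back.
hasSum-pull : ∀ {r t} (ι : Lattice t → Lattice r) (π : Lattice r → Lattice t) → (∀ b → π (ι b) ≡ b) →
  {F : Lattice r → ℚ} {s : ℚ} → (∀ a → ι (π a) ≢ a → F a ≡ 0ℚ) → HasSum F s → HasSum (F ∘ ι) s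
hasSum-pull ι π πι {F} off h = record { supp = L ; unique = dedup-unique _ ; vanish = v
  ; value = trans (sumL-pull ι π πι F off (supp h) L (unique h) (dedup-unique _) (vanish h) v) (value h) }
  where
  L = dedup (List.map π (supp h))
  v : ∀ b → b ∉ L → F (ι b) ≡ 0ℚ
  v b n = vanish h (ι b) (λ m → n (∈-dedup (subst (_∈ List.map π (supp h)) (πι b) (∈P.∈-map⁺ π m))))

-- Sums over initial segments and antidiagonals of ℕ.

opaque
  sumN : ℕ → (ℕ → ℚ) → ℚ
  sumN zero    F = 0ℚ
  sumN (suc n) F = F 0 ⊞ sumN n (F ∘ suc)

  sumN-suc : ∀ n (F : ℕ → ℚ) → sumN (suc n) F ≡ F 0 ⊞ sumN n (F ∘ suc)
  sumN-suc n F = refl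

  sumN-cong : ∀ n {F G : ℕ → ℚ} → (∀ l → F l ≡ G l) → sumN n F ≡ sumN n G
  sumN-cong zero    h = refl
  sumN-cong (suc n) h = cong₂ _⊞_ (h 0) (sumN-cong n (h ∘ suc))

  sumN-zero : ∀ n {F : ℕ → ℚ} → (∀ l → F l ≡ 0ℚ) → sumN n F ≡ 0ℚ
  sumN-zero zero    h = refl
  sumN-zero (suc n) h = trans (cong₂ _⊞_ (h 0) (sumN-zero n (h ∘ suc))) (𝔽.+-identityˡ 0ℚ)

  sumN-first : ∀ n {F : ℕ → ℚ} → (∀ l → F (suc l) ≡ 0ℚ) → sumN (suc n) F ≡ F 0
  sumN-first n {F} h = trans (cong (F 0 ⊞_) (sumN-zero n h)) (𝔽.+-identityʳ (F 0))

  sumN-add : ∀ n (F G : ℕ → ℚ) → sumN n (λ l → F l ⊞ G l) ≡ sumN n F ⊞ sumN n G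
  sumN-add zero    F G = sym (𝔽.+-identityˡ 0ℚ)
  sumN-add (suc n) F G = trans (cong ((F 0 ⊞ G 0) ⊞_) (sumN-add n (F ∘ suc) (G ∘ suc))) (aux _ _ _ _)
    where
    aux : ∀ p q s t → (p ⊞ q) ⊞ (s ⊞ t) ≡ (p ⊞ s) ⊞ (q ⊞ t)
    aux = solve 4 (λ p q s t → (p :⊞ q) :⊞ (s :⊞ t) := (p :⊞ s) :⊞ (q :⊞ t)) refl

  sumN-scale : ∀ n (k : ℚ) (F : ℕ → ℚ) → sumN n (λ l → k ⊠ F l) ≡ k ⊠ sumN n F
  sumN-scale zero    k F = sym (𝔽.zeroʳ k)
  sumN-scale (suc n) k F = trans (cong (k ⊠ F 0 ⊞_) (sumN-scale n k (F ∘ suc))) (sym (𝔽.distribˡ k _ _))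

  sumN-extend : ∀ {m n} (F : ℕ → ℚ) → m ℕ.≤ n → (∀ l → m ℕ.≤ l → F l ≡ 0ℚ) → sumN n F ≡ sumN m F
  sumN-extend {n = n} F z≤n h = sumN-zero n (λ l → h l z≤n)
  sumN-extend F (s≤s m≤n) h = cong (F 0 ⊞_) (sumN-extend (F ∘ suc) m≤n (λ l q → h (suc l) (s≤s q)))

  hasSum-sumN : ∀ {r} n {F : ℕ → Lattice r → ℚ} {s : ℕ → ℚ} → (∀ l → HasSum (F l) (s l)) →
    HasSum (λ a → sumN n (λ l → F l a)) (sumN n s)
  hasSum-sumN zero    h = hasSum-zero (λ _ → refl)
  hasSum-sumN (suc n) h = hasSum-add (h 0) (hasSum-sumN n (h ∘ suc))

-- The sum of `a l m` over l + m = k, that is, the coefficient of degree `k` in a Cauchy product of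
-- power series.
diagonal : ℕ → (ℕ → ℕ → ℚ) → ℚ
diagonal zero    a = a 0 0
diagonal (suc k) a = a 0 (suc k) ⊞ diagonal k (λ l m → a (suc l) m)

opaque
  unfolding sumN

  -- Terms with l + m ≥ L vanish, so the square is really a triangle. Peeling off its first row
  -- leaves a triangle of size one less, shifted by one in `l`.
  sumN-diagonals : ∀ L (a : ℕ → ℕ → ℚ) → (∀ l m → L ℕ.≤ l ℕ.+ m → a l m ≡ 0ℚ) →
    sumN L (λ l → sumN L (a l)) ≡ sumN L (λ k → diagonal k a)
  sumN-diagonals zero    a v = refl
  sumN-diagonals (suc L) a v = trans (cong (sumN (suc L) (a 0) ⊞_) (trans (sumN-cong L rows) (sumN-diagonals L a⁺ v⁺)))
    (trans (𝔽.+-assoc (a 0 0) _ _) (cong (a 0 0 ⊞_) (sym (sumN-add L (λ k → a 0 (suc k)) (λ k → diagonal k a⁺)))))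
    where
    a⁺ : ℕ → ℕ → ℚ
    a⁺ l m = a (suc l) m
    v⁺ : ∀ l m → L ℕ.≤ l ℕ.+ m → a⁺ l m ≡ 0ℚ
    v⁺ l m q = v (suc l) m (s≤s q)
    rows : ∀ l → sumN (suc L) (a (suc l)) ≡ sumN L (a⁺ l)
    rows l = sumN-extend (a (suc l)) (ℕP.n≤1+n L) (λ m q → v⁺ l m (ℕP.≤-trans q (ℕP.m≤n+m m l)))

diagonal-cong : ∀ k {a b : ℕ → ℕ → ℚ} → (∀ l m → l ℕ.+ m ≡ k → a l m ≡ b l m) → diagonal k a ≡ diagonal k b
diagonal-cong zero    h = h 0 0 refl
diagonal-cong (suc k) h = cong₂ _⊞_ (h 0 (suc k) refl) (diagonal-cong k (λ l m q → h (suc l) m (cong suc q)))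

diagonal-scaleʳ : ∀ k (a : ℕ → ℕ → ℚ) p → diagonal k (λ l m → a l m ⊠ p) ≡ diagonal k a ⊠ p
diagonal-scaleʳ zero    a p = refl
diagonal-scaleʳ (suc k) a p = trans (cong (a 0 (suc k) ⊠ p ⊞_) (diagonal-scaleʳ k (λ l m → a (suc l) m) p)) (sym (𝔽.distribʳ p _ _))

diagonal-end : ∀ k (a : ℕ → ℕ → ℚ) → diagonal (suc k) a ≡ diagonal k (λ l m → a l (suc m)) ⊞ a (suc k) 0
diagonal-end zero    a = refl
diagonal-end (suc k) a = trans (cong (a 0 (suc (suc k)) ⊞_) (diagonal-end k (λ l m → a (suc l) m))) (sym (𝔽.+-assoc (a 0 (suc (suc k))) _ _))

diagonal-flip : ∀ k (a : ℕ → ℕ → ℚ) → diagonal k a ≡ diagonal k (λ l m → a m l)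
diagonal-flip zero    a = refl
diagonal-flip (suc k) a = trans (cong (a 0 (suc k) ⊞_) (diagonal-flip k (λ l m → a (suc l) m)))
  (trans (𝔽.+-comm (a 0 (suc k)) _) (sym (diagonal-end k (λ l m → a m l))))

-- The quantum dilogarithm

pow : ℚ → ℕ → ℚ
pow p zero    = 1ℚ
pow p (suc n) = p ⊠ pow p n

two half : ℚ
two  = 1ℚ ℚ.+ 1ℚ
half = ℚ.½

opaque
  unfolding _⊠_

  two⊠half : two ⊠ half ≡ 1ℚ
  two⊠half = refl

  1≤pow-two : ∀ n → 1ℚ ℚ.≤ pow two n
  1≤pow-two zero    = ℚP.≤-refl
  1≤pow-two (suc n) = ℚP.≤-trans (ℚP.≤-trans (from-yes (1ℚ ℚP.≤? two)) (ℚP.≤-reflexive (sym (ℚP.*-identityʳ two))))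
    (ℚP.*-monoˡ-≤-nonNeg two (1≤pow-two n))

  pow-half≤1 : ∀ n → pow half n ℚ.≤ 1ℚ
  pow-half≤1 zero    = ℚP.≤-refl
  pow-half≤1 (suc n) = ℚP.≤-trans (ℚP.*-monoˡ-≤-nonNeg half (pow-half≤1 n))
    (ℚP.≤-trans (ℚP.≤-reflexive (ℚP.*-identityʳ half)) (from-yes (half ℚP.≤? 1ℚ)))

  -- The powers are separated by 1: (1/2)^(n+1) ≤ 1 < 2 ≤ 2^(n+1). Here it enters that t = 2 is not
  -- a root of unity.
  pow-half≢pow-two : ∀ n → pow half (suc n) ≢ pow two (suc n)
  pow-half≢pow-two n e = from-no (two ℚP.≤? 1ℚ) (ℚP.≤-trans
    (ℚP.≤-trans (ℚP.≤-reflexive (sym (ℚP.*-identityʳ two))) (ℚP.*-monoˡ-≤-nonNeg two (1≤pow-two n)))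
    (ℚP.≤-trans (ℚP.≤-reflexive (sym e)) (pow-half≤1 (suc n))))

-- The power of t with an integer exponent, at t = 2.
twist : ℤ → ℚ
twist (+ n)    = pow two n
twist -[1+ n ] = pow half (suc n)

pow-+ : ∀ p m n → pow p (m ℕ.+ n) ≡ pow p m ⊠ pow p n
pow-+ p zero    n = sym (𝔽.*-identityˡ _)
pow-+ p (suc m) n = trans (cong (p ⊠_) (pow-+ p m n)) (sym (𝔽.*-assoc p _ _))

twist-⊖ : ∀ m n → twist (m ℤ.⊖ n) ≡ pow two m ⊠ pow half n
twist-⊖ m       zero    = sym (𝔽.*-identityʳ _)
twist-⊖ zero    (suc n) = sym (𝔽.*-identityˡ _)
twist-⊖ (suc m) (suc n) = trans (cong twist (ℤP.[1+m]⊖[1+n]≡m⊖n m n)) (trans (twist-⊖ m n)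
  (sym (trans (aux two (pow two m) half (pow half n)) (trans (cong (_⊠ (pow two m ⊠ pow half n)) two⊠half) (𝔽.*-identityˡ _)))))
  where
  aux : ∀ p q s t → (p ⊠ q) ⊠ (s ⊠ t) ≡ (p ⊠ s) ⊠ (q ⊠ t)
  aux = solve 4 (λ p q s t → (p :⊠ q) :⊠ (s :⊠ t) := (p :⊠ s) :⊠ (q :⊠ t)) refl

twist-+ : ∀ a b → twist (a ℤ.+ b) ≡ twist a ⊠ twist b
twist-+ (+ m)    (+ n)    = pow-+ two m n
twist-+ (+ m)    -[1+ n ] = twist-⊖ m (suc n)
twist-+ -[1+ m ] (+ n)    = trans (twist-⊖ n (suc m)) (𝔽.*-comm _ _)
twist-+ -[1+ m ] -[1+ n ] = trans (cong (λ k → pow half (suc k)) (sym (ℕP.+-suc m n))) (pow-+ half (suc m) (suc n))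

twist-cancel : ∀ a → twist a ⊠ twist (ℤ.- a) ≡ 1ℚ
twist-cancel a = trans (sym (twist-+ a (ℤ.- a))) (cong twist (ℤP.+-inverseʳ a))

-- The factor t^(-n-1) - t^(n+1) that multiplies the coefficient of degree n + 1 in E(t⁻¹z) - E(tz);
-- the recursion for `dilog` divides by it.
gap : ℕ → ℚ
gap n = pow half (suc n) ⊞ neg (pow two (suc n))

gap≢0 : ∀ n → gap n ≢ 0ℚ
gap≢0 n e = pow-half≢pow-two n (𝔽-unneg _ _ e)
  where
  𝔽-unneg : ∀ p q → p ⊞ neg q ≡ 0ℚ → p ≡ q
  𝔽-unneg p q h = trans (sym (𝔽.+-identityʳ p)) (trans (cong (p ⊞_) (sym (𝔽.-‿inverseˡ q)))
    (trans (sym (𝔽.+-assoc p (neg q) q)) (trans (cong (_⊞ q) h) (𝔽.+-identityˡ q))))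

-- The quantum dilogarithm E(z) = Σ dilog l zˡ at t = 2, the solution of E(t⁻¹z) = (1 + z) E(tz).
dilog : ℕ → ℚ
dilog zero    = 1ℚ
dilog (suc l) = (dilog l ⊠ pow two l) ⊠ proj₁ (inverse (gap l) (gap≢0 l))

dilog-step : ∀ l → dilog (suc l) ⊠ pow half (suc l) ≡ dilog (suc l) ⊠ pow two (suc l) ⊞ dilog l ⊠ pow two l
dilog-step l = sym (begin
  e ⊠ b ⊞ d                        ≡⟨ cong (e ⊠ b ⊞_) (sym e⊠gap) ⟩
  e ⊠ b ⊞ e ⊠ (a ⊞ neg b)          ≡⟨ sym (𝔽.distribˡ e b (a ⊞ neg b)) ⟩
  e ⊠ (b ⊞ (a ⊞ neg b))            ≡⟨ cong (e ⊠_) cancel ⟩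
  e ⊠ a                            ∎)
  where
  open ≡-Reasoning
  a b d e : ℚ
  a = pow half (suc l)
  b = pow two (suc l)
  d = dilog l ⊠ pow two l
  e = dilog (suc l)
  e⊠gap : e ⊠ (a ⊞ neg b) ≡ d
  e⊠gap = trans (𝔽.*-assoc d _ _) (trans (cong (d ⊠_) (trans (𝔽.*-comm _ _) (proj₂ (inverse (gap l) (gap≢0 l))))) (𝔽.*-identityʳ d))
  cancel : b ⊞ (a ⊞ neg b) ≡ a
  cancel = trans (cong (b ⊞_) (𝔽.+-comm a (neg b))) (trans (sym (𝔽.+-assoc b (neg b) a))
    (trans (cong (_⊞ a) (𝔽.-‿inverseʳ b)) (𝔽.+-identityˡ a)))

0≢1 : 0ℚ ≢ 1ℚ
0≢1 ()

-- This coefficient is the inverse of `gap 0`. It is the value of a Donaldson-Thomas element at each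
-- c-vector of its seed, so no c-vector can escape the support; sign-coherence rests on that.
dilog-1≢0 : dilog 1 ≢ 0ℚ
dilog-1≢0 h = 0≢1 (trans (trans (sym (𝔽.zeroʳ (gap 0))) (cong (gap 0 ⊠_) (sym e1))) (proj₂ (inverse (gap 0) (gap≢0 0))))
  where
  e1 : proj₁ (inverse (gap 0) (gap≢0 0)) ≡ 0ℚ
  e1 = trans (sym (trans (cong (_⊠ proj₁ (inverse (gap 0) (gap≢0 0))) (𝔽.*-identityˡ 1ℚ)) (𝔽.*-identityˡ _))) h

module Inverse where
  weigh : List ℚ → (ℕ → ℚ) → ℚ
  weigh []       g = 0ℚ
  weigh (p ∷ ps) g = g 0 ⊠ p ⊞ weigh ps (g ∘ suc)

  -- Course-of-values recursion: a new coefficient of 1/E needs all earlier ones, so the list keeps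
  -- those of degrees `n` down to 0, latest first.
  history : ℕ → List ℚ
  history zero    = 1ℚ ∷ []
  history (suc n) = neg (weigh (history n) (dilog ∘ suc)) ∷ history n

  latest : List ℚ → ℚ
  latest []      = 0ℚ
  latest (p ∷ _) = p

open Inverse

-- The coefficients of the reciprocal series 1/E, not the reciprocals of the coefficients.
dilog⁻¹ : ℕ → ℚ
dilog⁻¹ n = latest (history n)

weigh-history : ∀ n (g : ℕ → ℚ) → weigh (history n) g ≡ diagonal n (λ l m → g l ⊠ dilog⁻¹ m)
weigh-history zero    g = 𝔽.+-identityʳ _
weigh-history (suc n) g = cong (g 0 ⊠ dilog⁻¹ (suc n) ⊞_) (weigh-history n (g ∘ suc))

δ₀ : ℕ → ℚ
δ₀ zero    = 1ℚ
δ₀ (suc _) = 0ℚ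

dilog⊛dilog⁻¹ : ∀ k → diagonal k (λ l m → dilog l ⊠ dilog⁻¹ m) ≡ δ₀ k
dilog⊛dilog⁻¹ zero    = 𝔽.*-identityˡ 1ℚ
dilog⊛dilog⁻¹ (suc k) = trans (cong₂ _⊞_ (𝔽.*-identityˡ (dilog⁻¹ (suc k))) (sym (weigh-history k (dilog ∘ suc))))
  (𝔽.-‿inverseˡ _)

dilog⁻¹⊛dilog : ∀ k → diagonal k (λ l m → dilog⁻¹ l ⊠ dilog m) ≡ δ₀ k
dilog⁻¹⊛dilog k = trans (diagonal-flip k _) (trans (diagonal-cong k (λ l m _ → 𝔽.*-comm (dilog⁻¹ m) (dilog l))) (dilog⊛dilog⁻¹ k))

-- Power series acting by translations

infix 4 0≤_

0≤_ : ℤ → Set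
0≤ z = 0ℤ ℤ.≤ z

0≤-+ : ∀ {a b} → 0≤ a → 0≤ b → 0≤ a ℤ.+ b
0≤-+ p q = ℤP.+-mono-≤ p q

0≤-* : ∀ {a b} → 0≤ a → 0≤ b → 0≤ a ℤ.* b
0≤-* {+ a} {+ b} _ _ = subst 0≤_ (ℤP.pos-* a b) (ℤ.+≤+ z≤n)
0≤-* { -[1+ a ]} ()
0≤-* {+ a} { -[1+ b ]} _ ()

0≤-nat : ∀ {n} → 0≤ + n
0≤-nat = ℤ.+≤+ z≤n

-- The inequality z ≤ -1 is encoded as a nonnegativity, so that bounds are added by `0≤-+` and
-- rearranged by the ring solver.
Negative : ℤ → Set
Negative z = 0≤ ℤ.- 1ℤ ℤ.- z

¬both : ∀ {z} → 0≤ z → Negative z → ⊥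
¬both {z} p q = absurd (subst 0≤_ (aux z) (0≤-+ p q))
  where
  absurd : 0≤ ℤ.- 1ℤ → ⊥
  absurd ()
  aux : ∀ z → z ℤ.+ (ℤ.- 1ℤ ℤ.- z) ≡ ℤ.- 1ℤ
  aux = solveℤ

sign? : ∀ z → 0≤ z ⊎ Negative z
sign? (+ n)    = inj₁ 0≤-nat
sign? -[1+ n ] = inj₂ 0≤-nat

∣∣-bound : ∀ z {L} → suc ∣ z ∣ ℕ.≤ L → 0≤ + L ℤ.- 1ℤ ℤ.- z
∣∣-bound z {suc L} (s≤s q) = subst 0≤_ (aux (+ L) z) (ℤP.i≤j⇒0≤j-i (ℤP.≤-trans (z≤∣z∣ z) (ℤ.+≤+ q)))
  where
  aux : ∀ l z → l ℤ.- z ≡ (1ℤ ℤ.+ l) ℤ.- 1ℤ ℤ.- z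
  aux = solveℤ
  z≤∣z∣ : ∀ z → z ℤ.≤ + ∣ z ∣
  z≤∣z∣ (+ n)    = ℤP.≤-refl
  z≤∣z∣ -[1+ n ] = ℤ.-≤+

SupportedOn : ∀ {r} → Additive r → (Lattice r → ℚ) → Set
SupportedOn φ f = ∀ x → Negative (fun φ x) → f x ≡ 0ℚ

module Operators {r : ℕ} where

  private
    L : Set
    L = Lattice r

  term : ℤ → (ℕ → ℚ) → L → (L → ℚ) → L → ℕ → ℚ
  term κ g d f x l = (g l ⊠ twist (κ ℤ.* + l)) ⊠ f (x ⊝ l · d)

  -- The action of the power series g on f by powers of the translation by d, scaled by t^κ.
  act : Additive r → ℤ → (ℕ → ℚ) → L → (L → ℚ) → L → ℚ
  act φ κ g d f x = sumN (suc ∣ fun φ x ∣) (term κ g d f x)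

  module _ (φ : Additive r) (d : L) (φd : 0≤ fun φ d ℤ.- 1ℤ) where

    shift-negative : ∀ {x} M → 0≤ + M ℤ.- 1ℤ ℤ.- fun φ x → ∀ l → M ℕ.≤ l → Negative (fun φ (x ⊝ l · d))
    shift-negative {x} M b l q = subst 0≤_ (sym (trans (cong (λ t → ℤ.- 1ℤ ℤ.- t) (sub-mulᶠ φ x l d)) (aux (+ l) (+ M) (fun φ x) (fun φ d))))
      (0≤-+ (0≤-+ b (ℤP.i≤j⇒0≤j-i (ℤ.+≤+ q))) (0≤-* {+ l} 0≤-nat φd))
      where
      aux : ∀ l m x d → ℤ.- 1ℤ ℤ.- (x ℤ.- l ℤ.* d) ≡ m ℤ.- 1ℤ ℤ.- x ℤ.+ (l ℤ.- m) ℤ.+ l ℤ.* (d ℤ.- 1ℤ)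
      aux = solveℤ

    module _ {f : L → ℚ} (bf : SupportedOn φ f) where

      term-vanish : ∀ κ g {x} M → 0≤ + M ℤ.- 1ℤ ℤ.- fun φ x → ∀ l → M ℕ.≤ l → term κ g d f x l ≡ 0ℚ
      term-vanish κ g {x} M b l q = ⊠-zeroʳ (bf (x ⊝ l · d) (shift-negative M b l q))

      -- Terms with `l` beyond `φ x` evaluate `f` where `φ` is negative. The truncation in `act` is
      -- therefore the full sum, and any other sufficient bound `M`, for instance one common to
      -- several points, may replace it.
      act-bound : ∀ κ g {x} M → 0≤ + M ℤ.- 1ℤ ℤ.- fun φ x → sumN M (term κ g d f x) ≡ act φ κ g d f x
      act-bound κ g {x} M b with ℕP.≤-total M (suc ∣ fun φ x ∣)
      ... | inj₁ q = sym (sumN-extend (term κ g d f x) q (term-vanish κ g M b))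
      ... | inj₂ q = sumN-extend (term κ g d f x) q (term-vanish κ g (suc ∣ fun φ x ∣) (∣∣-bound (fun φ x) ℕP.≤-refl))

  act-cong : ∀ φ κ g d {f f′ : L → ℚ} x → (∀ l → f (x ⊝ l · d) ≡ f′ (x ⊝ l · d)) → act φ κ g d f x ≡ act φ κ g d f′ x
  act-cong φ κ g d x h = sumN-cong (suc ∣ fun φ x ∣) (λ l → cong (_ ⊠_) (h l))

  act-zero : ∀ φ κ g d {f : L → ℚ} x → (∀ l → f (x ⊝ l · d) ≡ 0ℚ) → act φ κ g d f x ≡ 0ℚ
  act-zero φ κ g d x h = sumN-zero (suc ∣ fun φ x ∣) (λ l → ⊠-zeroʳ (h l))

  act-head : ∀ φ κ g d {f : L → ℚ} x → g 0 ≡ 1ℚ → (∀ l → f (x ⊝ suc l · d) ≡ 0ℚ) → act φ κ g d f x ≡ f x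
  act-head φ κ g d {f} x g0 h = trans (sumN-first ∣ fun φ x ∣ (λ l → ⊠-zeroʳ (h l)))
    (trans (cong₂ _⊠_ (trans (cong₂ _⊠_ g0 (cong twist (ℤP.*-zeroʳ κ))) (𝔽.*-identityˡ 1ℚ)) (cong f (⊝-𝟎 x))) (𝔽.*-identityˡ (f x)))

  act-supported : ∀ φ κ g d {f : L → ℚ} ψ → 0≤ fun ψ d → SupportedOn ψ f → ∀ x → Negative (fun ψ x) → act φ κ g d f x ≡ 0ℚ
  act-supported φ κ g d {f} ψ ψd b x nx = act-zero φ κ g d {f} x λ l → b (x ⊝ l · d)
    (subst 0≤_ (sym (trans (cong (λ t → ℤ.- 1ℤ ℤ.- t) (sub-mulᶠ ψ x l d)) (aux (fun ψ x) (+ l ℤ.* fun ψ d)))) (0≤-+ nx (0≤-* {+ l} 0≤-nat ψd)))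
    where
    aux : ∀ x y → ℤ.- 1ℤ ℤ.- (x ℤ.- y) ≡ ℤ.- 1ℤ ℤ.- x ℤ.+ y
    aux = solveℤ

  -- The functional serves only to truncate: both values equal the sum up to a bound that suffices
  -- for both. The dual basis of a seed can thus be traded for `total`, which is the same for all
  -- seeds.
  act-switch : ∀ φ φ′ κ g d {f : L → ℚ} x → 0≤ fun φ d ℤ.- 1ℤ → 0≤ fun φ′ d ℤ.- 1ℤ → SupportedOn φ f → SupportedOn φ′ f →
    act φ κ g d f x ≡ act φ′ κ g d f x
  act-switch φ φ′ κ g d {f} x φd φ′d b b′ = trans (sym (act-bound φ d φd b κ g M (∣∣-bound (fun φ x) (ℕP.m≤m+n (suc ∣ fun φ x ∣) _))))
    (act-bound φ′ d φ′d b′ κ g M (∣∣-bound (fun φ′ x) (ℕP.m≤n+m _ (suc ∣ fun φ x ∣))))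
    where M = suc ∣ fun φ x ∣ ℕ.+ suc ∣ fun φ′ x ∣

  ⊝-+· : ∀ (x d : L) k l → (x ⊝ k · d) ⊝ l · d ≡ x ⊝ (k ℕ.+ l) · d
  ⊝-+· x d k l = trans (solveᴸ (x ∷ k · d ∷ l · d ∷ []) ((v₀ :- v₁) :- v₂) (v₀ :- (v₁ ∔ v₂)) refl) (cong (x ⊝_) (sym (+-· k l d)))

  module _ (φ : Additive r) (d : L) (φd : 0≤ fun φ d ℤ.- 1ℤ) {f : L → ℚ} (bf : SupportedOn φ f) where

    -- For fixed `κ` the series act through powers of one operator, so composition is the Cauchy
    -- product; summing along l + m = k leaves only k = 0.
    act-inverse : ∀ κ g h → (∀ k → diagonal k (λ l m → g l ⊠ h m) ≡ δ₀ k) →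
      ∀ x → act φ κ g d (act φ κ h d f) x ≡ f x
    act-inverse κ g h gh x = begin
      sumN M (λ l → (g l ⊠ twist (κ ℤ.* + l)) ⊠ act φ κ h d f (x ⊝ l · d))
        ≡⟨ sumN-cong M (λ l → cong ((g l ⊠ twist (κ ℤ.* + l)) ⊠_) (sym (act-bound φ d φd bf κ h M (inner l)))) ⟩
      sumN M (λ l → (g l ⊠ twist (κ ℤ.* + l)) ⊠ sumN M (term κ h d f (x ⊝ l · d)))
        ≡⟨ sumN-cong M (λ l → trans (sym (sumN-scale M _ _)) (sumN-cong M (regroup l))) ⟩
      sumN M (λ l → sumN M (λ m → (g l ⊠ h m) ⊠ F (l ℕ.+ m)))
        ≡⟨ sumN-diagonals M _ (λ l m q → ⊠-zeroʳ (Fvanish (l ℕ.+ m) q)) ⟩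
      sumN M (λ k → diagonal k (λ l m → (g l ⊠ h m) ⊠ F (l ℕ.+ m)))
        ≡⟨ sumN-cong M (λ k → trans (diagonal-cong k (λ l m e → cong (λ j → (g l ⊠ h m) ⊠ F j) e)) (trans (diagonal-scaleʳ k _ (F k)) (cong (_⊠ F k) (gh k)))) ⟩
      sumN M (λ k → δ₀ k ⊠ F k)
        ≡⟨ sumN-first _ (λ l → 𝔽.zeroˡ _) ⟩
      1ℚ ⊠ F 0
        ≡⟨ 𝔽.*-identityˡ _ ⟩
      F 0
        ≡⟨ trans (cong₂ _⊠_ (cong twist (ℤP.*-zeroʳ κ)) (cong f (⊝-𝟎 x))) (𝔽.*-identityˡ (f x)) ⟩
      f x ∎
      where
      open ≡-Reasoning
      M = suc ∣ fun φ x ∣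
      F : ℕ → ℚ
      F k = twist (κ ℤ.* + k) ⊠ f (x ⊝ k · d)
      inner : ∀ l → 0≤ + M ℤ.- 1ℤ ℤ.- fun φ (x ⊝ l · d)
      inner l = subst 0≤_ (sym (trans (cong (λ t → + M ℤ.- 1ℤ ℤ.- t) (sub-mulᶠ φ x l d)) (aux (+ M) (fun φ x) (+ l) (fun φ d))))
        (0≤-+ (0≤-+ (∣∣-bound (fun φ x) ℕP.≤-refl) (0≤-* {+ l} 0≤-nat φd)) (0≤-nat {l}))
        where
        aux : ∀ m x l d → m ℤ.- 1ℤ ℤ.- (x ℤ.- l ℤ.* d) ≡ m ℤ.- 1ℤ ℤ.- x ℤ.+ l ℤ.* (d ℤ.- 1ℤ) ℤ.+ l
        aux = solveℤ
      regroup : ∀ l m → (g l ⊠ twist (κ ℤ.* + l)) ⊠ term κ h d f (x ⊝ l · d) m ≡ (g l ⊠ h m) ⊠ F (l ℕ.+ m)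
      regroup l m = trans (aux (g l) (twist (κ ℤ.* + l)) (h m) (twist (κ ℤ.* + m)) (f ((x ⊝ l · d) ⊝ m · d)))
        (cong ((g l ⊠ h m) ⊠_) (cong₂ _⊠_ (trans (sym (twist-+ (κ ℤ.* + l) (κ ℤ.* + m))) (cong twist (sym (ℤP.*-distribˡ-+ κ (+ l) (+ m)))))
          (cong f (⊝-+· x d l m))))
        where
        aux : ∀ a b c e f → (a ⊠ b) ⊠ ((c ⊠ e) ⊠ f) ≡ (a ⊠ c) ⊠ ((b ⊠ e) ⊠ f)
        aux = solve 5 (λ a b c e f → (a :⊠ b) :⊠ ((c :⊠ e) :⊠ f) := (a :⊠ c) :⊠ ((b :⊠ e) :⊠ f)) refl
      Fvanish : ∀ k → M ℕ.≤ k → F k ≡ 0ℚ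
      Fvanish k q = ⊠-zeroʳ (bf _ (shift-negative φ d φd M (∣∣-bound (fun φ x) ℕP.≤-refl) k q))

    -- With Z the translation by `d` this reads E(t^(κ-1) Z) = (1 + t^κ Z) E(t^(κ+1) Z), the
    -- functional equation of E; `split` is its coefficient of degree l + 1.
    dilog-act-step : ∀ κ x → act φ (κ ℤ.- 1ℤ) dilog d f x ≡ act φ (κ ℤ.+ 1ℤ) dilog d f x ⊞ twist κ ⊠ act φ (κ ℤ.+ 1ℤ) dilog d f (x ⊝ d)
    dilog-act-step κ x = begin
      act φ (κ ℤ.- 1ℤ) dilog d f x
        ≡⟨ sym (act-bound φ d φd bf (κ ℤ.- 1ℤ) dilog (suc M) (∣∣-bound (fun φ x) (ℕP.n≤1+n _))) ⟩
      sumN (suc M) A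
        ≡⟨ sumN-suc M A ⟩
      A 0 ⊞ sumN M (λ l → A (suc l))
        ≡⟨ cong₂ _⊞_ (cong (λ t → (1ℚ ⊠ twist t) ⊠ f (x ⊝ 𝟎)) (trans (ℤP.*-zeroʳ (κ ℤ.- 1ℤ)) (sym (ℤP.*-zeroʳ (κ ℤ.+ 1ℤ)))))
             (trans (sumN-cong M split) (trans (sumN-add M _ _) (cong (sumN M (λ l → B (suc l)) ⊞_) (sumN-scale M (twist κ) _)))) ⟩
      B 0 ⊞ (sumN M (λ l → B (suc l)) ⊞ twist κ ⊠ sumN M C)
        ≡⟨ trans (sym (𝔽.+-assoc (B 0) _ _)) (cong (_⊞ twist κ ⊠ sumN M C) (sym (sumN-suc M B))) ⟩
      sumN (suc M) B ⊞ twist κ ⊠ sumN M C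
        ≡⟨ cong₂ (λ p q → p ⊞ twist κ ⊠ q) (act-bound φ d φd bf (κ ℤ.+ 1ℤ) dilog (suc M) (∣∣-bound (fun φ x) (ℕP.n≤1+n _)))
             (act-bound φ d φd bf (κ ℤ.+ 1ℤ) dilog M Cbound) ⟩
      act φ (κ ℤ.+ 1ℤ) dilog d f x ⊞ twist κ ⊠ act φ (κ ℤ.+ 1ℤ) dilog d f (x ⊝ d) ∎
      where
      open ≡-Reasoning
      M = suc ∣ fun φ x ∣
      A B C : ℕ → ℚ
      A = term (κ ℤ.- 1ℤ) dilog d f x
      B = term (κ ℤ.+ 1ℤ) dilog d f x
      C = term (κ ℤ.+ 1ℤ) dilog d f (x ⊝ d)
      Cbound : 0≤ + M ℤ.- 1ℤ ℤ.- fun φ (x ⊝ d)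
      Cbound = subst 0≤_ (sym (trans (cong (λ t → + M ℤ.- 1ℤ ℤ.- t) (subᶠ φ x d)) (aux (+ M) (fun φ x) (fun φ d))))
        (0≤-+ (0≤-+ (∣∣-bound (fun φ x) ℕP.≤-refl) φd) (0≤-nat {1}))
        where
        aux : ∀ m x d → m ℤ.- 1ℤ ℤ.- (x ℤ.- d) ≡ m ℤ.- 1ℤ ℤ.- x ℤ.+ (d ℤ.- 1ℤ) ℤ.+ 1ℤ
        aux = solveℤ
      split : ∀ l → A (suc l) ≡ B (suc l) ⊞ twist κ ⊠ C l
      split l = begin
        (e ⊠ twist ((κ ℤ.- 1ℤ) ℤ.* + suc l)) ⊠ y
          ≡⟨ cong (λ t → (e ⊠ t) ⊠ y) (trans (cong twist (exp₁ κ (+ suc l))) (twist-+ (κ ℤ.* + suc l) (ℤ.- (+ suc l)))) ⟩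
        (e ⊠ (twist (κ ℤ.* + suc l) ⊠ twist (ℤ.- (+ suc l)))) ⊠ y
          ≡⟨ aux₁ e (twist (κ ℤ.* + suc l)) (pow half (suc l)) y ⟩
        (twist (κ ℤ.* + suc l) ⊠ (e ⊠ pow half (suc l))) ⊠ y
          ≡⟨ cong (λ t → (twist (κ ℤ.* + suc l) ⊠ t) ⊠ y) (dilog-step l) ⟩
        (twist (κ ℤ.* + suc l) ⊠ (e ⊠ pow two (suc l) ⊞ dilog l ⊠ pow two l)) ⊠ y
          ≡⟨ aux₂ (twist (κ ℤ.* + suc l)) e (pow two (suc l)) (dilog l) (pow two l) y ⟩
        (e ⊠ (twist (κ ℤ.* + suc l) ⊠ twist (+ suc l))) ⊠ y ⊞ (dilog l ⊠ (twist (κ ℤ.* + suc l) ⊠ twist (+ l))) ⊠ y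
          ≡⟨ cong₂ (λ s t → (e ⊠ s) ⊠ y ⊞ (dilog l ⊠ t) ⊠ y)
               (trans (sym (twist-+ (κ ℤ.* + suc l) (+ suc l))) (cong twist (exp₂ κ (+ suc l))))
               (trans (sym (twist-+ (κ ℤ.* + suc l) (+ l))) (trans (cong twist (exp₃ κ (+ l))) (twist-+ κ ((κ ℤ.+ 1ℤ) ℤ.* + l)))) ⟩
        B (suc l) ⊞ (dilog l ⊠ (twist κ ⊠ twist ((κ ℤ.+ 1ℤ) ℤ.* + l))) ⊠ y
          ≡⟨ cong (B (suc l) ⊞_) (trans (aux₃ (dilog l) (twist κ) (twist ((κ ℤ.+ 1ℤ) ℤ.* + l)) y)
               (cong (λ z → twist κ ⊠ ((dilog l ⊠ twist ((κ ℤ.+ 1ℤ) ℤ.* + l)) ⊠ f z)) (⊝-suc x d l))) ⟩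
        B (suc l) ⊞ twist κ ⊠ C l ∎
        where
        e y : ℚ
        e = dilog (suc l)
        y = f (x ⊝ suc l · d)
        exp₁ : ∀ k m → (k ℤ.- 1ℤ) ℤ.* m ≡ k ℤ.* m ℤ.+ (ℤ.- m)
        exp₁ = solveℤ
        exp₂ : ∀ k m → k ℤ.* m ℤ.+ m ≡ (k ℤ.+ 1ℤ) ℤ.* m
        exp₂ = solveℤ
        exp₃ : ∀ k m → k ℤ.* (1ℤ ℤ.+ m) ℤ.+ m ≡ k ℤ.+ (k ℤ.+ 1ℤ) ℤ.* m
        exp₃ = solveℤ
        aux₁ : ∀ e t h y → (e ⊠ (t ⊠ h)) ⊠ y ≡ (t ⊠ (e ⊠ h)) ⊠ y
        aux₁ = solve 4 (λ e t h y → (e :⊠ (t :⊠ h)) :⊠ y := (t :⊠ (e :⊠ h)) :⊠ y) refl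
        aux₂ : ∀ t e p d q y → (t ⊠ (e ⊠ p ⊞ d ⊠ q)) ⊠ y ≡ (e ⊠ (t ⊠ p)) ⊠ y ⊞ (d ⊠ (t ⊠ q)) ⊠ y
        aux₂ = solve 6 (λ t e p d q y → (t :⊠ (e :⊠ p :⊞ d :⊠ q)) :⊠ y := (e :⊠ (t :⊠ p)) :⊠ y :⊞ (d :⊠ (t :⊠ q)) :⊠ y) refl
        aux₃ : ∀ d k s y → (d ⊠ (k ⊠ s)) ⊠ y ≡ k ⊠ ((d ⊠ s) ⊠ y)
        aux₃ = solve 4 (λ d k s y → (d :⊠ (k :⊠ s)) :⊠ y := k :⊠ ((d :⊠ s) :⊠ y)) refl

  -- The operator ∏_{i<n} (1 + t^{a+2i} Z), where Z is the translation by d.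
  binom : ℕ → ℤ → L → (L → ℚ) → L → ℚ
  binom zero    a d f x = f x
  binom (suc n) a d f x = binom n (a ℤ.+ + 2) d f x ⊞ twist a ⊠ binom n (a ℤ.+ + 2) d f (x ⊝ d)

  binom-cong : ∀ n a d {f g : L → ℚ} x y → (∀ l → l ℕ.≤ n → f (x ⊝ l · d) ≡ g (y ⊝ l · d)) → binom n a d f x ≡ binom n a d g y
  binom-cong zero    a d {f} {g} x y h = trans (cong f (sym (⊝-𝟎 x))) (trans (h 0 z≤n) (cong g (⊝-𝟎 y)))
  binom-cong (suc n) a d {f} {g} x y h = cong₂ (λ p q → p ⊞ twist a ⊠ q)
    (binom-cong n (a ℤ.+ + 2) d x y (λ l q → h l (ℕP.m≤n⇒m≤1+n q)))
    (binom-cong n (a ℤ.+ + 2) d (x ⊝ d) (y ⊝ d) (λ l q → trans (cong f (sym (⊝-suc x d l))) (trans (h (suc l) (s≤s q)) (cong g (⊝-suc y d l)))))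

  binom-zero : ∀ n a d {f : L → ℚ} x → (∀ l → l ℕ.≤ n → f (x ⊝ l · d) ≡ 0ℚ) → binom n a d f x ≡ 0ℚ
  binom-zero n a d {f} x h = trans (binom-cong n a d {f} {λ _ → 0ℚ} x x h) (const n a x)
    where
    const : ∀ n a x → binom n a d (λ _ → 0ℚ) x ≡ 0ℚ
    const zero    a x = refl
    const (suc n) a x = trans (cong₂ (λ p q → p ⊞ twist a ⊠ q) (const n _ x) (const n _ (x ⊝ d))) (trans (𝔽.+-identityˡ _) (𝔽.zeroʳ _))

  binom-last : ∀ n a d (f : L → ℚ) x → binom (suc n) a d f x ≡ binom n a d f x ⊞ twist (a ℤ.+ + 2 ℤ.* + n) ⊠ binom n a d f (x ⊝ d)
  binom-last zero    a d f x = cong (λ t → f x ⊞ twist t ⊠ f (x ⊝ d)) (sym (ℤP.+-identityʳ a))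
  binom-last (suc n) a d f x = trans (cong₂ (λ p q → p ⊞ twist a ⊠ q) (binom-last n (a ℤ.+ + 2) d f x) (binom-last n (a ℤ.+ + 2) d f (x ⊝ d)))
    (trans (aux (B x) (twist (a ℤ.+ + 2 ℤ.+ + 2 ℤ.* + n)) (B (x ⊝ d)) (twist a) (B ((x ⊝ d) ⊝ d)))
      (cong (λ t → B x ⊞ twist a ⊠ B (x ⊝ d) ⊞ twist t ⊠ (B (x ⊝ d) ⊞ twist a ⊠ B ((x ⊝ d) ⊝ d))) (expo a (+ n))))
    where
    B : L → ℚ
    B = binom n (a ℤ.+ + 2) d f
    expo : ∀ a n → a ℤ.+ + 2 ℤ.+ + 2 ℤ.* n ≡ a ℤ.+ + 2 ℤ.* (1ℤ ℤ.+ n)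
    expo = solveℤ
    aux : ∀ b s c t e → (b ⊞ s ⊠ c) ⊞ t ⊠ (c ⊞ s ⊠ e) ≡ b ⊞ t ⊠ c ⊞ s ⊠ (c ⊞ t ⊠ e)
    aux = solve 5 (λ b s c t e → (b :⊞ s :⊠ c) :⊞ t :⊠ (c :⊞ s :⊠ e) := b :⊞ t :⊠ c :⊞ s :⊠ (c :⊞ t :⊠ e)) refl

  -- Pulling t^(a+2i) Z⁻¹ out of the factor 1 + t^(a+2i) Z⁻¹ leaves 1 + t^(-a-2i) Z. The exponents
  -- pulled out add up to n(a + n - 1), and the new ones, read in reverse, start at 2 - 2n - a.
  binom-reverse : ∀ n a d (f : L → ℚ) x →
    binom n a (⊖ d) f x ≡ twist (+ n ℤ.* (a ℤ.+ + n ℤ.- 1ℤ)) ⊠ binom n (+ 2 ℤ.- + 2 ℤ.* + n ℤ.- a) d f (x ⊕ n · d)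
  binom-reverse zero    a d f x = trans (sym (𝔽.*-identityˡ (f x))) (cong (λ z → 1ℚ ⊠ f z) (sym (⊕-identityʳ x)))
  binom-reverse (suc n) a d f x = begin
    binom n (a ℤ.+ + 2) (⊖ d) f x ⊞ twist a ⊠ binom n (a ℤ.+ + 2) (⊖ d) f (x ⊝ ⊖ d)
      ≡⟨ cong₂ (λ p q → p ⊞ twist a ⊠ q) (binom-reverse n (a ℤ.+ + 2) d f x) (binom-reverse n (a ℤ.+ + 2) d f (x ⊝ ⊖ d)) ⟩
    twist s ⊠ binom n b′ d f (x ⊕ n · d) ⊞ twist a ⊠ (twist s ⊠ binom n b′ d f ((x ⊝ ⊖ d) ⊕ n · d))
      ≡⟨ cong (λ c → twist s ⊠ binom n c d f (x ⊕ n · d) ⊞ twist a ⊠ (twist s ⊠ binom n c d f ((x ⊝ ⊖ d) ⊕ n · d))) (expb a (+ n)) ⟩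
    twist s ⊠ B (x ⊕ n · d) ⊞ twist a ⊠ (twist s ⊠ B ((x ⊝ ⊖ d) ⊕ n · d))
      ≡⟨ cong₂ (λ y z → twist s ⊠ B y ⊞ twist a ⊠ (twist s ⊠ B z))
           (solveᴸ (x ∷ d ∷ n · d ∷ []) (v₀ ∔ v₂) ((v₀ ∔ (v₁ ∔ v₂)) :- v₁) refl)
           (solveᴸ (x ∷ d ∷ n · d ∷ []) ((v₀ :- (:- v₁)) ∔ v₂) (v₀ ∔ (v₁ ∔ v₂)) refl) ⟩
    twist s ⊠ B (y ⊝ d) ⊞ twist a ⊠ (twist s ⊠ B y)
      ≡⟨ trans (cong₂ (λ p q → p ⊠ B (y ⊝ d) ⊞ q) (trans (cong twist (exps a (+ n))) (twist-+ u w))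
           (trans (sym (𝔽.*-assoc (twist a) (twist s) (B y))) (cong (_⊠ B y) (trans (sym (twist-+ a s)) (cong twist (expu a (+ n)))))))
           (aux (twist u) (twist w) (B (y ⊝ d)) (B y)) ⟩
    twist u ⊠ (B y ⊞ twist w ⊠ B (y ⊝ d))
      ≡⟨ cong (λ t → twist u ⊠ (B y ⊞ twist t ⊠ B (y ⊝ d))) (expw a (+ n)) ⟩
    twist u ⊠ (B y ⊞ twist (b ℤ.+ + 2 ℤ.* + n) ⊠ B (y ⊝ d))
      ≡⟨ cong (twist u ⊠_) (sym (binom-last n b d f y)) ⟩
    twist u ⊠ binom (suc n) b d f y ∎
    where
    open ≡-Reasoning
    s u w b b′ : ℤ
    s  = + n ℤ.* (a ℤ.+ + 2 ℤ.+ + n ℤ.- 1ℤ)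
    u  = + suc n ℤ.* (a ℤ.+ + suc n ℤ.- 1ℤ)
    w  = ℤ.- a
    b  = + 2 ℤ.- + 2 ℤ.* + suc n ℤ.- a
    b′ = + 2 ℤ.- + 2 ℤ.* + n ℤ.- (a ℤ.+ + 2)
    y : L
    y = x ⊕ suc n · d
    B : L → ℚ
    B = binom n b d f
    expb : ∀ a n → + 2 ℤ.- + 2 ℤ.* n ℤ.- (a ℤ.+ + 2) ≡ + 2 ℤ.- + 2 ℤ.* (1ℤ ℤ.+ n) ℤ.- a
    expb = solveℤ
    exps : ∀ a n → n ℤ.* (a ℤ.+ + 2 ℤ.+ n ℤ.- 1ℤ) ≡ (1ℤ ℤ.+ n) ℤ.* (a ℤ.+ (1ℤ ℤ.+ n) ℤ.- 1ℤ) ℤ.+ (ℤ.- a)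
    exps = solveℤ
    expu : ∀ a n → a ℤ.+ n ℤ.* (a ℤ.+ + 2 ℤ.+ n ℤ.- 1ℤ) ≡ (1ℤ ℤ.+ n) ℤ.* (a ℤ.+ (1ℤ ℤ.+ n) ℤ.- 1ℤ)
    expu = solveℤ
    expw : ∀ a n → ℤ.- a ≡ + 2 ℤ.- + 2 ℤ.* (1ℤ ℤ.+ n) ℤ.- a ℤ.+ + 2 ℤ.* n
    expw = solveℤ
    aux : ∀ u w p q → (u ⊠ w) ⊠ p ⊞ u ⊠ q ≡ u ⊠ (q ⊞ w ⊠ p)
    aux = solve 4 (λ u w p q → (u :⊠ w) :⊠ p :⊞ u :⊠ q := u :⊠ (q :⊞ w :⊠ p)) refl

  -- At a = 1 - n the exponents 1 - n, 3 - n, ..., n - 1 are symmetric about 0, so reversal produces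
  -- no power of t.
  binom-palindrome : ∀ n d (f : L → ℚ) x → binom n (1ℤ ℤ.- + n) (⊖ d) f x ≡ binom n (1ℤ ℤ.- + n) d f (x ⊕ n · d)
  binom-palindrome n d f x = trans (binom-reverse n (1ℤ ℤ.- + n) d f x)
    (trans (cong₂ (λ s b → twist s ⊠ binom n b d f (x ⊕ n · d)) (exps (+ n)) (expb (+ n))) (𝔽.*-identityˡ _))
    where
    exps : ∀ n → n ℤ.* (1ℤ ℤ.- n ℤ.+ n ℤ.- 1ℤ) ≡ 0ℤ
    exps = solveℤ
    expb : ∀ n → + 2 ℤ.- + 2 ℤ.* n ℤ.- (1ℤ ℤ.- n) ≡ 1ℤ ℤ.- n
    expb = solveℤ

  module _ (φ : Additive r) (d : L) (φd : 0≤ fun φ d ℤ.- 1ℤ) where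

    private
      step-negative : ∀ x → Negative (fun φ x) → Negative (fun φ (x ⊝ d))
      step-negative x nx = subst 0≤_ (sym (trans (cong (λ t → ℤ.- 1ℤ ℤ.- t) (subᶠ φ x d)) (aux (fun φ x) (fun φ d)))) (0≤-+ (0≤-+ nx φd) (0≤-nat {1}))
        where
        aux : ∀ x d → ℤ.- 1ℤ ℤ.- (x ℤ.- d) ≡ ℤ.- 1ℤ ℤ.- x ℤ.+ (d ℤ.- 1ℤ) ℤ.+ 1ℤ
        aux = solveℤ

    binom-supported : ∀ n a {f : L → ℚ} → SupportedOn φ f → SupportedOn φ (binom n a d f)
    binom-supported zero    a bf x nx = bf x nx
    binom-supported (suc n) a bf x nx = trans (cong₂ (λ p q → p ⊞ twist a ⊠ q) (binom-supported n _ bf x nx) (binom-supported n _ bf (x ⊝ d) (step-negative x nx)))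
      (trans (𝔽.+-identityˡ _) (𝔽.zeroʳ _))

    -- The functional equation iterated: E(t^(a-1) Z) is E(t^(a-1+2n) Z) times the `n` factors 1 +
    -- t^(a+2i) Z.
    act-dilog-binom : ∀ n a {f : L → ℚ} → SupportedOn φ f → ∀ x →
      act φ (a ℤ.- 1ℤ) dilog d f x ≡ binom n a d (act φ (a ℤ.- 1ℤ ℤ.+ + 2 ℤ.* + n) dilog d f) x
    act-dilog-binom zero    a {f} bf x = cong (λ t → act φ t dilog d f x) (sym (ℤP.+-identityʳ (a ℤ.- 1ℤ)))
    act-dilog-binom (suc n) a {f} bf x = trans (dilog-act-step φ d φd bf a x) (cong₂ (λ p q → p ⊞ twist a ⊠ q) (rec x) (rec (x ⊝ d)))
      where
      rec : ∀ y → act φ (a ℤ.+ 1ℤ) dilog d f y ≡ binom n (a ℤ.+ + 2) d (act φ (a ℤ.- 1ℤ ℤ.+ + 2 ℤ.* + suc n) dilog d f) y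
      rec y = trans (cong (λ t → act φ t dilog d f y) (exp₁ a)) (trans (act-dilog-binom n (a ℤ.+ + 2) bf y)
        (cong (λ t → binom n (a ℤ.+ + 2) d (act φ t dilog d f) y) (exp₂ a (+ n))))
        where
        exp₁ : ∀ a → a ℤ.+ 1ℤ ≡ a ℤ.+ + 2 ℤ.- 1ℤ
        exp₁ = solveℤ
        exp₂ : ∀ a n → a ℤ.+ + 2 ℤ.- 1ℤ ℤ.+ + 2 ℤ.* n ≡ a ℤ.- 1ℤ ℤ.+ + 2 ℤ.* (1ℤ ℤ.+ n)
        exp₂ = solveℤ

    binom-act : ∀ n a κ g {f : L → ℚ} → SupportedOn φ f → ∀ x → binom n a d (act φ κ g d f) x ≡ act φ κ g d (binom n a d f) x
    binom-act zero    a κ g bf x = refl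
    binom-act (suc n) a κ g {f} bf x = begin
      binom n a₂ d (act φ κ g d f) x ⊞ twist a ⊠ binom n a₂ d (act φ κ g d f) (x ⊝ d)
        ≡⟨ cong₂ (λ p q → p ⊞ twist a ⊠ q) (binom-act n a₂ κ g bf x) (binom-act n a₂ κ g bf (x ⊝ d)) ⟩
      act φ κ g d B x ⊞ twist a ⊠ act φ κ g d B (x ⊝ d)
        ≡⟨ cong (λ p → act φ κ g d B x ⊞ twist a ⊠ p) (sym (act-bound φ d φd bB κ g M shifted)) ⟩
      sumN M (term κ g d B x) ⊞ twist a ⊠ sumN M (term κ g d B (x ⊝ d))
        ≡⟨ trans (cong (sumN M (term κ g d B x) ⊞_) (sym (sumN-scale M (twist a) _))) (sym (sumN-add M _ _)) ⟩
      sumN M (λ l → term κ g d B x l ⊞ twist a ⊠ term κ g d B (x ⊝ d) l)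
        ≡⟨ sumN-cong M (λ l → trans (cong (λ z → term κ g d B x l ⊞ twist a ⊠ ((g l ⊠ twist (κ ℤ.* + l)) ⊠ B z))
             (solveᴸ (x ∷ d ∷ l · d ∷ []) ((v₀ :- v₁) :- v₂) ((v₀ :- v₂) :- v₁) refl))
             (aux (g l ⊠ twist (κ ℤ.* + l)) (B (x ⊝ l · d)) (twist a) (B ((x ⊝ l · d) ⊝ d)))) ⟩
      act φ κ g d (binom (suc n) a d f) x ∎
      where
      open ≡-Reasoning
      a₂ = a ℤ.+ + 2
      B : L → ℚ
      B = binom n a₂ d f
      bB : SupportedOn φ B
      bB = binom-supported n a₂ bf
      M = suc ∣ fun φ x ∣
      shifted : 0≤ + M ℤ.- 1ℤ ℤ.- fun φ (x ⊝ d)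
      shifted = subst 0≤_ (sym (trans (cong (λ t → + M ℤ.- 1ℤ ℤ.- t) (subᶠ φ x d)) (aux′ (+ M) (fun φ x) (fun φ d))))
        (0≤-+ (0≤-+ (∣∣-bound (fun φ x) ℕP.≤-refl) φd) (0≤-nat {1}))
        where
        aux′ : ∀ m x d → m ℤ.- 1ℤ ℤ.- (x ℤ.- d) ≡ m ℤ.- 1ℤ ℤ.- x ℤ.+ (d ℤ.- 1ℤ) ℤ.+ 1ℤ
        aux′ = solveℤ
      aux : ∀ g p t q → g ⊠ p ⊞ t ⊠ (g ⊠ q) ≡ g ⊠ (p ⊞ t ⊠ q)
      aux = solve 4 (λ g p t q → g :⊠ p :⊞ t :⊠ (g :⊠ q) := g :⊠ (p :⊞ t :⊠ q)) refl

open Operators public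

-- The quantum torus

module Torus {r : ℕ} (W : SkewForm r) where

  open SkewForm W

  private
    L : Set
    L = Lattice r

  summand : (L → ℚ) → (L → ℚ) → L → L → ℚ
  summand A B x a = (twist (ω a (x ⊝ a)) ⊠ A a) ⊠ B (x ⊝ a)

  -- C is the product A * B in the quantum torus yᵃyᵇ = t^{ω(a,b)} yᵃ⁺ᵇ.
  IsProduct : (A B C : L → ℚ) → Set
  IsProduct A B C = ∀ x → HasSum (summand A B x) (C x)

  -- Left and right multiplication by Σ g l y^{ld}.
  actˡ actʳ : Additive r → (ℕ → ℚ) → L → (L → ℚ) → L → ℚ
  actˡ φ g d f x = act φ (ω d x) g d f x
  actʳ φ g d f x = act φ (ω x d) g d f x

  ω-shiftʳ : ∀ x d l → ω (x ⊝ l · d) d ≡ ω x d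
  ω-shiftʳ x d l = trans (sub-mulᶠ (ωˡ d) x l d) (trans (cong (λ t → ω x d ℤ.- + l ℤ.* t) (alt d)) (aux (ω x d) (+ l)))
    where
    aux : ∀ a l → a ℤ.- l ℤ.* 0ℤ ≡ a
    aux = solveℤ

  ω-shiftˡ : ∀ x d l → ω d (x ⊝ l · d) ≡ ω d x
  ω-shiftˡ x d l = trans (skew d (x ⊝ l · d)) (trans (cong ℤ.-_ (ω-shiftʳ x d l)) (sym (skew d x)))

  module _ (φ : Additive r) (d : L) (φd : 0≤ fun φ d ℤ.- 1ℤ) {f : L → ℚ} (bf : SupportedOn φ f)
           (g h : ℕ → ℚ) (gh : ∀ k → diagonal k (λ l m → g l ⊠ h m) ≡ δ₀ k) where

    actˡ-inverse : ∀ x → actˡ φ g d (actˡ φ h d f) x ≡ f x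
    actˡ-inverse x = trans (act-cong φ (ω d x) g d {actˡ φ h d f} {act φ (ω d x) h d f} x (λ l → cong (λ κ → act φ κ h d f (x ⊝ l · d)) (ω-shiftˡ x d l)))
      (act-inverse φ d φd bf (ω d x) g h gh x)

    actʳ-inverse : ∀ x → actʳ φ g d (actʳ φ h d f) x ≡ f x
    actʳ-inverse x = trans (act-cong φ (ω x d) g d {actʳ φ h d f} {act φ (ω x d) h d f} x (λ l → cong (λ κ → act φ κ h d f (x ⊝ l · d)) (ω-shiftʳ x d l)))
      (act-inverse φ d φd bf (ω x d) g h gh x)

  regroupˡ : ∀ g p q r s x y → p ℤ.+ q ≡ r ℤ.+ s → (g ⊠ twist p) ⊠ ((twist q ⊠ x) ⊠ y) ≡ (twist r ⊠ y) ⊠ ((g ⊠ twist s) ⊠ x)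
  regroupˡ g p q r s x y h = trans (aux₁ g (twist p) (twist q) x y)
    (trans (cong (_⊠ (g ⊠ x ⊠ y)) (trans (sym (twist-+ p q)) (trans (cong twist h) (twist-+ r s)))) (aux₂ g (twist r) (twist s) x y))
    where
    aux₁ : ∀ g s t p q → (g ⊠ s) ⊠ ((t ⊠ p) ⊠ q) ≡ (s ⊠ t) ⊠ (g ⊠ p ⊠ q)
    aux₁ = solve 5 (λ g s t p q → (g :⊠ s) :⊠ ((t :⊠ p) :⊠ q) := (s :⊠ t) :⊠ (g :⊠ p :⊠ q)) refl
    aux₂ : ∀ g s t p q → (s ⊠ t) ⊠ (g ⊠ p ⊠ q) ≡ (s ⊠ q) ⊠ ((g ⊠ t) ⊠ p)
    aux₂ = solve 5 (λ g s t p q → (s :⊠ t) :⊠ (g :⊠ p :⊠ q) := (s :⊠ q) :⊠ ((g :⊠ t) :⊠ p)) refl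

  regroupʳ : ∀ g p q r s x y → p ℤ.+ q ≡ r ℤ.+ s → (g ⊠ twist p) ⊠ ((twist q ⊠ x) ⊠ y) ≡ (twist r ⊠ x) ⊠ ((g ⊠ twist s) ⊠ y)
  regroupʳ g p q r s x y h = trans (cong ((g ⊠ twist p) ⊠_) (swap (twist q) x y)) (regroupˡ g p q r s y x h)
    where
    swap : ∀ t p q → (t ⊠ p) ⊠ q ≡ (t ⊠ q) ⊠ p
    swap = solve 3 (λ t p q → (t :⊠ p) :⊠ q := (t :⊠ q) :⊠ p) refl

  module _ (φ : Additive r) where

    -- At degree `x` only those `a` count for which `x ⊝ a` lies in the half-space of `φ`. They
    -- satisfy `φ a ≤ φ x`, so one truncation depending on `x` alone serves all of them.
    product-bound : ∀ x a → 0≤ fun φ (x ⊝ a) → 0≤ + suc ∣ fun φ x ∣ ℤ.- 1ℤ ℤ.- fun φ a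
    product-bound x a p = subst 0≤_ (aux (+ suc ∣ fun φ x ∣) (fun φ x) (fun φ a)) (0≤-+ (∣∣-bound (fun φ x) ℕP.≤-refl) (subst 0≤_ (subᶠ φ x a) p))
      where
      aux : ∀ m x a → m ℤ.- 1ℤ ℤ.- x ℤ.+ (x ℤ.- a) ≡ m ℤ.- 1ℤ ℤ.- a
      aux = solveℤ

    product-bound′ : ∀ x a → 0≤ fun φ a → 0≤ + suc ∣ fun φ x ∣ ℤ.- 1ℤ ℤ.- fun φ (x ⊝ a)
    product-bound′ x a p = subst 0≤_ (trans (aux (+ suc ∣ fun φ x ∣) (fun φ x) (fun φ a)) (cong (λ t → + suc ∣ fun φ x ∣ ℤ.- 1ℤ ℤ.- t) (sym (subᶠ φ x a))))
      (0≤-+ (∣∣-bound (fun φ x) ℕP.≤-refl) p)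
      where
      aux : ∀ m x a → m ℤ.- 1ℤ ℤ.- x ℤ.+ a ≡ m ℤ.- 1ℤ ℤ.- (x ℤ.- a)
      aux = solveℤ

  module _ (φ : Additive r) (d : L) (φd : 0≤ fun φ d ℤ.- 1ℤ) {A B : L → ℚ} (bA : SupportedOn φ A) (bB : SupportedOn φ B) (g : ℕ → ℚ) where

    sum-left : ∀ κ x a → (twist (ω a (x ⊝ a)) ⊠ B (x ⊝ a)) ⊠ sumN (suc ∣ fun φ x ∣) (term κ g d A a) ≡ (twist (ω a (x ⊝ a)) ⊠ act φ κ g d A a) ⊠ B (x ⊝ a)
    sum-left κ x a with sign? (fun φ (x ⊝ a))
    ... | inj₁ p = trans (swap _ _ _) (cong (λ s → (twist (ω a (x ⊝ a)) ⊠ s) ⊠ B (x ⊝ a)) (act-bound φ d φd bA κ g (suc ∣ fun φ x ∣) (product-bound φ x a p)))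
      where
      swap : ∀ t b s → (t ⊠ b) ⊠ s ≡ (t ⊠ s) ⊠ b
      swap = solve 3 (λ t b s → (t :⊠ b) :⊠ s := (t :⊠ s) :⊠ b) refl
    ... | inj₂ q = trans (⊠-zeroˡ (⊠-zeroʳ (bB _ q))) (sym (⊠-zeroʳ (bB _ q)))

    sum-right : ∀ κ x a → (twist (ω a (x ⊝ a)) ⊠ A a) ⊠ sumN (suc ∣ fun φ x ∣) (term κ g d B (x ⊝ a)) ≡ (twist (ω a (x ⊝ a)) ⊠ A a) ⊠ act φ κ g d B (x ⊝ a)
    sum-right κ x a with sign? (fun φ a)
    ... | inj₁ p = cong ((twist (ω a (x ⊝ a)) ⊠ A a) ⊠_) (act-bound φ d φd bB κ g (suc ∣ fun φ x ∣) (product-bound′ φ x a p))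
    ... | inj₂ q = trans (⊠-zeroˡ (⊠-zeroʳ (bA a q))) (sym (⊠-zeroˡ (⊠-zeroʳ (bA a q))))

    -- Associativity G * (A * B) = (G * A) * B. In the term for `l` the product at `x ⊝ l · d` is
    -- reindexed by `a ↦ a ⊝ l · d`; the sum over `l` is finite and may be exchanged with that over
    -- `a`.
    product-actˡ : ∀ {C} → IsProduct A B C → IsProduct (actˡ φ g d A) B (actˡ φ g d C)
    product-actˡ {C} P x = hasSum-cong pointwise (hasSum-sumN M (λ l → hasSum-scale (g l ⊠ twist (ω d x ℤ.* + l)) (shifted l)))
      where
      M = suc ∣ fun φ x ∣
      shifted : ∀ l → HasSum (λ a → summand A B (x ⊝ l · d) (a ⊝ l · d)) (C (x ⊝ l · d))
      shifted l = hasSum-pull (_⊝ l · d) (_⊕ l · d) (λ b → ⊝-⊕ b (l · d))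
        (λ a ne → ⊥-elim (ne (⊕-⊝ a (l · d)))) (P (x ⊝ l · d))
      diff : ∀ a l → (x ⊝ l · d) ⊝ (a ⊝ l · d) ≡ x ⊝ a
      diff a l = solveᴸ (x ∷ a ∷ l · d ∷ []) ((v₀ :- v₂) :- (v₁ :- v₂)) (v₀ :- v₁) refl
      expo : ∀ a l → ω d x ℤ.* + l ℤ.+ ω (a ⊝ l · d) (x ⊝ a) ≡ ω a (x ⊝ a) ℤ.+ ω d a ℤ.* + l
      expo a l = trans (cong (λ t → ω d x ℤ.* + l ℤ.+ t) (trans (sub-mulᶠ (ωˡ (x ⊝ a)) a l d) (cong (λ t → ω a (x ⊝ a) ℤ.- + l ℤ.* t) (subᶠ (ωʳ d) x a))))
        (aux (ω d x) (+ l) (ω a (x ⊝ a)) (ω d a))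
        where
        aux : ∀ p l q s → p ℤ.* l ℤ.+ (q ℤ.- l ℤ.* (p ℤ.- s)) ≡ q ℤ.+ s ℤ.* l
        aux = solveℤ
      cell : ∀ a l → (g l ⊠ twist (ω d x ℤ.* + l)) ⊠ summand A B (x ⊝ l · d) (a ⊝ l · d)
                   ≡ (twist (ω a (x ⊝ a)) ⊠ B (x ⊝ a)) ⊠ term (ω d a) g d A a l
      cell a l = trans (cong (λ z → (g l ⊠ twist (ω d x ℤ.* + l)) ⊠ ((twist (ω (a ⊝ l · d) z) ⊠ A (a ⊝ l · d)) ⊠ B z)) (diff a l))
        (regroupˡ (g l) (ω d x ℤ.* + l) _ (ω a (x ⊝ a)) (ω d a ℤ.* + l) (A (a ⊝ l · d)) (B (x ⊝ a)) (expo a l))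
      pointwise : ∀ a → sumN M (λ l → (g l ⊠ twist (ω d x ℤ.* + l)) ⊠ summand A B (x ⊝ l · d) (a ⊝ l · d)) ≡ summand (actˡ φ g d A) B x a
      pointwise a = trans (sumN-cong M (cell a)) (trans (sumN-scale M (twist (ω a (x ⊝ a)) ⊠ B (x ⊝ a)) (term (ω d a) g d A a)) (sum-left (ω d a) x a))

    product-actʳ : ∀ {C} → IsProduct A B C → IsProduct A (actʳ φ g d B) (actʳ φ g d C)
    product-actʳ {C} P x = hasSum-cong pointwise (hasSum-sumN M (λ l → hasSum-scale (g l ⊠ twist (ω x d ℤ.* + l)) (P (x ⊝ l · d))))
      where
      M = suc ∣ fun φ x ∣
      diff : ∀ a l → (x ⊝ l · d) ⊝ a ≡ (x ⊝ a) ⊝ l · d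
      diff a l = solveᴸ (x ∷ a ∷ l · d ∷ []) ((v₀ :- v₂) :- v₁) ((v₀ :- v₁) :- v₂) refl
      expo : ∀ a l → ω x d ℤ.* + l ℤ.+ ω a ((x ⊝ a) ⊝ l · d) ≡ ω a (x ⊝ a) ℤ.+ ω (x ⊝ a) d ℤ.* + l
      expo a l = trans (cong (λ t → ω x d ℤ.* + l ℤ.+ t) (sub-mulᶠ (ωʳ a) (x ⊝ a) l d))
        (trans (aux (ω x d) (+ l) (ω a (x ⊝ a)) (ω a d)) (cong (λ t → ω a (x ⊝ a) ℤ.+ t ℤ.* + l) (sym (subᶠ (ωˡ d) x a))))
        where
        aux : ∀ p l q s → p ℤ.* l ℤ.+ (q ℤ.- l ℤ.* s) ≡ q ℤ.+ (p ℤ.- s) ℤ.* l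
        aux = solveℤ
      cell : ∀ a l → (g l ⊠ twist (ω x d ℤ.* + l)) ⊠ summand A B (x ⊝ l · d) a ≡ (twist (ω a (x ⊝ a)) ⊠ A a) ⊠ term (ω (x ⊝ a) d) g d B (x ⊝ a) l
      cell a l = trans (cong (λ z → (g l ⊠ twist (ω x d ℤ.* + l)) ⊠ ((twist (ω a z) ⊠ A a) ⊠ B z)) (diff a l))
        (regroupʳ (g l) (ω x d ℤ.* + l) _ (ω a (x ⊝ a)) (ω (x ⊝ a) d ℤ.* + l) (A a) (B ((x ⊝ a) ⊝ l · d)) (expo a l))
      pointwise : ∀ a → sumN M (λ l → (g l ⊠ twist (ω x d ℤ.* + l)) ⊠ summand A B (x ⊝ l · d) a) ≡ summand A (actʳ φ g d B) x a
      pointwise a = trans (sumN-cong M (cell a)) (trans (sumN-scale M (twist (ω a (x ⊝ a)) ⊠ A a) _) (sum-right (ω (x ⊝ a) d) x a))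

    -- (A * G) * B = A * (G * B); finiteness of the sums is inherited from A * B.
    product-middle : ∀ {C} → IsProduct A B C → ∃ λ D → IsProduct (actʳ φ g d A) B D × IsProduct A (actˡ φ g d B) D
    product-middle {C} P = proj₁ ∘ both , proj₁ ∘ proj₂ ∘ both , proj₂ ∘ proj₂ ∘ both
      where
     both : ∀ x → ∃ λ p → HasSum (summand (actʳ φ g d A) B x) p × HasSum (summand A (actˡ φ g d B) x) p
     both x = sumN M S , left , right
      where
      M = suc ∣ fun φ x ∣
      G : ℕ → L → ℚ
      G l a = (g l ⊠ twist (ω d (x ⊝ a) ℤ.* + l)) ⊠ ((twist (ω a (x ⊝ a)) ⊠ A a) ⊠ B ((x ⊝ a) ⊝ l · d))
      zeroG : ∀ l a → A a ⊠ B ((x ⊝ a) ⊝ l · d) ≡ 0ℚ → G l a ≡ 0ℚ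
      zeroG l a e = ⊠-zeroʳ (trans (𝔽.*-assoc _ _ _) (⊠-zeroʳ e))
      S : ℕ → ℚ
      S l = sumL (supp (P (x ⊝ l · d))) (G l)
      sumG : ∀ l → HasSum (G l) (S l)
      sumG l = record { supp = supp H ; unique = unique H ; vanish = v ; value = refl }
        where
        H = P (x ⊝ l · d)
        v : ∀ a → a ∉ supp H → G l a ≡ 0ℚ
        v a n = zeroG l a (trans (cong (λ z → A a ⊠ B z) (solveᴸ (x ∷ a ∷ l · d ∷ []) ((v₀ :- v₁) :- v₂) ((v₀ :- v₂) :- v₁) refl))
          (untwist (ω a ((x ⊝ l · d) ⊝ a)) _ _ (vanish H a n)))
          where
          -- The list for `A * B` makes the product vanish together with its power of t; powers of t
          -- are units, so the bare product vanishes too.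
          untwist : ∀ e p q → (twist e ⊠ p) ⊠ q ≡ 0ℚ → p ⊠ q ≡ 0ℚ
          untwist e p q h = trans (sym (𝔽.*-identityˡ _)) (trans (cong (_⊠ (p ⊠ q)) (trans (sym (twist-cancel e)) (𝔽.*-comm _ _)))
            (trans (aux (twist (ℤ.- e)) (twist e) p q) (⊠-zeroʳ h)))
            where
            aux : ∀ s t p q → (s ⊠ t) ⊠ (p ⊠ q) ≡ s ⊠ ((t ⊠ p) ⊠ q)
            aux = solve 4 (λ s t p q → (s :⊠ t) :⊠ (p :⊠ q) := s :⊠ ((t :⊠ p) :⊠ q)) refl
      right : HasSum (summand A (actˡ φ g d B) x) (sumN M S)
      right = hasSum-cong pointwise (hasSum-sumN M sumG)
        where
        cell : ∀ a l → G l a ≡ (twist (ω a (x ⊝ a)) ⊠ A a) ⊠ term (ω d (x ⊝ a)) g d B (x ⊝ a) l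
        cell a l = regroupʳ (g l) (ω d (x ⊝ a) ℤ.* + l) _ (ω a (x ⊝ a)) (ω d (x ⊝ a) ℤ.* + l) (A a) (B ((x ⊝ a) ⊝ l · d)) (ℤP.+-comm _ (ω a (x ⊝ a)))
        pointwise : ∀ a → sumN M (λ l → G l a) ≡ summand A (actˡ φ g d B) x a
        pointwise a = trans (sumN-cong M (cell a)) (trans (sumN-scale M (twist (ω a (x ⊝ a)) ⊠ A a) _) (sum-right (ω d (x ⊝ a)) x a))
      left : HasSum (summand (actʳ φ g d A) B x) (sumN M S)
      left = hasSum-cong pointwise (hasSum-sumN M (λ l → hasSum-pull (_⊝ l · d) (_⊕ l · d) (λ b → ⊝-⊕ b (l · d))
        (λ a ne → ⊥-elim (ne (⊕-⊝ a (l · d)))) (sumG l)))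
        where
        expo : ∀ a l → ω d (x ⊝ (a ⊝ l · d)) ℤ.* + l ℤ.+ ω (a ⊝ l · d) (x ⊝ (a ⊝ l · d)) ≡ ω a (x ⊝ a) ℤ.+ ω a d ℤ.* + l
        expo a l = begin
          ω d (x ⊝ (a ⊝ l · d)) ℤ.* + l ℤ.+ ω (a ⊝ l · d) (x ⊝ (a ⊝ l · d))
            ≡⟨ cong (λ t → ω d (x ⊝ (a ⊝ l · d)) ℤ.* + l ℤ.+ t) (sub-mulᶠ (ωˡ (x ⊝ (a ⊝ l · d))) a l d) ⟩
          ω d (x ⊝ (a ⊝ l · d)) ℤ.* + l ℤ.+ (ω a (x ⊝ (a ⊝ l · d)) ℤ.- + l ℤ.* ω d (x ⊝ (a ⊝ l · d)))
            ≡⟨ aux (ω d (x ⊝ (a ⊝ l · d))) (ω a (x ⊝ (a ⊝ l · d))) (+ l) ⟩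
          ω a (x ⊝ (a ⊝ l · d))
            ≡⟨ cong (ω a) (solveᴸ (x ∷ a ∷ l · d ∷ []) (v₀ :- (v₁ :- v₂)) ((v₀ :- v₁) ∔ v₂) refl) ⟩
          ω a ((x ⊝ a) ⊕ l · d)
            ≡⟨ trans (add (ωʳ a) (x ⊝ a) (l · d)) (cong (λ t → ω a (x ⊝ a) ℤ.+ t) (trans (mulᶠ (ωʳ a) l d) (ℤP.*-comm (+ l) (ω a d)))) ⟩
          ω a (x ⊝ a) ℤ.+ ω a d ℤ.* + l ∎
          where
          open ≡-Reasoning
          aux : ∀ p q l → p ℤ.* l ℤ.+ (q ℤ.- l ℤ.* p) ≡ q
          aux = solveℤ
        cell : ∀ a l → G l (a ⊝ l · d) ≡ (twist (ω a (x ⊝ a)) ⊠ B (x ⊝ a)) ⊠ term (ω a d) g d A a l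
        cell a l = trans (cong (λ z → (g l ⊠ twist (ω d (x ⊝ a′) ℤ.* + l)) ⊠ ((twist (ω a′ (x ⊝ a′)) ⊠ A a′) ⊠ B z))
            (solveᴸ (x ∷ a ∷ l · d ∷ []) ((v₀ :- (v₁ :- v₂)) :- v₂) (v₀ :- v₁) refl))
          (regroupˡ (g l) (ω d (x ⊝ a′) ℤ.* + l) _ (ω a (x ⊝ a)) (ω a d ℤ.* + l) (A a′) (B (x ⊝ a)) (expo a l))
          where a′ = a ⊝ l · d
        pointwise : ∀ a → sumN M (λ l → G l (a ⊝ l · d)) ≡ summand (actʳ φ g d A) B x a
        pointwise a = trans (sumN-cong M (cell a)) (trans (sumN-scale M (twist (ω a (x ⊝ a)) ⊠ B (x ⊝ a)) (term (ω a d) g d A a)) (sum-left (ω a d) x a))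

-- Seeds and Donaldson–Thomas elements

sumℤ : ∀ {n} → (Fin n → ℤ) → ℤ
sumℤ {zero}  a = 0ℤ
sumℤ {suc n} a = a zero ℤ.+ sumℤ (a ∘ suc)

sumℤ-zero : ∀ {n} {a : Fin n → ℤ} → (∀ i → a i ≡ 0ℤ) → sumℤ a ≡ 0ℤ
sumℤ-zero {zero}  h = refl
sumℤ-zero {suc n} h = cong₂ ℤ._+_ (h zero) (sumℤ-zero (h ∘ suc))

sumℤ-add : ∀ {n} (a b : Fin n → ℤ) → sumℤ (λ i → a i ℤ.+ b i) ≡ sumℤ a ℤ.+ sumℤ b
sumℤ-add {zero}  a b = refl
sumℤ-add {suc n} a b = trans (cong (λ t → a zero ℤ.+ b zero ℤ.+ t) (sumℤ-add (a ∘ suc) (b ∘ suc))) (aux (a zero) (b zero) _ _)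
  where
  aux : ∀ p q s t → p ℤ.+ q ℤ.+ (s ℤ.+ t) ≡ p ℤ.+ s ℤ.+ (q ℤ.+ t)
  aux = solveℤ

sumℤ-cong : ∀ {n} {a b : Fin n → ℤ} → (∀ i → a i ≡ b i) → sumℤ a ≡ sumℤ b
sumℤ-cong {zero}  h = refl
sumℤ-cong {suc n} h = cong₂ ℤ._+_ (h zero) (sumℤ-cong (h ∘ suc))

sumℤ-single : ∀ {n} {a : Fin n → ℤ} i → (∀ j → j ≢ i → a j ≡ 0ℤ) → sumℤ a ≡ a i
sumℤ-single {a = a} zero    h = trans (cong (λ t → a zero ℤ.+ t) (sumℤ-zero (λ j → h (suc j) (λ ())))) (ℤP.+-identityʳ _)
sumℤ-single {a = a} (suc i) h = trans (cong₂ ℤ._+_ (h zero (λ ())) (sumℤ-single i (λ j ne → h (suc j) (λ e → ne (FinP.suc-injective e))))) (ℤP.+-identityˡ _)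

sumℤ-nonneg : ∀ {n} {a : Fin n → ℤ} → (∀ i → 0≤ a i) → 0≤ sumℤ a
sumℤ-nonneg {zero}  h = 0≤-nat
sumℤ-nonneg {suc n} h = 0≤-+ (h zero) (sumℤ-nonneg (h ∘ suc))

sumℤ-dominates : ∀ {n} {a : Fin n → ℤ} → (∀ i → 0≤ a i) → ∀ i → 0≤ sumℤ a ℤ.- a i
sumℤ-dominates {a = a} h zero    = subst 0≤_ (aux (a zero) _) (sumℤ-nonneg (h ∘ suc))
  where
  aux : ∀ p q → q ≡ p ℤ.+ q ℤ.- p
  aux = solveℤ
sumℤ-dominates {a = a} h (suc i) = subst 0≤_ (aux (a zero) _ (a (suc i))) (0≤-+ (h zero) (sumℤ-dominates (h ∘ suc) i))
  where
  aux : ∀ p q t → p ℤ.+ (q ℤ.- t) ≡ p ℤ.+ q ℤ.- t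
  aux = solveℤ

scan : ∀ {n} (a : Fin n → ℤ) → (∀ i → 0≤ a i) ⊎ ∃ λ i → Negative (a i)
scan {zero}  a = inj₁ λ ()
scan {suc n} a with sign? (a zero) | scan (a ∘ suc)
... | inj₂ q | _            = inj₂ (zero , q)
... | inj₁ _ | inj₂ (i , q) = inj₂ (suc i , q)
... | inj₁ p | inj₁ h       = inj₁ λ { zero → p ; (suc i) → h i }

0≤-antisym : ∀ {z} → 0≤ z → 0≤ ℤ.- z → z ≡ 0ℤ
0≤-antisym {+ zero}  _ _  = refl
0≤-antisym {+ suc n} _ ()
0≤-antisym { -[1+ n ]} ()

[_]₊ : ℤ → ℕ
[ + n ]₊      = n
[ -[1+ n ] ]₊ = 0

[]₊-≥ : ∀ z → 0≤ + [ z ]₊ ℤ.- z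
[]₊-≥ (+ n)    = subst 0≤_ (sym (ℤP.+-inverseʳ (+ n))) 0≤-nat
[]₊-≥ -[1+ n ] = 0≤-nat

[]₊-nonneg : ∀ {z} → 0≤ z → + [ z ]₊ ≡ z
[]₊-nonneg {+ n} _ = refl
[]₊-nonneg { -[1+ n ]} ()

[]₊-nonpos : ∀ {z} → 0≤ ℤ.- z → [ z ]₊ ≡ 0
[]₊-nonpos {+ zero}  _ = refl
[]₊-nonpos {+ suc n} ()
[]₊-nonpos { -[1+ n ]} _ = refl

_⊞ᶠ_ : ∀ {r} → Additive r → Additive r → Additive r
φ ⊞ᶠ ψ = record { fun = λ x → fun φ x ℤ.+ fun ψ x
  ; add = λ x y → trans (cong₂ ℤ._+_ (add φ x y) (add ψ x y)) (aux (fun φ x) (fun φ y) (fun ψ x) (fun ψ y)) }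
  where
  aux : ∀ p q s t → p ℤ.+ q ℤ.+ (s ℤ.+ t) ≡ p ℤ.+ s ℤ.+ (q ℤ.+ t)
  aux = solveℤ

scaleᶠ : ∀ {r} → ℤ → Additive r → Additive r
scaleᶠ k φ = record { fun = λ x → k ℤ.* fun φ x ; add = λ x y → trans (cong (k ℤ.*_) (add φ x y)) (ℤP.*-distribˡ-+ k (fun φ x) (fun φ y)) }

negateᶠ : ∀ {r} → Additive r → Additive r
negateᶠ φ = record { fun = λ x → ℤ.- fun φ x ; add = λ x y → trans (cong ℤ.-_ (add φ x y)) (ℤP.neg-distrib-+ (fun φ x) (fun φ y)) }

_⊟ᶠ_ : ∀ {r} → Additive r → Additive r → Additive r
φ ⊟ᶠ ψ = φ ⊞ᶠ negateᶠ ψ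

sumᶠ : ∀ {r n} → (Fin n → Additive r) → Additive r
sumᶠ φs = record { fun = λ x → sumℤ (λ i → fun (φs i) x)
  ; add = λ x y → trans (sumℤ-cong (λ i → add (φs i) x y)) (sumℤ-add (λ i → fun (φs i) x) (λ i → fun (φs i) y)) }

data Sgn : Set where
  pos nul ngt : Sgn

flip : Sgn → Sgn
flip pos = ngt
flip nul = nul
flip ngt = pos

pos? : ∀ s → s ≡ pos ⊎ s ≢ pos
pos? pos = inj₁ refl
pos? nul = inj₂ (λ ())
pos? ngt = inj₂ (λ ())

module Seeds {r : ℕ} (W : SkewForm r) where

  open SkewForm W public
  open Torus W public

  private
    L : Set
    L = Lattice r

  -- A basis of c-vectors with its dual basis `γ`. Spanning is expressed by `complete`: a vector
  -- minus its expansion has all coordinates zero, hence vanishes.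
  record Seed : Set where
    field
      c        : Fin r → L
      γ        : Fin r → Additive r
      γ-diag   : ∀ i → fun (γ i) (c i) ≡ 1ℤ
      γ-off    : ∀ i j → i ≢ j → fun (γ i) (c j) ≡ 0ℤ
      complete : ∀ x → (∀ i → fun (γ i) x ≡ 0ℤ) → x ≡ 𝟎

    InCone : L → Set
    InCone x = ∀ i → 0≤ fun (γ i) x

    height : Additive r
    height = sumᶠ γ

    height-pos : ∀ {x} → InCone x → x ≢ 𝟎 → 0≤ fun height x ℤ.- 1ℤ
    height-pos {x} hx ne with sign? (fun height x ℤ.- 1ℤ)
    ... | inj₁ p = p
    ... | inj₂ q = ⊥-elim (ne (complete x λ i → 0≤-antisym (hx i)
            (subst 0≤_ (aux (fun height x) (fun (γ i) x)) (0≤-+ (sumℤ-dominates hx i) q))))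
      where
      aux : ∀ h g → h ℤ.- g ℤ.+ (ℤ.- 1ℤ ℤ.- (h ℤ.- 1ℤ)) ≡ ℤ.- g
      aux = solveℤ

    height-c : ∀ i → fun height (c i) ≡ 1ℤ
    height-c i = trans (sumℤ-single {a = λ j → fun (γ j) (c i)} i (λ j ne → γ-off j i ne)) (γ-diag i)

    c≢𝟎 : ∀ i → c i ≢ 𝟎
    c≢𝟎 i e with trans (sym (γ-diag i)) (trans (cong (fun (γ i)) e) (zeroᶠ (γ i)))
    ... | ()

    γd : ∀ i → 0≤ fun (γ i) (c i) ℤ.- 1ℤ
    γd i = subst 0≤_ (cong (ℤ._- 1ℤ) (sym (γ-diag i))) 0≤-nat

  open Seed public

  cone? : ∀ s x → InCone s x ⊎ ∃ λ i → Negative (fun (γ s i) x)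
  cone? s x = scan (λ i → fun (γ s i) x)

  ConeSupported : Seed → (L → ℚ) → Set
  ConeSupported s f = ∀ i → SupportedOn (γ s i) f

  -- By `apart` the two factors can be told apart inside their sum: where `A x ⊞ B x` vanishes, one
  -- of the values is 0 anyway, hence so is the other.
  record Factors (s : Seed) (A B C : L → ℚ) : Set where
    field
      coneA : ConeSupported s A
      coneB : ConeSupported s B
      oneA  : A 𝟎 ≡ 1ℚ
      oneB  : B 𝟎 ≡ 1ℚ
      apart : ∀ x → x ≢ 𝟎 → A x ≡ 0ℚ ⊎ B x ≡ 0ℚ
      prod  : IsProduct A B C

  ω-𝟎ˡ : ∀ x → ω 𝟎 x ≡ 0ℤ
  ω-𝟎ˡ x = zeroᶠ (ωˡ x)

  ω-𝟎ʳ : ∀ x → ω x 𝟎 ≡ 0ℤ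
  ω-𝟎ʳ x = zeroᶠ (ωʳ x)

  summand-first : ∀ A B x → A 𝟎 ≡ 1ℚ → summand A B x 𝟎 ≡ B x
  summand-first A B x a1 = trans (cong₂ _⊠_ (trans (cong₂ _⊠_ (cong twist (ω-𝟎ˡ (x ⊝ 𝟎))) a1) (𝔽.*-identityˡ 1ℚ)) (cong B (⊝-𝟎 x))) (𝔽.*-identityˡ (B x))

  summand-last : ∀ A B x → B 𝟎 ≡ 1ℚ → summand A B x x ≡ A x
  summand-last A B x b1 = trans (cong (λ z → (twist (ω x z) ⊠ A x) ⊠ B z) (⊝-self x))
    (trans (cong₂ _⊠_ (trans (cong (λ t → twist t ⊠ A x) (ω-𝟎ʳ x)) (𝔽.*-identityˡ (A x))) b1) (𝔽.*-identityʳ (A x)))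

  summand-zero : ∀ A B x a → A a ⊠ B (x ⊝ a) ≡ 0ℚ → summand A B x a ≡ 0ℚ
  summand-zero A B x a e = trans (𝔽.*-assoc _ (A a) _) (⊠-zeroʳ e)

  ⊝-≡𝟎 : ∀ {x a : L} → x ⊝ a ≡ 𝟎 → x ≡ a
  ⊝-≡𝟎 {x} {a} e = trans (sym (⊝-⊕ x a)) (trans (cong (_⊕ a) e) (solveᴸ (a ∷ []) (:0 ∔ v₀) v₀ refl))

  module _ {s : Seed} {A B C : L → ℚ} (F : Factors s A B C) where
    open Factors F

    product-split : ∀ x → x ≢ 𝟎 → (∀ a → a ≢ 𝟎 → a ≢ x → A a ⊠ B (x ⊝ a) ≡ 0ℚ) → C x ≡ A x ⊞ B x
    product-split x ne h = trans (hasSum-unique (prod x) (hasSum-cong pointwise (hasSum-add (hasSum-at 𝟎 (B x)) (hasSum-at x (A x))))) (𝔽.+-comm (B x) (A x))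
      where
      pointwise : ∀ a → at 𝟎 (B x) a ⊞ at x (A x) a ≡ summand A B x a
      pointwise a with 𝟎 ≟ᴸ a | x ≟ᴸ a
      ... | yes refl | yes e    = ⊥-elim (ne e)
      ... | yes refl | no _     = trans (𝔽.+-identityʳ _) (sym (summand-first A B x oneA))
      ... | no _     | yes refl = trans (𝔽.+-identityˡ _) (sym (summand-last A B x oneB))
      ... | no n0    | no nx    = trans (𝔽.+-identityˡ _) (sym (summand-zero A B x a (h a (n0 ∘ sym) (nx ∘ sym))))

    -- A functional that is positive at a sum is positive at one of the terms, so all proper terms vanish.
    bad-split : (v : Additive r) → ∀ x → 0≤ fun v x ℤ.- 1ℤ →
      (∀ y → 0≤ fun v y ℤ.- 1ℤ → 0≤ fun (height s) x ℤ.- 1ℤ ℤ.- fun (height s) y → A y ≡ 0ℚ × B y ≡ 0ℚ) → C x ≡ A x ⊞ B x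
    bad-split v x vx lower = product-split x x≢𝟎 zeros
      where
      ht : L → ℤ
      ht = fun (height s)
      x≢𝟎 : x ≢ 𝟎
      x≢𝟎 refl = ¬both (subst 0≤_ (cong (ℤ._- 1ℤ) (zeroᶠ v)) vx) 0≤-nat
      zeros : ∀ a → a ≢ 𝟎 → a ≢ x → A a ⊠ B (x ⊝ a) ≡ 0ℚ
      zeros a a≢𝟎 a≢x with cone? s a | cone? s (x ⊝ a)
      ... | inj₂ (i , q) | _ = ⊠-zeroˡ (coneA i a q)
      ... | inj₁ _ | inj₂ (i , q) = ⊠-zeroʳ (coneB i (x ⊝ a) q)
      ... | inj₁ ca | inj₁ cb with sign? (fun v a ℤ.- 1ℤ)
      ... | inj₁ p = ⊠-zeroˡ (proj₁ (lower a p (subst 0≤_ (trans (cong (ℤ._- 1ℤ) (subᶠ (height s) x a)) (aux (ht x) (ht a)))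
                       (height-pos s cb (λ e → a≢x (sym (⊝-≡𝟎 e)))))))
        where
        aux : ∀ p q → p ℤ.- q ℤ.- 1ℤ ≡ p ℤ.- 1ℤ ℤ.- q
        aux = solveℤ
      ... | inj₂ q = ⊠-zeroʳ (proj₂ (lower (x ⊝ a)
                       (subst 0≤_ (trans (aux₁ (fun v x) (fun v a)) (cong (ℤ._- 1ℤ) (sym (subᶠ v x a)))) (0≤-+ vx q))
                       (subst 0≤_ (trans (aux₂ (ht x) (ht a)) (cong (λ t → ht x ℤ.- 1ℤ ℤ.- t) (sym (subᶠ (height s) x a)))) (height-pos s ca a≢𝟎))))
        where
        aux₁ : ∀ x a → x ℤ.- 1ℤ ℤ.+ (ℤ.- 1ℤ ℤ.- (a ℤ.- 1ℤ)) ≡ x ℤ.- a ℤ.- 1ℤ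
        aux₁ = solveℤ
        aux₂ : ∀ x a → a ℤ.- 1ℤ ≡ x ℤ.- 1ℤ ℤ.- (x ℤ.- a)
        aux₂ = solveℤ

    -- Induction on the height: once the smaller bad degrees are known to vanish, `bad-split` leaves
    -- only `A x ⊞ B x = 0`, and `apart` finishes.
    factors-vanish : (v : Additive r) (H : ℤ) →
      (∀ x → 0≤ fun v x ℤ.- 1ℤ → 0≤ H ℤ.- fun (height s) x → C x ≡ 0ℚ) →
      ∀ x → 0≤ fun v x ℤ.- 1ℤ → 0≤ H ℤ.- fun (height s) x → A x ≡ 0ℚ × B x ≡ 0ℚ
    factors-vanish v H hC x = go (suc ∣ ht x ∣) x (∣∣-bound (ht x) ℕP.≤-refl)
      where
      ht : L → ℤ
      ht = fun (height s)
      go : ∀ n x → 0≤ + n ℤ.- 1ℤ ℤ.- ht x → 0≤ fun v x ℤ.- 1ℤ → 0≤ H ℤ.- ht x → A x ≡ 0ℚ × B x ≡ 0ℚ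
      go n x fuel vx hx with cone? s x
      ... | inj₂ (i , q) = coneA i x q , coneB i x q
      go zero x fuel vx hx | inj₁ cx = ⊥-elim (¬both (sumℤ-nonneg cx) fuel)
      go (suc n) x fuel vx hx | inj₁ cx = finish (apart x x≢𝟎)
        where
        x≢𝟎 : x ≢ 𝟎
        x≢𝟎 refl = ¬both (subst 0≤_ (cong (ℤ._- 1ℤ) (zeroᶠ v)) vx) 0≤-nat
        aux₁ : ∀ n x y → 1ℤ ℤ.+ n ℤ.- 1ℤ ℤ.- x ℤ.+ (x ℤ.- 1ℤ ℤ.- y) ≡ n ℤ.- 1ℤ ℤ.- y
        aux₁ = solveℤ
        aux₂ : ∀ h x y → h ℤ.- x ℤ.+ (x ℤ.- 1ℤ ℤ.- y) ℤ.+ 1ℤ ≡ h ℤ.- y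
        aux₂ = solveℤ
        split : C x ≡ A x ⊞ B x
        split = bad-split v x vx (λ y vy hy → go n y (subst 0≤_ (aux₁ (+ n) (ht x) (ht y)) (0≤-+ fuel hy)) vy
          (subst 0≤_ (aux₂ H (ht x) (ht y)) (0≤-+ (0≤-+ hx hy) (0≤-nat {1}))))
        Cx : A x ⊞ B x ≡ 0ℚ
        Cx = trans (sym split) (hC x vx hx)
        finish : A x ≡ 0ℚ ⊎ B x ≡ 0ℚ → A x ≡ 0ℚ × B x ≡ 0ℚ
        finish (inj₁ e) = e , trans (trans (sym (𝔽.+-identityˡ (B x))) (cong (_⊞ B x) (sym e))) Cx
        finish (inj₂ e) = trans (trans (sym (𝔽.+-identityʳ (A x))) (cong (A x ⊞_) (sym e))) Cx , e

  -- A sign function refining the sign of ω n and vanishing only on the rational line of n: a generic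
  -- perturbation of the stability condition ω n inside n^⊥.
  record Stability (n : L) : Set where
    field
      sgn     : L → Sgn
      sgn-⊖   : ∀ a → sgn (⊖ a) ≡ flip (sgn a)
      pos+pos : ∀ {a b} → sgn a ≡ pos → sgn b ≡ pos → sgn (a ⊕ b) ≡ pos
      pos+nul : ∀ {a b} → sgn a ≡ pos → sgn b ≡ nul → sgn (a ⊕ b) ≡ pos
      nul+nul : ∀ {a b} → sgn a ≡ nul → sgn b ≡ nul → sgn (a ⊕ b) ≡ nul
      sgn-n   : sgn n ≡ nul
      aligned : ∀ a → sgn a ≡ pos → 0≤ ω n a
      line    : ∀ a → sgn a ≡ nul → a ≢ 𝟎 → (φ : Additive r) → fun φ a ≡ 0ℤ → fun φ n ≡ 0ℤ

    sgn-𝟎 : sgn 𝟎 ≡ nul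
    sgn-𝟎 = trans (cong sgn (sym (⊝-self n))) (nul+nul sgn-n (trans (sgn-⊖ n) (cong flip sgn-n)))

    pos-· : ∀ {a} l → sgn a ≡ pos → sgn (suc l · a) ≡ pos
    pos-· zero    h = trans (cong sgn (⊕-identityʳ _)) h
    pos-· (suc l) h = pos+pos h (pos-· l h)

    nul-· : ∀ {a} l → sgn a ≡ nul → sgn (l · a) ≡ nul
    nul-· zero    h = sgn-𝟎
    nul-· (suc l) h = nul+nul h (nul-· l h)

    -- Positive multiples of a positive or negative vector keep its sign, so sign zero can only come
    -- from sign zero.
    nul-root : ∀ {a} l → sgn (suc l · a) ≡ nul → sgn a ≡ nul
    nul-root {a} l h with sgn a in e
    ... | nul = refl
    ... | pos = case trans (sym h) (pos-· l e) of λ ()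
    ... | ngt = case trans (sym (trans (sgn-⊖ (suc l · a)) (cong flip h)))
                  (trans (cong sgn (sym (·-⊖ (suc l) a))) (pos-· l (trans (sgn-⊖ a) (cong flip e)))) of λ ()

    pos-stays : ∀ {x a} l → sgn x ≡ pos → sgn a ≢ ngt → sgn (x ⊕ l · a) ≡ pos
    pos-stays {x} {a} zero    hx ha = trans (cong sgn (⊕-identityʳ x)) hx
    pos-stays {x} {a} (suc l) hx ha with sgn a in e
    ... | pos = pos+pos hx (pos-· l e)
    ... | nul = pos+nul hx (nul-· (suc l) e)
    ... | ngt = ⊥-elim (ha refl)

  -- The wall-crossing picture at a generic point of n^⊥: `A` has the degrees of positive sign, `B`
  -- those of sign zero or negative. A zero degree plus a negative one is negative, so at the degree
  -- `n` itself `B` shows the coefficient of the wall alone.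
  record Factorization (s : Seed) (n : L) (Θ : L → ℚ) : Set where
    field
      stability : Stability n
      A B       : L → ℚ
      coneA     : ConeSupported s A
      coneB     : ConeSupported s B
      oneA      : A 𝟎 ≡ 1ℚ
      oneB      : B 𝟎 ≡ 1ℚ
      posA      : ∀ x → x ≢ 𝟎 → Stability.sgn stability x ≢ pos → A x ≡ 0ℚ
      posB      : ∀ x → Stability.sgn stability x ≡ pos → B x ≡ 0ℚ
      prod      : IsProduct A B Θ

    factors : Factors s A B Θ
    factors = record { coneA = coneA ; coneB = coneB ; oneA = oneA ; oneB = oneB ; prod = prod
      ; apart = λ x ne → case pos? (Stability.sgn stability x) of λ { (inj₁ p) → inj₂ (posB x p) ; (inj₂ q) → inj₁ (posA x ne q) } }

  side : ∀ {s n Θ} → Factorization s n Θ → L → Sgn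
  side F = Stability.sgn (Factorization.stability F)

  Simple : Seed → L → Set
  Simple s n = ∃₂ λ i l → n ≡ l · c s i

  -- Θ is the Donaldson–Thomas element of the seed: the only incoming walls of its scattering diagram
  -- are the hyperplanes of the c-vectors, and these carry the quantum dilogarithm.
  record IsDT (s : Seed) (Θ : L → ℚ) : Set where
    field
      cone     : ConeSupported s Θ
      one      : Θ 𝟎 ≡ 1ℚ
      simple   : ∀ i l → Θ (l · c s i) ≡ dilog l
      incoming : ∀ n → n ≢ 𝟎 → Σ (Factorization s n Θ) λ F → Simple s n ⊎ Factorization.B F n ≡ 0ℚ

-- Mutation of Donaldson–Thomas elements

infixr 7 _•_

_•_ : ∀ {r} → ℤ → Lattice r → Lattice r
z • x = Vec.map (z ℤ.*_) x

lookup-• : ∀ {r} (i : Fin r) z (x : Lattice r) → lookup (z • x) i ≡ z ℤ.* lookup x i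
lookup-• i z x = VecP.lookup-map i (z ℤ.*_) x

lookupᶠ : ∀ {r} → Fin r → Additive r
lookupᶠ i = record { fun = λ x → lookup x i ; add = lookup-⊕ i }

•-+ : ∀ {r} a b (x : Lattice r) → (a ℤ.+ b) • x ≡ a • x ⊕ b • x
•-+ a b x = lattice-ext λ i → trans (lookup-• i (a ℤ.+ b) x) (trans (ℤP.*-distribʳ-+ (lookup x i) a b)
  (sym (trans (lookup-⊕ i (a • x) (b • x)) (cong₂ ℤ._+_ (lookup-• i a x) (lookup-• i b x)))))

•-nat : ∀ {r} l (x : Lattice r) → (+ l) • x ≡ l · x
•-nat l x = lattice-ext λ i → trans (lookup-• i (+ l) x) (sym (mulᶠ (lookupᶠ i) l x))

•-neg : ∀ {r} z (x : Lattice r) → (ℤ.- z) • x ≡ ⊖ (z • x)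
•-neg z x = lattice-ext λ i → trans (lookup-• i (ℤ.- z) x) (trans (sym (ℤP.neg-distribˡ-* z (lookup x i)))
  (sym (trans (lookup-⊖ i (z • x)) (cong ℤ.-_ (lookup-• i z x)))))

0• : ∀ {r} (x : Lattice r) → 0ℤ • x ≡ 𝟎
0• x = •-nat 0 x

mulᶠ-• : ∀ {r} (φ : Additive r) z x → fun φ (z • x) ≡ z ℤ.* fun φ x
mulᶠ-• φ (+ l)    x = trans (cong (fun φ) (•-nat l x)) (mulᶠ φ l x)
mulᶠ-• φ -[1+ l ] x = trans (cong (fun φ) (trans (•-neg (+ suc l) x) (cong ⊖_ (•-nat (suc l) x))))
  (trans (negᶠ φ (suc l · x)) (trans (cong ℤ.-_ (mulᶠ φ (suc l) x)) (ℤP.neg-distribˡ-* (+ suc l) (fun φ x))))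

·-distrib-⊕ : ∀ {r} l (x y : Lattice r) → l · (x ⊕ y) ≡ l · x ⊕ l · y
·-distrib-⊕ zero    x y = solveᴸ [] :0 (:0 ∔ :0) refl
·-distrib-⊕ (suc l) x y = trans (cong (x ⊕ y ⊕_) (·-distrib-⊕ l x y))
  (solveᴸ (x ∷ y ∷ l · x ∷ l · y ∷ []) ((v₀ ∔ v₁) ∔ (v₂ ∔ v₃)) ((v₀ ∔ v₂) ∔ (v₁ ∔ v₃)) refl)

module SeedMutation {r : ℕ} (W : SkewForm r) where

  open Seeds W public

  private
    L : Set
    L = Lattice r

  module _ (cs : Fin r → L) (k : Fin r) where

    mutateᶜ : Fin r → L
    mutateᶜ j with j Fin.≟ k
    ... | yes _ = ⊖ cs k
    ... | no _  = cs j ⊕ [ ω (cs j) (cs k) ]₊ · cs k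

    mutateᶜ-same : mutateᶜ k ≡ ⊖ cs k
    mutateᶜ-same with k Fin.≟ k
    ... | yes _ = refl
    ... | no ne = ⊥-elim (ne refl)

    mutateᶜ-other : ∀ {j} → j ≢ k → mutateᶜ j ≡ cs j ⊕ [ ω (cs j) (cs k) ]₊ · cs k
    mutateᶜ-other {j} ne with j Fin.≟ k
    ... | yes e = ⊥-elim (ne e)
    ... | no _  = refl

  module _ (s : Seed) (k : Fin r) where

    private
      β : L
      β = c s k

    weight : Fin r → ℕ
    weight j = [ ω (c s j) β ]₊

    weight-k : weight k ≡ 0
    weight-k = cong [_]₊ (alt β)

    degree : Additive r
    degree = sumᶠ (λ j → scaleᶠ (+ weight j) (γ s j))

    degree-c : ∀ j → fun degree (c s j) ≡ + weight j
    degree-c j = trans (sumℤ-single {a = λ i → + weight i ℤ.* fun (γ s i) (c s j)} j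
      (λ i ne → trans (cong (+ weight i ℤ.*_) (γ-off s i j ne)) (ℤP.*-zeroʳ (+ weight i))))
      (trans (cong (+ weight j ℤ.*_) (γ-diag s j)) (ℤP.*-identityʳ _))

    degree-β : fun degree β ≡ 0ℤ
    degree-β = trans (degree-c k) (cong +_ weight-k)

    degree-axis : ∀ x → (∀ i → i ≢ k → fun (γ s i) x ≡ 0ℤ) → fun degree x ≡ 0ℤ
    degree-axis x h = sumℤ-zero λ i → zero-at i (i Fin.≟ k)
      where
      zero-at : ∀ i → Dec (i ≡ k) → + weight i ℤ.* fun (γ s i) x ≡ 0ℤ
      zero-at i (yes refl) = cong (λ w → + w ℤ.* fun (γ s k) x) weight-k
      zero-at i (no ne)    = trans (cong (+ weight i ℤ.*_) (h i ne)) (ℤP.*-zeroʳ (+ weight i))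

    -- Dual to `mutateᶜ`: since c_j = c'_j + w_j c'_k for j ≠ k and c_k = -c'_k, the coordinate of x
    -- = Σ x_j c_j along c'_k is Σ w_j x_j - x_k, where w_k = 0.
    mutateᵞ : Fin r → Additive r
    mutateᵞ j with j Fin.≟ k
    ... | yes _ = degree ⊟ᶠ γ s k
    ... | no _  = γ s j

    mutateᵞ-same : mutateᵞ k ≡ degree ⊟ᶠ γ s k
    mutateᵞ-same with k Fin.≟ k
    ... | yes _ = refl
    ... | no ne = ⊥-elim (ne refl)

    mutateᵞ-other : ∀ {j} → j ≢ k → mutateᵞ j ≡ γ s j
    mutateᵞ-other {j} ne with j Fin.≟ k
    ... | yes e = ⊥-elim (ne e)
    ... | no _  = refl

    private
      γk : L → ℤ
      γk = fun (γ s k)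

      off-k : ∀ j → j ≢ k → fun (degree ⊟ᶠ γ s k) (c s j ⊕ weight j · β) ≡ 0ℤ
      off-k j ne = trans (add (degree ⊟ᶠ γ s k) (c s j) (weight j · β)) (trans (cong₂ ℤ._+_
        (cong₂ (λ p q → p ℤ.+ ℤ.- q) (degree-c j) (γ-off s k j (ne ∘ sym)))
        (trans (mulᶠ (degree ⊟ᶠ γ s k) (weight j) β) (cong₂ (λ p q → + weight j ℤ.* (p ℤ.+ ℤ.- q)) degree-β (γ-diag s k))))
        (aux (+ weight j)))
        where
        aux : ∀ w → w ℤ.+ ℤ.- 0ℤ ℤ.+ w ℤ.* (0ℤ ℤ.+ ℤ.- 1ℤ) ≡ 0ℤ
        aux = solveℤ

      on-k : fun (degree ⊟ᶠ γ s k) (⊖ β) ≡ 1ℤ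
      on-k = trans (negᶠ (degree ⊟ᶠ γ s k) β) (cong₂ (λ p q → ℤ.- (p ℤ.+ ℤ.- q)) degree-β (γ-diag s k))

      off : ∀ i j → i ≢ k → j ≢ k → fun (γ s i) (c s j ⊕ weight j · β) ≡ fun (γ s i) (c s j)
      off i j ni nj = trans (add (γ s i) (c s j) (weight j · β)) (trans (cong (λ t → fun (γ s i) (c s j) ℤ.+ t)
        (trans (mulᶠ (γ s i) (weight j) β) (trans (cong (+ weight j ℤ.*_) (γ-off s i k ni)) (ℤP.*-zeroʳ (+ weight j))))) (ℤP.+-identityʳ _))

    mutateˢ : Seed
    mutateˢ = record { c = mutateᶜ (c s) k ; γ = mutateᵞ ; γ-diag = diag ; γ-off = offd ; complete = comp }
      where
      diag : ∀ i → fun (mutateᵞ i) (mutateᶜ (c s) k i) ≡ 1ℤ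
      diag i with i Fin.≟ k
      ... | yes refl = on-k
      ... | no ne    = trans (off i i ne ne) (γ-diag s i)
      offd : ∀ i j → i ≢ j → fun (mutateᵞ i) (mutateᶜ (c s) k j) ≡ 0ℤ
      offd i j ne with i Fin.≟ k | j Fin.≟ k
      ... | yes refl | yes refl = ⊥-elim (ne refl)
      ... | yes refl | no nj    = off-k j nj
      ... | no ni    | yes refl = trans (negᶠ (γ s i) β) (cong ℤ.-_ (γ-off s i k ni))
      ... | no ni    | no nj    = trans (off i j ni nj) (γ-off s i j ne)
      comp : ∀ x → (∀ i → fun (mutateᵞ i) x ≡ 0ℤ) → x ≡ 𝟎
      comp x h = complete s x λ i → at-i i (i Fin.≟ k)
        where
        others : ∀ i → i ≢ k → fun (γ s i) x ≡ 0ℤ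
        others i ne = trans (cong (λ φ → fun φ x) (sym (mutateᵞ-other ne))) (h i)
        at-i : ∀ i → Dec (i ≡ k) → fun (γ s i) x ≡ 0ℤ
        at-i i (no ne)    = others i ne
        at-i i (yes refl) = trans (aux (fun degree x) (γk x)) (cong₂ ℤ._-_ (degree-axis x others)
          (trans (cong (λ φ → fun φ x) (sym mutateᵞ-same)) (h k)))
          where
          aux : ∀ d g → g ≡ d ℤ.- (d ℤ.+ ℤ.- g)
          aux = solveℤ

sumN-single : ∀ n {F : ℕ → ℚ} l → l ℕ.< n → (∀ m → m ≢ l → F m ≡ 0ℚ) → sumN n F ≡ F l
sumN-single (suc n) {F} zero    _       h = sumN-first n (λ m → h (suc m) (λ ()))
sumN-single (suc n) {F} (suc l) (s≤s q) h = trans (sumN-suc n F) (trans (cong (_⊞ sumN n (F ∘ suc)) (h 0 (λ ())))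
  (trans (𝔽.+-identityˡ _) (sumN-single n l q (λ m ne → h (suc m) (λ e → ne (ℕP.suc-injective e))))))

opaque
  unit : ∀ {r} → Lattice r → ℚ
  unit = at 𝟎 1ℚ

  unit-𝟎 : ∀ {r} → unit (𝟎 {r}) ≡ 1ℚ
  unit-𝟎 {r} = at-≡ (𝟎 {r}) 1ℚ

  unit-off : ∀ {r} {x : Lattice r} → x ≢ 𝟎 → unit x ≡ 0ℚ
  unit-off {x = x} ne = at-≢ {a = 𝟎} {b = x} 1ℚ (ne ∘ sym)

unit-supported : ∀ {r} (φ : Additive r) → SupportedOn φ unit
unit-supported φ x nx = unit-off λ { refl → ¬both {0ℤ} 0≤-nat (subst Negative (zeroᶠ φ) nx) }

multiple-injective : ∀ {r} (φ : Additive r) {d : Lattice r} → 0≤ fun φ d ℤ.- 1ℤ → ∀ l m → l · d ≡ m · d → l ≡ m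
multiple-injective φ {d} φd l m e = go (fun φ d) φd (trans (sym (mulᶠ φ l d)) (trans (cong (fun φ) e) (mulᶠ φ m d)))
  where
  go : ∀ z → 0≤ z ℤ.- 1ℤ → + l ℤ.* z ≡ + m ℤ.* z → l ≡ m
  go (+ suc n) _ h = ℤP.+-injective (ℤP.*-cancelʳ-≡ (+ l) (+ m) (+ suc n) h)
  go (+ zero) () h
  go -[1+ n ] () h

act-unit : ∀ {r} (φ : Additive r) g (d : Lattice r) → 0≤ fun φ d ℤ.- 1ℤ → ∀ l → act φ 0ℤ g d unit (l · d) ≡ g l
act-unit φ g d φd l = trans (sym (act-bound φ d φd (unit-supported φ) 0ℤ g M (∣∣-bound (fun φ (l · d)) (ℕP.m≤m+n (suc ∣ fun φ (l · d) ∣) (suc l)))))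
  (trans (sumN-single M l (ℕP.m≤n+m (suc l) (suc ∣ fun φ (l · d) ∣)) zeros)
    (trans (cong (λ z → (g l ⊠ twist (0ℤ ℤ.* + l)) ⊠ unit z) (⊝-self (l · d)))
      (trans (cong₂ _⊠_ (trans (cong (g l ⊠_) (cong twist (ℤP.*-zeroˡ (+ l)))) (𝔽.*-identityʳ (g l))) unit-𝟎) (𝔽.*-identityʳ (g l)))))
  where
  M = suc ∣ fun φ (l · d) ∣ ℕ.+ suc l
  zeros : ∀ m → m ≢ l → term 0ℤ g d unit (l · d) m ≡ 0ℚ
  zeros m ne = ⊠-zeroʳ (unit-off (λ e → ne (multiple-injective φ φd m l (sym (trans (sym (⊝-⊕ (l · d) (m · d)))
    (trans (cong (_⊕ m · d) e) (solveᴸ (m · d ∷ []) (:0 ∔ v₀) v₀ refl)))))))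

module DTMutation {r : ℕ} (W : SkewForm r) where

  open SeedMutation W public

  private
    L : Set
    L = Lattice r

  -- Multiplication by E from the left is E(t^(-n) Z) on this chain and division from the right is
  -- 1/E(t^n Z). Their ratio is a product of `n` binomials, so two infinite series are compared by a
  -- finite relation.
  quotient-chain : (φ : Additive r) (d : L) (φd : 0≤ fun φ d ℤ.- 1ℤ) {Θ G : L → ℚ} → SupportedOn φ G → ∀ n x →
    (∀ l → Θ (x ⊝ l · d) ≡ act φ (ℤ.- + n) dilog d G (x ⊝ l · d)) →
    act φ (+ n) dilog⁻¹ d Θ x ≡ binom n (1ℤ ℤ.- + n) d G x
  quotient-chain φ d φd {Θ} {G} bG n x h =
    trans (act-cong φ (+ n) dilog⁻¹ d {Θ} {act φ (+ n) dilog d (binom n (1ℤ ℤ.- + n) d G)} x chain)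
      (act-inverse φ d φd (binom-supported φ d φd n (1ℤ ℤ.- + n) bG) (+ n) dilog⁻¹ dilog dilog⁻¹⊛dilog x)
    where
    e₁ : ∀ n → ℤ.- n ≡ 1ℤ ℤ.- n ℤ.- 1ℤ
    e₁ = solveℤ
    e₂ : ∀ n → 1ℤ ℤ.- n ℤ.- 1ℤ ℤ.+ + 2 ℤ.* n ≡ n
    e₂ = solveℤ
    chain : ∀ l → Θ (x ⊝ l · d) ≡ act φ (+ n) dilog d (binom n (1ℤ ℤ.- + n) d G) (x ⊝ l · d)
    chain l = trans (h l) (trans (cong (λ κ → act φ κ dilog d G y) (e₁ (+ n)))
      (trans (act-dilog-binom φ d φd n (1ℤ ℤ.- + n) bG y)
        (trans (cong (λ κ → binom n (1ℤ ℤ.- + n) d (act φ κ dilog d G) y) (e₂ (+ n)))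
          (binom-act φ d φd n (1ℤ ℤ.- + n) (+ n) dilog bG y))))
      where y = x ⊝ l · d

  -- Instantiated twice: for `β` in the old seed and for `⊖ β` in the mutated one.
  module Axis (t : Seed) (k : Fin r) (d : L) (ψd : 0≤ fun (γ t k) d ℤ.- 1ℤ) (γd≥0 : ∀ i → 0≤ fun (γ t i) d) where

    private
      ψ : Additive r
      ψ = γ t k

    act-cone : ∀ κ g {f} → ConeSupported t f → ConeSupported t (act ψ κ g d f)
    act-cone κ g bf i = act-supported ψ κ g d (γ t i) (γd≥0 i) (bf i)

    actˡ-cone : ∀ g {f} → ConeSupported t f → ConeSupported t (actˡ ψ g d f)
    actˡ-cone g bf i x = act-cone (ω d x) g bf i x

    actʳ-cone : ∀ g {f} → ConeSupported t f → ConeSupported t (actʳ ψ g d f)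
    actʳ-cone g bf i x = act-cone (ω x d) g bf i x

    below-negative : ∀ l → Negative (fun ψ (𝟎 ⊝ suc l · d))
    below-negative l = shift-negative ψ d ψd 1 (subst (λ t → 0≤ 1ℤ ℤ.- 1ℤ ℤ.- t) (sym (zeroᶠ ψ)) 0≤-nat) (suc l) (s≤s z≤n)

    act-one : ∀ κ g {f} → g 0 ≡ 1ℚ → ConeSupported t f → f 𝟎 ≡ 1ℚ → act ψ κ g d f 𝟎 ≡ 1ℚ
    act-one κ g {f} g0 bf f1 = trans (act-head ψ κ g d {f} 𝟎 g0 (λ l → bf k (𝟎 ⊝ suc l · d) (below-negative l))) f1

    module _ (g : ℕ → ℚ) (g0 : g 0 ≡ 1ℚ) {n : L} {Θ : L → ℚ} (F : Factorization t n Θ) where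
      open Factorization F
      open Stability stability

      ⊝-stays-pos : ∀ x l → sgn d ≢ pos → sgn x ≡ pos → sgn (x ⊝ l · d) ≡ pos
      ⊝-stays-pos x l sd px = trans (cong (λ z → sgn (x ⊕ z)) (sym (·-⊖ l d))) (pos-stays l px (λ e → sd (unflip (trans (sym (sgn-⊖ d)) e))))
        where
        unflip : ∀ {t} → flip t ≡ ngt → t ≡ pos
        unflip {pos} _ = refl

      ⊝-stays-notpos : ∀ x l → sgn d ≢ ngt → sgn x ≢ pos → sgn (x ⊝ l · d) ≢ pos
      ⊝-stays-notpos x l sd np e = np (trans (cong sgn (sym (⊝-⊕ x (l · d)))) (pos-stays l e sd))

      -- `B` can absorb the factor as long as `d` is not positive: subtracting multiples of `d` from
      -- a positive degree leaves it positive, so `B` still vanishes there. A positive `d` is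
      -- absorbed by `A` on the left instead.
      multiplyʳ : sgn d ≢ pos → Factorization t n (actʳ ψ g d Θ)
      multiplyʳ sd = record
        { stability = stability ; A = A ; B = actʳ ψ g d B ; coneA = coneA ; coneB = actʳ-cone g coneB
        ; oneA = oneA ; oneB = act-one (ω 𝟎 d) g g0 coneB oneB ; posA = posA
        ; posB = λ x px → act-zero ψ (ω x d) g d {B} x (λ l → posB _ (⊝-stays-pos x l sd px))
        ; prod = product-actʳ ψ d ψd (coneA k) (coneB k) g prod }

      multiplyˡ : sgn d ≡ pos → Factorization t n (actˡ ψ g d Θ)
      multiplyˡ sd = record
        { stability = stability ; A = actˡ ψ g d A ; B = B ; coneA = actˡ-cone g coneA ; coneB = coneB
        ; oneA = act-one (ω d 𝟎) g g0 coneA oneA ; oneB = oneB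
        ; posA = λ x ne np → act-zero ψ (ω d x) g d {A} x (λ l → posA _ (nonzero x l ne np) (⊝-stays-notpos x l (λ e → case trans (sym sd) e of λ ()) np))
        ; posB = posB
        ; prod = product-actˡ ψ d ψd (coneA k) (coneB k) g prod }
        where
        nonzero : ∀ x l → x ≢ 𝟎 → sgn x ≢ pos → x ⊝ l · d ≢ 𝟎
        nonzero x zero    ne np e = ne (trans (sym (⊝-𝟎 x)) e)
        nonzero x (suc l) ne np e = np (trans (cong sgn (⊝-≡𝟎 e)) (pos-· l sd))

      -- B is unchanged at n, since n - ld lies on the positive side.
      multiplyʳ-value : sgn d ≡ ngt → actʳ ψ g d B n ≡ B n
      multiplyʳ-value sd = act-head ψ (ω n d) g d {B} n g0 λ l → posB _
        (trans (cong (λ z → sgn (n ⊕ z)) (sym (·-⊖ (suc l) d))) (trans (cong sgn (solveᴸ (n ∷ suc l · ⊖ d ∷ []) (v₀ ∔ v₁) (v₁ ∔ v₀) refl))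
          (pos+nul (pos-· l (trans (sgn-⊖ d) (cong flip sd))) sgn-n)))

  module Quotients (s : Seed) (k : Fin r) {Θ : L → ℚ} (D : IsDT s Θ) where

    open IsDT D

    β : L
    β = c s k
    φ : Additive r
    φ = γ s k
    φβ : 0≤ fun φ β ℤ.- 1ℤ
    φβ = γd s k
    ht : L → ℤ
    ht = fun (height s)

    γβ : ∀ i → 0≤ fun (γ s i) β
    γβ i with i Fin.≟ k
    ... | yes refl = subst 0≤_ (sym (γ-diag s k)) 0≤-nat
    ... | no ne    = subst 0≤_ (sym (γ-off s i k ne)) 0≤-nat

    open Axis s k β φβ γβ public

    -- Θ = rightQ * E = E * leftQ.
    rightQ leftQ : L → ℚ
    rightQ = actʳ φ dilog⁻¹ β Θ
    leftQ  = actˡ φ dilog⁻¹ β Θ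

    rightQ-cone : ConeSupported s rightQ
    rightQ-cone = actʳ-cone dilog⁻¹ cone

    leftQ-cone : ConeSupported s leftQ
    leftQ-cone = actˡ-cone dilog⁻¹ cone

    Θ-right : ∀ x → actʳ φ dilog β rightQ x ≡ Θ x
    Θ-right = actʳ-inverse φ β φβ (cone k) dilog dilog⁻¹ dilog⊛dilog⁻¹

    Θ-left : ∀ x → actˡ φ dilog β leftQ x ≡ Θ x
    Θ-left = actˡ-inverse φ β φβ (cone k) dilog dilog⁻¹ dilog⊛dilog⁻¹

    -- The quotients differ by conjugation with E, and the relation is polynomial in a direction
    -- that depends on the degree: for `ω x β ≥ 0` it expresses `rightQ` through `leftQ`, for
    -- `ω x β ≤ 0` the other way round.
    right-from-left : ∀ n x → ω x β ≡ + n → rightQ x ≡ binom n (1ℤ ℤ.- + n) β leftQ x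
    right-from-left n x e = trans (cong (λ κ → act φ κ dilog⁻¹ β Θ x) e)
      (quotient-chain φ β φβ {Θ} (leftQ-cone k) n x (λ l → trans (sym (Θ-left _))
        (cong (λ κ → act φ κ dilog β leftQ (x ⊝ l · β)) (trans (ω-shiftˡ x β l) (trans (skew β x) (cong ℤ.-_ e))))))

    left-from-right : ∀ n x → ω x β ≡ ℤ.- + n → leftQ x ≡ binom n (1ℤ ℤ.- + n) β rightQ x
    left-from-right n x e = trans (cong (λ κ → act φ κ dilog⁻¹ β Θ x) (trans (skew β x) (trans (cong ℤ.-_ e) (ℤP.neg-involutive (+ n)))))
      (quotient-chain φ β φβ {Θ} (rightQ-cone k) n x (λ l → trans (sym (Θ-right _))
        (cong (λ κ → act φ κ dilog β rightQ (x ⊝ l · β)) (trans (ω-shiftʳ x β l) e))))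

    OnAxis : L → Set
    OnAxis x = ∀ i → i ≢ k → fun (γ s i) x ≡ 0ℤ

    axis-form : ∀ x → OnAxis x → x ≡ fun φ x • β
    axis-form x h = ⊝-≡𝟎 (complete s _ λ i → trans (subᶠ (γ s i) x (fun φ x • β)) (trans (cong (λ t → fun (γ s i) x ℤ.- t) (mulᶠ-• (γ s i) (fun φ x) β)) (at-i i (i Fin.≟ k))))
      where
      at-i : ∀ i → Dec (i ≡ k) → fun (γ s i) x ℤ.- fun φ x ℤ.* fun (γ s i) β ≡ 0ℤ
      at-i i (yes refl) = trans (cong (λ t → fun φ x ℤ.- fun φ x ℤ.* t) (γ-diag s k)) (aux (fun φ x))
        where
        aux : ∀ a → a ℤ.- a ℤ.* 1ℤ ≡ 0ℤ
        aux = solveℤ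
      at-i i (no ne) = trans (cong₂ (λ p t → p ℤ.- fun φ x ℤ.* t) (h i ne) (γ-off s i k ne)) (aux (fun φ x))
        where
        aux : ∀ a → 0ℤ ℤ.- a ℤ.* 0ℤ ≡ 0ℤ
        aux = solveℤ

    axis-· : ∀ l → OnAxis (l · β)
    axis-· l i ne = trans (mulᶠ (γ s i) l β) (trans (cong (+ l ℤ.*_) (γ-off s i k ne)) (ℤP.*-zeroʳ (+ l)))

    axis-⊝ : ∀ {x} → OnAxis x → ∀ l → OnAxis (x ⊝ l · β)
    axis-⊝ {x} h l i ne = trans (subᶠ (γ s i) x (l · β)) (cong₂ ℤ._-_ (h i ne) (axis-· l i ne))

    ω-axis : ∀ {x} → OnAxis x → ω x β ≡ 0ℤ
    ω-axis {x} h = trans (cong (λ z → ω z β) (axis-form x h)) (trans (mulᶠ-• (ωˡ β) (fun φ x) β) (trans (cong (fun φ x ℤ.*_) (alt β)) (ℤP.*-zeroʳ (fun φ x))))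

    Θ-axis : ∀ x → OnAxis x → Θ x ≡ act φ 0ℤ dilog β unit x
    Θ-axis x h = go (fun φ x) refl
      where
      go : ∀ z → fun φ x ≡ z → Θ x ≡ act φ 0ℤ dilog β unit x
      go (+ l) e = trans (trans (cong Θ x≡) (simple k l)) (sym (trans (cong (act φ 0ℤ dilog β unit) x≡) (act-unit φ dilog β φβ l)))
        where
        x≡ : x ≡ l · β
        x≡ = trans (axis-form x h) (trans (cong (_• β) e) (•-nat l β))
      go -[1+ l ] e = trans (cone k x nx) (sym (act-supported φ 0ℤ dilog β φ (γβ k) (unit-supported φ) x nx))
        where
        nx : Negative (fun φ x)
        nx = subst Negative (sym e) 0≤-nat

    rightQ-axis : ∀ x → OnAxis x → rightQ x ≡ unit x
    rightQ-axis x h = trans (cong (λ κ → act φ κ dilog⁻¹ β Θ x) (ω-axis h))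
      (trans (act-cong φ 0ℤ dilog⁻¹ β {Θ} {act φ 0ℤ dilog β unit} x (λ l → Θ-axis _ (axis-⊝ h l)))
        (act-inverse φ β φβ (unit-supported φ) 0ℤ dilog⁻¹ dilog dilog⁻¹⊛dilog x))

    -- The mutated coordinate along `⊖ β` is the negative of `v`, so it forbids exactly `v ≥ 1`. As
    -- `v β = 1`, `v′` is `v` composed with x ↦ x + ω(x, β) β: the corresponding half-space for the
    -- left quotient.
    v v′ : Additive r
    v  = φ ⊟ᶠ degree s k
    v′ = v ⊞ᶠ ωˡ β

    v-β : fun v β ≡ 1ℤ
    v-β = cong₂ (λ p q → p ℤ.+ ℤ.- q) (γ-diag s k) (degree-β s k)

    v′-β : fun v′ β ≡ 1ℤ
    v′-β = cong₂ ℤ._+_ v-β (alt β)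

    v-c : ∀ i → i ≢ k → fun v (c s i) ≡ ℤ.- + weight s k i
    v-c i ne = trans (cong₂ (λ p q → p ℤ.+ ℤ.- q) (γ-off s k i (ne ∘ sym)) (degree-c s k i)) (ℤP.+-identityˡ _)

    v-simple : ∀ i → i ≢ k → 0≤ ℤ.- fun v (c s i)
    v-simple i ne = subst 0≤_ (sym (trans (cong ℤ.-_ (v-c i ne)) (ℤP.neg-involutive _))) 0≤-nat

    v′-simple : ∀ i → i ≢ k → 0≤ ℤ.- fun v′ (c s i)
    v′-simple i ne = subst 0≤_ (trans (aux (+ weight s k i) (ω (c s i) β)) (cong (λ t → ℤ.- (t ℤ.+ ω (c s i) β)) (sym (v-c i ne)))) ([]₊-≥ (ω (c s i) β))
      where
      aux : ∀ w b → w ℤ.- b ≡ ℤ.- (ℤ.- w ℤ.+ b)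
      aux = solveℤ

    nonpos-multiple : (u : Additive r) (d : L) → 0≤ ℤ.- fun u d → ∀ l → 0≤ ℤ.- fun u (l · d)
    nonpos-multiple u d h l = subst 0≤_ (trans (aux (+ l) (fun u d)) (cong ℤ.-_ (sym (mulᶠ u l d)))) (0≤-* {+ l} 0≤-nat h)
      where
      aux : ∀ l a → l ℤ.* ℤ.- a ≡ ℤ.- (l ℤ.* a)
      aux = solveℤ

    ¬pos-nonpos : ∀ {z} → 0≤ z ℤ.- 1ℤ → 0≤ ℤ.- z → ⊥
    ¬pos-nonpos {z} p q = ¬both q (subst 0≤_ (aux z) p)
      where
      aux : ∀ z → z ℤ.- 1ℤ ≡ ℤ.- 1ℤ ℤ.- ℤ.- z
      aux = solveℤ

    step-height : ∀ x l → ht (x ⊝ l · β) ≡ ht x ℤ.- + l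
    step-height x l = trans (sub-mulᶠ (height s) x l β) (trans (cong (λ t → ht x ℤ.- + l ℤ.* t) (height-c s k)) (cong (λ t → ht x ℤ.- t) (ℤP.*-identityʳ (+ l))))

    divideʳ : ∀ {n} (F : Factorization s n Θ) → side F β ≢ pos → Factorization s n rightQ
    divideʳ = multiplyʳ dilog⁻¹ refl

    divideˡ : ∀ {n} (F : Factorization s n Θ) → side F β ≡ pos → Factorization s n leftQ
    divideˡ = multiplyˡ dilog⁻¹ refl

    simple-sgn : ∀ {n} (S : Stability n) → n ≢ 𝟎 → ∀ l → n ≡ l · β → Stability.sgn S β ≡ nul
    simple-sgn {n} S ne zero    e = ⊥-elim (ne e)
    simple-sgn {n} S ne (suc l) e = Stability.nul-root S l (trans (cong (Stability.sgn S) (sym e)) (Stability.sgn-n S))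

    ω-nonneg : ∀ {n} (S : Stability n) → Stability.sgn S β ≡ pos → 0≤ ω n β
    ω-nonneg S e = Stability.aligned S β e

    ω-nonpos : ∀ {n} (S : Stability n) → Stability.sgn S β ≡ ngt → 0≤ ℤ.- ω n β
    ω-nonpos {n} S e = subst 0≤_ (negᶠ (ωʳ n) β) (Stability.aligned S (⊖ β) (trans (Stability.sgn-⊖ S β) (cong flip e)))

    axis-of-nul : ∀ {n} (S : Stability n) → Stability.sgn S β ≡ nul → OnAxis n
    axis-of-nul S e i ne = Stability.line S β e (c≢𝟎 s k) (γ s i) (γ-off s i k ne)

    lower-bad : (u : Additive r) → fun u β ≡ 1ℤ → ∀ x l → 0≤ fun u x ℤ.- + l ℤ.- 1ℤ → 0≤ fun u (x ⊝ l · β) ℤ.- 1ℤ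
    lower-bad u uβ x l h = subst 0≤_ (cong (ℤ._- 1ℤ) (sym (trans (sub-mulᶠ u x l β) (trans (cong (λ t → fun u x ℤ.- + l ℤ.* t) uβ) (cong (λ t → fun u x ℤ.- t) (ℤP.*-identityʳ (+ l))))))) h

    -- Both quotients are supported in half-spaces: by induction on the height, using at each degree x
    -- the quotient in which the incoming condition at x lives; on the other one the bound follows from
    -- the binomial relation along the β-chain.
    quotients-vanish : ∀ n x → 0≤ + n ℤ.- 1ℤ ℤ.- ht x → (0≤ fun v x ℤ.- 1ℤ → rightQ x ≡ 0ℚ) × (0≤ fun v′ x ℤ.- 1ℤ → leftQ x ≡ 0ℚ)
    quotients-vanish n x fuel with cone? s x
    ... | inj₂ (i , q) = (λ _ → rightQ-cone i x q) , (λ _ → leftQ-cone i x q)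
    quotients-vanish zero x fuel | inj₁ cx = ⊥-elim (¬both (sumℤ-nonneg cx) fuel)
    quotients-vanish (suc n) x fuel | inj₁ cx with x ≟ᴸ 𝟎
    ... | yes refl = (λ p → ⊥-elim (¬both (subst 0≤_ (cong (ℤ._- 1ℤ) (zeroᶠ v)) p) 0≤-nat)) , (λ p → ⊥-elim (¬both (subst 0≤_ (cong (ℤ._- 1ℤ) (zeroᶠ v′)) p) 0≤-nat))
    ... | no x≢𝟎 = by-sign (sgn β) refl
      where
      F = proj₁ (incoming x x≢𝟎)
      open Factorization F
      open Stability stability
      val : Simple s x ⊎ B x ≡ 0ℚ
      val = proj₂ (incoming x x≢𝟎)
      rec : ∀ y → 0≤ ht x ℤ.- 1ℤ ℤ.- ht y → (0≤ fun v y ℤ.- 1ℤ → rightQ y ≡ 0ℚ) × (0≤ fun v′ y ℤ.- 1ℤ → leftQ y ≡ 0ℚ)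
      rec y hy = quotients-vanish n y (subst 0≤_ (aux (+ n) (ht x) (ht y)) (0≤-+ fuel hy))
        where
        aux : ∀ n x y → 1ℤ ℤ.+ n ℤ.- 1ℤ ℤ.- x ℤ.+ (x ℤ.- 1ℤ ℤ.- y) ≡ n ℤ.- 1ℤ ℤ.- y
        aux = solveℤ
      lower : ∀ l → 0≤ ht x ℤ.- 1ℤ ℤ.- ht (x ⊝ suc l · β)
      lower l = subst 0≤_ (sym (trans (cong (λ t → ht x ℤ.- 1ℤ ℤ.- t) (step-height x (suc l))) (aux (ht x) (+ l)))) (0≤-nat {l})
        where
        aux : ∀ x l → x ℤ.- 1ℤ ℤ.- (x ℤ.- (1ℤ ℤ.+ l)) ≡ l
        aux = solveℤ
      B-zero : (u : Additive r) → (∀ i → i ≢ k → 0≤ ℤ.- fun u (c s i)) → sgn β ≢ nul → 0≤ fun u x ℤ.- 1ℤ → B x ≡ 0ℚ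
      B-zero u us nβ p with val
      ... | inj₂ e = e
      ... | inj₁ (i , l , e) with i Fin.≟ k
      ... | yes refl = ⊥-elim (nβ (simple-sgn stability x≢𝟎 l e))
      ... | no ne    = ⊥-elim (¬pos-nonpos p (subst (λ z → 0≤ ℤ.- fun u z) (sym e) (nonpos-multiple u (c s i) (us i ne) l)))
      -- The degree `x` has sign zero for its own stability condition, so it belongs to `B`.
      Ax : A x ≡ 0ℚ
      Ax = posA x x≢𝟎 (λ e → case trans (sym e) sgn-n of λ ())
      by-sign : ∀ t → sgn β ≡ t → (0≤ fun v x ℤ.- 1ℤ → rightQ x ≡ 0ℚ) × (0≤ fun v′ x ℤ.- 1ℤ → leftQ x ≡ 0ℚ)
      by-sign nul eβ = (λ _ → right) , (λ _ → trans (left-from-right 0 x (ω-axis ax)) right)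
        where
        ax = axis-of-nul stability eβ
        right : rightQ x ≡ 0ℚ
        right = trans (rightQ-axis x ax) (unit-off x≢𝟎)
      by-sign ngt eβ = right , left
        where
        G : Factorization s x rightQ
        G = divideʳ F (λ e → case trans (sym e) eβ of λ ())
        right : 0≤ fun v x ℤ.- 1ℤ → rightQ x ≡ 0ℚ
        right p = trans (bad-split (Factorization.factors G) v x p
            (factors-vanish (Factorization.factors G) v (ht x ℤ.- 1ℤ) (λ y vy hy → proj₁ (rec y hy) vy)))
          (trans (cong₂ _⊞_ Ax (trans (multiplyʳ-value dilog⁻¹ refl F eβ) (B-zero v v-simple (λ e → case trans (sym e) eβ of λ ()) p))) (𝔽.+-identityˡ 0ℚ))
        m : ℕ
        m = ∣ ω x β ∣
        ωm : ω x β ≡ ℤ.- + m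
        ωm = nonpos-abs (ω-nonpos stability eβ)
          where
          nonpos-abs : ∀ {z} → 0≤ ℤ.- z → z ≡ ℤ.- + ∣ z ∣
          nonpos-abs {+ zero}  _ = refl
          nonpos-abs {+ suc n} ()
          nonpos-abs { -[1+ n ]} _ = refl
        left : 0≤ fun v′ x ℤ.- 1ℤ → leftQ x ≡ 0ℚ
        left p = trans (left-from-right m x ωm) (binom-zero m _ β x at-l)
          where
          -- Since `ω x β` is `- m`, `v′ x` is `v x - m`; hence `v` is still at least 1 at every
          -- point `x ⊝ l · β` with l ≤ m that the binomial relation uses.
          bad : ∀ l → l ℕ.≤ m → 0≤ fun v x ℤ.- + l ℤ.- 1ℤ
          bad l q = subst 0≤_ (trans (cong (λ w → fun v x ℤ.+ w ℤ.- 1ℤ ℤ.+ (+ m ℤ.- + l)) ωm) (aux (fun v x) (+ m) (+ l))) (0≤-+ p (ℤP.i≤j⇒0≤j-i (ℤ.+≤+ q)))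
            where
            aux : ∀ v m l → v ℤ.+ ℤ.- m ℤ.- 1ℤ ℤ.+ (m ℤ.- l) ≡ v ℤ.- l ℤ.- 1ℤ
            aux = solveℤ
          at-l : ∀ l → l ℕ.≤ m → rightQ (x ⊝ l · β) ≡ 0ℚ
          at-l zero    q = trans (cong rightQ (⊝-𝟎 x)) (right (subst 0≤_ (cong (ℤ._- 1ℤ) (ℤP.+-identityʳ (fun v x))) (bad 0 q)))
          at-l (suc l) q = proj₁ (rec _ (lower l)) (lower-bad v v-β x (suc l) (bad (suc l) q))
      by-sign pos eβ = right , left
        where
        G : Factorization s x leftQ
        G = divideˡ F eβ
        left : 0≤ fun v′ x ℤ.- 1ℤ → leftQ x ≡ 0ℚ
        left p = trans (bad-split (Factorization.factors G) v′ x p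
            (factors-vanish (Factorization.factors G) v′ (ht x ℤ.- 1ℤ) (λ y vy hy → proj₂ (rec y hy) vy)))
          (trans (cong₂ _⊞_ (Factorization.posA G x x≢𝟎 (λ e → case trans (sym e) sgn-n of λ ())) (B-zero v′ v′-simple (λ e → case trans (sym e) eβ of λ ()) p)) (𝔽.+-identityˡ 0ℚ))
        m : ℕ
        m = ∣ ω x β ∣
        ωm : ω x β ≡ + m
        ωm = sym (ℤP.0≤i⇒+∣i∣≡i (ω-nonneg stability eβ))
        right : 0≤ fun v x ℤ.- 1ℤ → rightQ x ≡ 0ℚ
        right p = trans (right-from-left m x ωm) (binom-zero m _ β x at-l)
          where
          bad : ∀ l → l ℕ.≤ m → 0≤ fun v′ x ℤ.- + l ℤ.- 1ℤ
          bad l q = subst 0≤_ (trans (aux (fun v x) (+ m) (+ l)) (cong (λ w → fun v x ℤ.+ w ℤ.- + l ℤ.- 1ℤ) (sym ωm))) (0≤-+ p (ℤP.i≤j⇒0≤j-i (ℤ.+≤+ q)))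
            where
            aux : ∀ v m l → v ℤ.- 1ℤ ℤ.+ (m ℤ.- l) ≡ v ℤ.+ m ℤ.- l ℤ.- 1ℤ
            aux = solveℤ
          at-l : ∀ l → l ℕ.≤ m → leftQ (x ⊝ l · β) ≡ 0ℚ
          at-l zero    q = trans (cong leftQ (⊝-𝟎 x)) (left (subst 0≤_ (cong (ℤ._- 1ℤ) (ℤP.+-identityʳ (fun v′ x))) (bad 0 q)))
          at-l (suc l) q = proj₂ (rec _ (lower l)) (lower-bad v′ v′-β x (suc l) (bad (suc l) q))

    rightQ-vanish : ∀ x → 0≤ fun v x ℤ.- 1ℤ → rightQ x ≡ 0ℚ
    rightQ-vanish x = proj₁ (quotients-vanish (suc ∣ ht x ∣) x (∣∣-bound (ht x) ℕP.≤-refl))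

    leftQ-vanish : ∀ x → 0≤ fun v′ x ℤ.- 1ℤ → leftQ x ≡ 0ℚ
    leftQ-vanish x = proj₂ (quotients-vanish (suc ∣ ht x ∣) x (∣∣-bound (ht x) ℕP.≤-refl))

module DTTransfer {r : ℕ} (W : SkewForm r) where

  open DTMutation W public

  private
    L : Set
    L = Lattice r

  product-cong : ∀ {A B C C′ : L → ℚ} → (∀ x → C x ≡ C′ x) → IsProduct A B C → IsProduct A B C′
  product-cong e P x = subst (HasSum _) (e x) (P x)

  retarget : ∀ {t n} {Θ Θ′ : L → ℚ} → (∀ x → Θ x ≡ Θ′ x) → Factorization t n Θ → Factorization t n Θ′
  retarget e F = record { Factorization F ; prod = product-cong {Factorization.A F} {Factorization.B F} e (Factorization.prod F) }

  module Transvection (β : L) where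

    -- The symplectic transvection along `β`. Mutation moves degrees by `T` where `ω x β ≥ 0` and
    -- fixes them elsewhere; for c-vectors these are `c′-moved` and `c′-fixed`.
    T T⁻¹ : L → L
    T   x = x ⊕ ω x β • β
    T⁻¹ x = x ⊝ ω x β • β

    ω-T⁻¹ : ∀ x → ω (T⁻¹ x) β ≡ ω x β
    ω-T⁻¹ x = trans (subᶠ (ωˡ β) x (ω x β • β)) (trans (cong (λ t → ω x β ℤ.- t) (trans (mulᶠ-• (ωˡ β) (ω x β) β) (trans (cong (ω x β ℤ.*_) (alt β)) (ℤP.*-zeroʳ (ω x β))))) (ℤP.+-identityʳ _))

    ω-T : ∀ x → ω (T x) β ≡ ω x β
    ω-T x = trans (add (ωˡ β) x (ω x β • β)) (trans (cong (λ t → ω x β ℤ.+ t) (trans (mulᶠ-• (ωˡ β) (ω x β) β) (trans (cong (ω x β ℤ.*_) (alt β)) (ℤP.*-zeroʳ (ω x β))))) (ℤP.+-identityʳ _))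

    T-T⁻¹ : ∀ x → T (T⁻¹ x) ≡ x
    T-T⁻¹ x = trans (cong (λ z → T⁻¹ x ⊕ z • β) (ω-T⁻¹ x)) (⊝-⊕ x (ω x β • β))

    T⁻¹-T : ∀ x → T⁻¹ (T x) ≡ x
    T⁻¹-T x = trans (cong (λ z → T x ⊝ z • β) (ω-T x)) (⊕-⊝ x (ω x β • β))

    T⁻¹-⊕ : ∀ x y → T⁻¹ (x ⊕ y) ≡ T⁻¹ x ⊕ T⁻¹ y
    T⁻¹-⊕ x y = trans (cong (x ⊕ y ⊝_) (trans (cong (_• β) (ω-add x y β)) (•-+ (ω x β) (ω y β) β)))
      (solveᴸ (x ∷ y ∷ ω x β • β ∷ ω y β • β ∷ []) ((v₀ ∔ v₁) :- (v₂ ∔ v₃)) ((v₀ :- v₂) ∔ (v₁ :- v₃)) refl)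

    T-⊕ : ∀ x y → T (x ⊕ y) ≡ T x ⊕ T y
    T-⊕ x y = trans (cong (x ⊕ y ⊕_) (trans (cong (_• β) (ω-add x y β)) (•-+ (ω x β) (ω y β) β)))
      (solveᴸ (x ∷ y ∷ ω x β • β ∷ ω y β • β ∷ []) ((v₀ ∔ v₁) ∔ (v₂ ∔ v₃)) ((v₀ ∔ v₂) ∔ (v₁ ∔ v₃)) refl)

    T⁻¹-⊖ : ∀ x → T⁻¹ (⊖ x) ≡ ⊖ T⁻¹ x
    T⁻¹-⊖ x = trans (cong (⊖ x ⊝_) (trans (cong (_• β) (negᶠ (ωˡ β) x)) (•-neg (ω x β) β)))
      (solveᴸ (x ∷ ω x β • β ∷ []) (:- v₀ :- (:- v₁)) (:- (v₀ :- v₁)) refl)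

    T⁻¹-⊝ : ∀ x y → T⁻¹ (x ⊝ y) ≡ T⁻¹ x ⊝ T⁻¹ y
    T⁻¹-⊝ x y = trans (T⁻¹-⊕ x (⊖ y)) (cong (T⁻¹ x ⊕_) (T⁻¹-⊖ y))

    T⁻¹-fix : ∀ x → ω x β ≡ 0ℤ → T⁻¹ x ≡ x
    T⁻¹-fix x e = trans (cong (λ z → x ⊝ z • β) e) (trans (cong (x ⊝_) (0• β)) (⊝-𝟎 x))

    T-fix : ∀ x → ω x β ≡ 0ℤ → T x ≡ x
    T-fix x e = trans (cong T (sym (T⁻¹-fix x e))) (T-T⁻¹ x)

    T⁻¹-𝟎 : T⁻¹ 𝟎 ≡ 𝟎
    T⁻¹-𝟎 = T⁻¹-fix 𝟎 (ω-𝟎ˡ β)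

    T-invariant : ∀ x y → ω (T⁻¹ x) (T⁻¹ y) ≡ ω x y
    T-invariant x y = begin
      ω (T⁻¹ x) (T⁻¹ y)
        ≡⟨ subᶠ (ωʳ (T⁻¹ x)) y (ω y β • β) ⟩
      ω (T⁻¹ x) y ℤ.- ω (T⁻¹ x) (ω y β • β)
        ≡⟨ cong₂ ℤ._-_ (subᶠ (ωˡ y) x (ω x β • β)) (trans (mulᶠ-• (ωʳ (T⁻¹ x)) (ω y β) β) (cong (ω y β ℤ.*_) (ω-T⁻¹ x))) ⟩
      ω x y ℤ.- ω (ω x β • β) y ℤ.- ω y β ℤ.* ω x β
        ≡⟨ cong (λ t → ω x y ℤ.- t ℤ.- ω y β ℤ.* ω x β) (trans (mulᶠ-• (ωˡ y) (ω x β) β) (cong (ω x β ℤ.*_) (skew β y))) ⟩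
      ω x y ℤ.- ω x β ℤ.* ℤ.- ω y β ℤ.- ω y β ℤ.* ω x β
        ≡⟨ aux (ω x y) (ω x β) (ω y β) ⟩
      ω x y ∎
      where
      open ≡-Reasoning
      aux : ∀ w p q → w ℤ.- p ℤ.* ℤ.- q ℤ.- q ℤ.* p ≡ w
      aux = solveℤ

    _∘T : Additive r → Additive r
    φ ∘T = record { fun = λ x → fun φ (T x) ; add = λ x y → trans (cong (fun φ) (T-⊕ x y)) (add φ (T x) (T y)) }

    transport : ∀ {n} → Stability n → Stability (T n)
    transport {n} S = record
      { sgn     = λ x → sgn (T⁻¹ x)
      ; sgn-⊖   = λ a → trans (cong sgn (T⁻¹-⊖ a)) (sgn-⊖ (T⁻¹ a))
      ; pos+pos = λ {a} {b} p q → trans (cong sgn (T⁻¹-⊕ a b)) (pos+pos p q)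
      ; pos+nul = λ {a} {b} p q → trans (cong sgn (T⁻¹-⊕ a b)) (pos+nul p q)
      ; nul+nul = λ {a} {b} p q → trans (cong sgn (T⁻¹-⊕ a b)) (nul+nul p q)
      ; sgn-n   = trans (cong sgn (T⁻¹-T n)) sgn-n
      ; aligned = λ a p → subst 0≤_ (trans (cong (λ z → ω z (T⁻¹ a)) (sym (T⁻¹-T n))) (T-invariant (T n) a)) (aligned (T⁻¹ a) p)
      ; line    = λ a p ne φ e → line (T⁻¹ a) p (λ e₀ → ne (trans (sym (T-T⁻¹ a)) (trans (cong T e₀) (T-fix 𝟎 (ω-𝟎ˡ β))))) (φ ∘T) (trans (cong (fun φ) (T-T⁻¹ a)) e) }
      where open Stability S

    -- `T` preserves `ω`, so it induces an automorphism of the quantum torus.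
    transport-product : ∀ {A B C} → IsProduct A B C → IsProduct (A ∘ T⁻¹) (B ∘ T⁻¹) (C ∘ T⁻¹)
    transport-product {A} {B} P x = hasSum-cong pointwise (hasSum-pull T⁻¹ T T-T⁻¹ (λ a ne → ⊥-elim (ne (T⁻¹-T a))) (P (T⁻¹ x)))
      where
      pointwise : ∀ a → summand A B (T⁻¹ x) (T⁻¹ a) ≡ summand (A ∘ T⁻¹) (B ∘ T⁻¹) x a
      pointwise a = trans (cong (λ z → (twist (ω (T⁻¹ a) z) ⊠ A (T⁻¹ a)) ⊠ B z) (sym (T⁻¹-⊝ x a)))
        (cong (λ t → (twist t ⊠ A (T⁻¹ a)) ⊠ B (T⁻¹ (x ⊝ a))) (T-invariant a (x ⊝ a)))

  module Transfer (s : Seed) (k : Fin r) {Θ : L → ℚ} (D : IsDT s Θ) where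

    open IsDT D
    open Quotients s k D
    open Transvection β

    s′ : Seed
    s′ = mutateˢ s k

    φ′ : Additive r
    φ′ = γ s′ k

    β′ : L
    β′ = ⊖ β

    φ′-fun : ∀ x → fun φ′ x ≡ ℤ.- fun v x
    φ′-fun x = trans (cong (λ f → fun f x) (mutateᵞ-same s k)) (aux (fun (degree s k) x) (fun φ x))
      where
      aux : ∀ d g → d ℤ.+ ℤ.- g ≡ ℤ.- (g ℤ.+ ℤ.- d)
      aux = solveℤ

    φ′-β′ : fun φ′ β′ ≡ 1ℤ
    φ′-β′ = trans (φ′-fun β′) (cong ℤ.-_ (trans (negᶠ v β) (cong ℤ.-_ v-β)))

    φ′β′ : 0≤ fun φ′ β′ ℤ.- 1ℤ
    φ′β′ = subst 0≤_ (cong (ℤ._- 1ℤ) (sym φ′-β′)) 0≤-nat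

    γ′β′ : ∀ i → 0≤ fun (γ s′ i) β′
    γ′β′ i with i Fin.≟ k
    ... | yes refl = subst 0≤_ (trans (sym φ′-β′) (cong (λ f → fun f β′) (mutateᵞ-same s k))) 0≤-nat
    ... | no ne    = subst 0≤_ (sym (trans (negᶠ (γ s i) β) (cong ℤ.-_ (γ-off s i k ne)))) 0≤-nat

    module A′ = Axis s′ k β′ φ′β′ γ′β′

    φ′-bad : ∀ x → Negative (fun φ′ x) → 0≤ fun v x ℤ.- 1ℤ
    φ′-bad x nx = subst 0≤_ (trans (cong (λ t → ℤ.- 1ℤ ℤ.- t) (φ′-fun x)) (aux (fun v x))) nx
      where
      aux : ∀ v → ℤ.- 1ℤ ℤ.- ℤ.- v ≡ v ℤ.- 1ℤ
      aux = solveℤ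

    recone : ∀ {f} → ConeSupported s f → (∀ x → 0≤ fun v x ℤ.- 1ℤ → f x ≡ 0ℚ) → ConeSupported s′ f
    recone {f} bf vf i x nx = by-index i (i Fin.≟ k) nx
      where
      by-index : ∀ i → Dec (i ≡ k) → Negative (fun (γ s′ i) x) → f x ≡ 0ℚ
      by-index i (yes refl) nx = vf x (φ′-bad x nx)
      by-index i (no ne)    nx = bf i x (subst (λ h → Negative (fun h x)) (mutateᵞ-other s k ne) nx)

    factors-vanish-all : ∀ {A B C} → Factors s A B C → (u : Additive r) → (∀ x → 0≤ fun u x ℤ.- 1ℤ → C x ≡ 0ℚ) → ∀ x → 0≤ fun u x ℤ.- 1ℤ → A x ≡ 0ℚ × B x ≡ 0ℚ
    factors-vanish-all F u h x ux = factors-vanish F u (ht x) (λ y uy _ → h y uy) x ux (subst 0≤_ (sym (ℤP.+-inverseʳ (ht x))) 0≤-nat)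

    -- Both factors inherit the vanishing of `rightQ` on `v ≥ 1`; with the coordinates that mutation
    -- leaves unchanged, this half-space bounds the mutated cone.
    factors-recone : ∀ {A B} → Factors s A B rightQ → ConeSupported s′ A × ConeSupported s′ B
    factors-recone F = recone (Factors.coneA F) (λ x p → proj₁ (factors-vanish-all F v rightQ-vanish x p))
                     , recone (Factors.coneB F) (λ x p → proj₂ (factors-vanish-all F v rightQ-vanish x p))

    factorization-recone : ∀ {n} → Factorization s n rightQ → Factorization s′ n rightQ
    factorization-recone G = record { Factorization G ; coneA = proj₁ (factors-recone (Factorization.factors G)) ; coneB = proj₂ (factors-recone (Factorization.factors G)) }

    -- E(y^β) has been removed on the right of Θ, and E(y^(-β)) is put on the left.
    Θ′ : L → ℚ
    Θ′ = actˡ φ′ dilog β′ rightQ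

    rightQ-cone′ : ConeSupported s′ rightQ
    rightQ-cone′ = recone rightQ-cone rightQ-vanish

    rightQ-one : rightQ 𝟎 ≡ 1ℚ
    rightQ-one = act-one (ω 𝟎 β) dilog⁻¹ refl cone one

    twisted : L → ℚ
    twisted x = leftQ (T⁻¹ x)

    T⁻¹-bad : ∀ x → Negative (fun φ′ x) → 0≤ fun v′ (T⁻¹ x) ℤ.- 1ℤ
    T⁻¹-bad x nx = subst 0≤_ (trans (aux (fun v x) (ω x β)) (cong₂ (λ p q → p ℤ.+ q ℤ.- 1ℤ) (sym vT) (sym (ω-T⁻¹ x)))) (φ′-bad x nx)
      where
      aux : ∀ v c → v ℤ.- 1ℤ ≡ v ℤ.- c ℤ.+ c ℤ.- 1ℤ
      aux = solveℤ
      vT : fun v (T⁻¹ x) ≡ fun v x ℤ.- ω x β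
      vT = trans (subᶠ v x (ω x β • β)) (cong (λ t → fun v x ℤ.- t) (trans (mulᶠ-• v (ω x β) β) (trans (cong (ω x β ℤ.*_) v-β) (ℤP.*-identityʳ _))))

    twisted-recone : ∀ {f} → ConeSupported s f → (∀ x → 0≤ fun v′ x ℤ.- 1ℤ → f x ≡ 0ℚ) → ConeSupported s′ (f ∘ T⁻¹)
    twisted-recone {f} bf vf i x nx = by-index i (i Fin.≟ k) nx
      where
      by-index : ∀ i → Dec (i ≡ k) → Negative (fun (γ s′ i) x) → f (T⁻¹ x) ≡ 0ℚ
      by-index i (yes refl) nx = vf (T⁻¹ x) (T⁻¹-bad x nx)
      by-index i (no ne)    nx = bf i (T⁻¹ x) (subst Negative (trans (cong (λ h → fun h x) (mutateᵞ-other s k ne)) (sym γT)) nx)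
        where
        γT : fun (γ s i) (T⁻¹ x) ≡ fun (γ s i) x
        γT = trans (subᶠ (γ s i) x (ω x β • β)) (trans (cong (λ t → fun (γ s i) x ℤ.- t)
          (trans (mulᶠ-• (γ s i) (ω x β) β) (trans (cong (ω x β ℤ.*_) (γ-off s i k ne)) (ℤP.*-zeroʳ (ω x β))))) (ℤP.+-identityʳ _))

    twisted-cone : ConeSupported s′ twisted
    twisted-cone = twisted-recone leftQ-cone leftQ-vanish

    ω-β′ʳ : ∀ x → ω x β′ ≡ ℤ.- ω x β
    ω-β′ʳ x = negᶠ (ωʳ x) β

    ω-β′ˡ : ∀ x → ω β′ x ≡ ω x β
    ω-β′ˡ x = trans (negᶠ (ωˡ x) β) (sym (skew x β))

    private
      down : ∀ n x → (x ⊕ n · β) ≡ x ⊝ n · β′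
      down n x = cong (x ⊕_) (trans (solveᴸ (n · β ∷ []) v₀ (:- (:- v₀)) refl) (cong ⊖_ (sym (·-⊖ n β))))

    -- E⁻ * R = (T L) * E⁻ for the quotients R, L of Θ = R * E = E * L.
    left-right : ∀ x → Θ′ x ≡ actʳ φ′ dilog β′ twisted x
    left-right x = by-sign (ω x β) refl
      where
      open ≡-Reasoning
      shift : ∀ l → ω (x ⊝ l · β′) β ≡ ω x β
      shift l = trans (sub-mulᶠ (ωˡ β) x l β′) (trans (cong (λ t → ω x β ℤ.- + l ℤ.* t) (trans (negᶠ (ωˡ β) β) (cong ℤ.-_ (alt β)))) (aux (ω x β) (+ l)))
        where
        aux : ∀ a l → a ℤ.- l ℤ.* 0ℤ ≡ a
        aux = solveℤ
      by-sign : ∀ c → ω x β ≡ c → Θ′ x ≡ actʳ φ′ dilog β′ twisted x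
      by-sign (+ n) e = begin
        act φ′ (ω β′ x) dilog β′ rightQ x
          ≡⟨ cong (λ κ → act φ′ κ dilog β′ rightQ x) (trans (ω-β′ˡ x) e) ⟩
        act φ′ (+ n) dilog β′ rightQ x
          ≡⟨ act-cong φ′ (+ n) dilog β′ {rightQ} {binom n (1ℤ ℤ.- + n) β′ twisted} x chain ⟩
        act φ′ (+ n) dilog β′ (binom n (1ℤ ℤ.- + n) β′ twisted) x
          ≡⟨ sym (binom-act φ′ β′ φ′β′ n (1ℤ ℤ.- + n) (+ n) dilog (twisted-cone k) x) ⟩
        binom n (1ℤ ℤ.- + n) β′ (act φ′ (+ n) dilog β′ twisted) x
          ≡⟨ cong (λ κ → binom n (1ℤ ℤ.- + n) β′ (act φ′ κ dilog β′ twisted) x) (e₂ (+ n)) ⟩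
        binom n (1ℤ ℤ.- + n) β′ (act φ′ (1ℤ ℤ.- + n ℤ.- 1ℤ ℤ.+ + 2 ℤ.* + n) dilog β′ twisted) x
          ≡⟨ sym (act-dilog-binom φ′ β′ φ′β′ n (1ℤ ℤ.- + n) (twisted-cone k) x) ⟩
        act φ′ (1ℤ ℤ.- + n ℤ.- 1ℤ) dilog β′ twisted x
          ≡⟨ cong (λ κ → act φ′ κ dilog β′ twisted x) (trans (e₁ (+ n)) (trans (cong ℤ.-_ (sym e)) (sym (ω-β′ʳ x)))) ⟩
        act φ′ (ω x β′) dilog β′ twisted x ∎
        where
        e₁ : ∀ n → 1ℤ ℤ.- n ℤ.- 1ℤ ≡ ℤ.- n
        e₁ = solveℤ
        e₂ : ∀ n → n ≡ 1ℤ ℤ.- n ℤ.- 1ℤ ℤ.+ + 2 ℤ.* n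
        e₂ = solveℤ
        -- The chain of `leftQ` along `β` from `y` is that of `twisted` from `y ⊕ n · β`, because
        -- `T⁻¹` removes `n · β`. The palindrome turns the latter into the chain along `β′` from
        -- `y`.
        chain : ∀ l → rightQ (x ⊝ l · β′) ≡ binom n (1ℤ ℤ.- + n) β′ twisted (x ⊝ l · β′)
        chain l = trans (right-from-left n y (trans (shift l) e))
          (trans (binom-cong n (1ℤ ℤ.- + n) β {leftQ} {twisted} y (y ⊕ n · β) (λ m _ → cong leftQ (sym (back m))))
            (sym (binom-palindrome n β twisted y)))
          where
          y = x ⊝ l · β′
          back : ∀ m → T⁻¹ ((y ⊕ n · β) ⊝ m · β) ≡ y ⊝ m · β
          back m = trans (cong (λ z → ((y ⊕ n · β) ⊝ m · β) ⊝ z) (trans (cong (_• β) ωy) (•-nat n β)))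
            (solveᴸ (y ∷ n · β ∷ m · β ∷ []) (((v₀ ∔ v₁) :- v₂) :- v₁) (v₀ :- v₂) refl)
            where
            ωy : ω ((y ⊕ n · β) ⊝ m · β) β ≡ + n
            ωy = trans (ω-shiftʳ _ β m) (trans (cong (λ z → ω (y ⊕ z) β) (solveᴸ (n · β ∷ []) v₀ (:- (:- v₀)) refl))
              (trans (cong (λ z → ω (y ⊝ z) β) (sym (·-⊖ n β))) (trans (cong (λ z → ω z β) (⊝-+· x β′ l n)) (trans (shift (l ℕ.+ n)) e))))
      by-sign -[1+ p ] e = begin
        act φ′ (ω β′ x) dilog β′ rightQ x
          ≡⟨ cong (λ κ → act φ′ κ dilog β′ rightQ x) (trans (ω-β′ˡ x) (trans e (sym (e₁ (+ n))))) ⟩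
        act φ′ (1ℤ ℤ.- + n ℤ.- 1ℤ) dilog β′ rightQ x
          ≡⟨ act-dilog-binom φ′ β′ φ′β′ n (1ℤ ℤ.- + n) (rightQ-cone′ k) x ⟩
        binom n (1ℤ ℤ.- + n) β′ (act φ′ (1ℤ ℤ.- + n ℤ.- 1ℤ ℤ.+ + 2 ℤ.* + n) dilog β′ rightQ) x
          ≡⟨ cong (λ κ → binom n (1ℤ ℤ.- + n) β′ (act φ′ κ dilog β′ rightQ) x) (sym (e₂ (+ n))) ⟩
        binom n (1ℤ ℤ.- + n) β′ (act φ′ (+ n) dilog β′ rightQ) x
          ≡⟨ binom-act φ′ β′ φ′β′ n (1ℤ ℤ.- + n) (+ n) dilog (rightQ-cone′ k) x ⟩
        act φ′ (+ n) dilog β′ (binom n (1ℤ ℤ.- + n) β′ rightQ) x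
          ≡⟨ act-cong φ′ (+ n) dilog β′ {binom n (1ℤ ℤ.- + n) β′ rightQ} {twisted} x chain ⟩
        act φ′ (+ n) dilog β′ twisted x
          ≡⟨ cong (λ κ → act φ′ κ dilog β′ twisted x) (trans (cong ℤ.-_ (sym e)) (sym (ω-β′ʳ x))) ⟩
        act φ′ (ω x β′) dilog β′ twisted x ∎
        where
        n = suc p
        e₁ : ∀ n → 1ℤ ℤ.- n ℤ.- 1ℤ ≡ ℤ.- n
        e₁ = solveℤ
        e₂ : ∀ n → n ≡ 1ℤ ℤ.- n ℤ.- 1ℤ ℤ.+ + 2 ℤ.* n
        e₂ = solveℤ
        chain : ∀ l → binom n (1ℤ ℤ.- + n) β′ rightQ (x ⊝ l · β′) ≡ twisted (x ⊝ l · β′)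
        chain l = trans (binom-palindrome n β rightQ y) (trans (sym (left-from-right n (y ⊕ n · β) ωy)) (cong leftQ (sym (trans (cong (λ z → y ⊝ z) (trans (cong (_• β) (trans (shift l) e)) (trans (•-neg (+ n) β) (cong ⊖_ (•-nat n β)))))
            (solveᴸ (y ∷ n · β ∷ []) (v₀ :- (:- v₁)) (v₀ ∔ v₁) refl)))))
          where
          y = x ⊝ l · β′
          ωy : ω (y ⊕ n · β) β ≡ ℤ.- + n
          ωy = trans (cong (λ z → ω z β) (trans (down n y) (⊝-+· x β′ l n))) (trans (shift (l ℕ.+ n)) e)

    sgn-β′ : ∀ {n} (S : Stability n) {t} → Stability.sgn S β ≡ t → Stability.sgn S β′ ≡ flip t
    sgn-β′ S e = trans (Stability.sgn-⊖ S β) (cong flip e)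

    factorize-ngt : ∀ {n} (F : Factorization s n Θ) → side F β ≡ ngt → Factorization s′ n Θ′
    factorize-ngt F e = A′.multiplyˡ dilog refl (factorization-recone (divideʳ F (λ e′ → case trans (sym e′) e of λ ()))) (sgn-β′ (Factorization.stability F) e)

    factorize-pos : ∀ {n} (F : Factorization s n Θ) → side F β ≡ pos → Factorization s′ (T n) Θ′
    factorize-pos {n} F e = retarget (λ x → sym (left-right x)) (A′.multiplyʳ dilog refl moved
      (λ e′ → case trans (sym (trans (cong (Stability.sgn stability) (T⁻¹-fix β′ (trans (negᶠ (ωˡ β) β) (cong ℤ.-_ (alt β))))) (sgn-β′ stability e))) e′ of λ ()))
      where
      G : Factorization s n leftQ
      G = divideˡ F e
      open Factorization G
      moved : Factorization s′ (T n) twisted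
      moved = record
        { stability = transport stability ; A = A ∘ T⁻¹ ; B = B ∘ T⁻¹
        ; coneA = twisted-recone coneA (λ x p → proj₁ (factors-vanish-all factors v′ leftQ-vanish x p))
        ; coneB = twisted-recone coneB (λ x p → proj₂ (factors-vanish-all factors v′ leftQ-vanish x p))
        ; oneA = trans (cong A T⁻¹-𝟎) oneA ; oneB = trans (cong B T⁻¹-𝟎) oneB
        ; posA = λ x ne np → posA (T⁻¹ x) (λ e₀ → ne (trans (sym (T-T⁻¹ x)) (trans (cong T e₀) (T-fix 𝟎 (ω-𝟎ˡ β))))) np
        ; posB = λ x p → posB (T⁻¹ x) p
        ; prod = transport-product {A} {B} prod }

    -- Now E(y^(-β)) has sign zero and belongs to the right factor, while Θ′ has it on the far left.
    -- Moving it across conjugates the left factor: `A₂` is E⁻ * A * (E⁻)⁻¹.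
    factorize-nul : ∀ {n} (F : Factorization s n Θ) → side F β ≡ nul → Factorization s′ n Θ′
    factorize-nul {n} F e = record
      { stability = stability ; A = A₂ ; B = actˡ φ′ dilog β′ B
      ; coneA = cone₂ ; coneB = A′.actˡ-cone dilog coneB
      ; oneA = A′.act-one (ω 𝟎 β′) dilog⁻¹ refl cone₁ (A′.act-one (ω β′ 𝟎) dilog refl coneA oneA)
      ; oneB = A′.act-one (ω β′ 𝟎) dilog refl coneB oneB
      ; posA = λ x ne np → A₂-zero x ne np
      ; posB = λ x p → act-zero φ′ (ω β′ x) dilog β′ {B} x (λ l → posB _ (A′.⊝-stays-pos dilog refl G x l (λ e₁ → case trans (sym (sgn-β′ stability e)) e₁ of λ ()) p))
      ; prod = prod₂ }
      where
      G : Factorization s′ n rightQ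
      G = factorization-recone (divideʳ F (λ e′ → case trans (sym e′) e of λ ()))
      open Factorization G
      open Stability stability using (sgn)
      A₁ A₂ : L → ℚ
      A₁ = actˡ φ′ dilog β′ A
      A₂ = actʳ φ′ dilog⁻¹ β′ A₁
      cone₁ : ConeSupported s′ A₁
      cone₁ = A′.actˡ-cone dilog coneA
      cone₂ : ConeSupported s′ A₂
      cone₂ = A′.actʳ-cone dilog⁻¹ cone₁
      prod₁ : IsProduct A₁ B Θ′
      prod₁ = product-actˡ φ′ β′ φ′β′ (coneA k) (coneB k) dilog prod
      A₂-back : ∀ x → actʳ φ′ dilog β′ A₂ x ≡ A₁ x
      A₂-back = actʳ-inverse φ′ β′ φ′β′ (cone₁ k) dilog dilog⁻¹ dilog⊛dilog⁻¹
      prod₂ : IsProduct A₂ (actˡ φ′ dilog β′ B) Θ′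
      prod₂ x = subst (HasSum _) (hasSum-unique (hasSum-cong (λ a → cong (λ p → (twist (ω a (x ⊝ a)) ⊠ p) ⊠ B (x ⊝ a)) (A₂-back a)) (proj₁ (proj₂ M) x)) (prod₁ x)) (proj₂ (proj₂ M) x)
        where
        -- This first move across the middle only shows that `A₂ * B` exists. The second one gives
        -- `A₂ * (E⁻ * B)`, and uniqueness of sums identifies its value with Θ′.
        exists = product-middle φ′ β′ φ′β′ (cone₁ k) (coneB k) dilog⁻¹ prod₁
        M = product-middle φ′ β′ φ′β′ (cone₂ k) (coneB k) dilog (proj₁ (proj₂ exists))
      sβ′ : sgn β′ ≢ ngt
      sβ′ e₁ = case trans (sym (sgn-β′ stability e)) e₁ of λ ()
      A₂-zero : ∀ x → x ≢ 𝟎 → sgn x ≢ pos → A₂ x ≡ 0ℚ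
      -- `posA` excludes 𝟎, where `A` is 1. A chain through 𝟎 has `ω x β′ = 0`, and there
      -- conjugation is trivial; if `ω x β′` is not 0, every term vanishes.
      A₂-zero x ne np with ω x β′ ℤP.≟ 0ℤ
      ... | yes c = trans (cong (λ κ → act φ′ κ dilog⁻¹ β′ A₁ x) c)
        (trans (act-cong φ′ 0ℤ dilog⁻¹ β′ {A₁} {act φ′ 0ℤ dilog β′ A} x (λ l → cong (λ κ → act φ′ κ dilog β′ A (x ⊝ l · β′)) (trans (ω-shiftˡ x β′ l) (trans (skew β′ x) (cong ℤ.-_ c)))))
          (trans (act-inverse φ′ β′ φ′β′ (coneA k) 0ℤ dilog⁻¹ dilog dilog⁻¹⊛dilog x) (posA x ne np)))
      ... | no c  = act-zero φ′ (ω x β′) dilog⁻¹ β′ {A₁} x λ l → act-zero φ′ (ω β′ (x ⊝ l · β′)) dilog β′ {A} (x ⊝ l · β′) λ m →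
        trans (cong A (⊝-+· x β′ l m)) (posA _ (nonzero (l ℕ.+ m)) (A′.⊝-stays-notpos dilog refl G x (l ℕ.+ m) sβ′ np))
        where
        nonzero : ∀ l → x ⊝ l · β′ ≢ 𝟎
        nonzero l e₀ = c (trans (sym (ω-shiftʳ x β′ l)) (trans (cong (λ z → ω z β′) e₀) (ω-𝟎ˡ β′)))

    c′-other : ∀ {i} → i ≢ k → c s′ i ≡ c s i ⊕ weight s k i · β
    c′-other = mutateᶜ-other (c s) k

    c′-k : c s′ k ≡ β′
    c′-k = mutateᶜ-same (c s) k

    weight-zero : ∀ i → 0≤ ℤ.- ω (c s i) β → weight s k i ≡ 0
    weight-zero i = []₊-nonpos

    c′-fixed : ∀ {i} → i ≢ k → 0≤ ℤ.- ω (c s i) β → c s′ i ≡ c s i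
    c′-fixed {i} ne h = trans (c′-other ne) (trans (cong (λ w → c s i ⊕ w · β) (weight-zero i h)) (⊕-identityʳ (c s i)))

    c′-moved : ∀ {i} → i ≢ k → 0≤ ω (c s i) β → ∀ l → T (l · c s i) ≡ l · c s′ i
    c′-moved {i} ne h l = begin
      l · c s i ⊕ ω (l · c s i) β • β          ≡⟨ cong (λ z → l · c s i ⊕ z • β) (trans (mulᶠ (ωˡ β) l (c s i)) (trans (cong (+ l ℤ.*_) (sym ([]₊-nonneg h))) (sym (ℤP.pos-* l w)))) ⟩
      l · c s i ⊕ (+ (l ℕ.* w)) • β            ≡⟨ cong (l · c s i ⊕_) (trans (•-nat (l ℕ.* w) β) (·-assoc l)) ⟩
      l · c s i ⊕ l · (w · β)                  ≡⟨ sym (·-distrib-⊕ l (c s i) (w · β)) ⟩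
      l · (c s i ⊕ w · β)                      ≡⟨ cong (l ·_) (sym (c′-other ne)) ⟩
      l · c s′ i                               ∎
      where
      open ≡-Reasoning
      w = weight s k i
      ·-assoc : ∀ l → (l ℕ.* w) · β ≡ l · (w · β)
      ·-assoc zero    = refl
      ·-assoc (suc l) = trans (+-· w (l ℕ.* w) β) (cong (w · β ⊕_) (·-assoc l))

    private
      nonneg-quotient : ∀ l {z} → 0≤ + suc l ℤ.* z → 0≤ z
      nonneg-quotient l {+ n} _ = 0≤-nat
      nonneg-quotient l { -[1+ n ]} ()

      nonpos-quotient : ∀ l {z} → 0≤ ℤ.- (+ suc l ℤ.* z) → 0≤ ℤ.- z
      nonpos-quotient l {z} h = nonneg-quotient l (subst 0≤_ (ℤP.neg-distribʳ-* (+ suc l) z) h)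

    Outcome : L → Set
    Outcome n = Σ (Factorization s′ n Θ′) λ F → Simple s′ n ⊎ Factorization.B F n ≡ 0ℚ

    outcome-ngt : ∀ n (ne : n ≢ 𝟎) → Stability.sgn (Factorization.stability (proj₁ (incoming n ne))) β ≡ ngt → Outcome n
    outcome-ngt n ne e = factorize-ngt F e , outcome val
      where
      F = proj₁ (incoming n ne)
      val : Simple s n ⊎ Factorization.B F n ≡ 0ℚ
      val = proj₂ (incoming n ne)
      S = Factorization.stability F
      outcome : Simple s n ⊎ Factorization.B F n ≡ 0ℚ → Simple s′ n ⊎ Factorization.B (factorize-ngt F e) n ≡ 0ℚ
      outcome (inj₂ z) = inj₂ (trans (multiplyʳ-value dilog⁻¹ refl F e) z)
      outcome (inj₁ (i , zero , n≡)) = ⊥-elim (ne n≡)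
      outcome (inj₁ (i , suc l , n≡)) with i Fin.≟ k
      ... | yes refl = case trans (sym (simple-sgn S ne (suc l) n≡)) e of λ ()
      ... | no i≢k   = inj₁ (i , suc l , trans n≡ (cong (suc l ·_) (sym (c′-fixed i≢k (nonpos-quotient l
              (subst (λ t → 0≤ ℤ.- t) (trans (cong (λ z → ω z β) n≡) (mulᶠ (ωˡ β) (suc l) (c s i))) (ω-nonpos S e)))))))

    outcome-pos : ∀ n (ne : n ≢ 𝟎) → Stability.sgn (Factorization.stability (proj₁ (incoming n ne))) β ≡ pos → Outcome (T n)
    outcome-pos n ne e = factorize-pos F e , outcome val
      where
      F = proj₁ (incoming n ne)
      open Factorization F using (B; posB)
      val : Simple s n ⊎ B n ≡ 0ℚ
      val = proj₂ (incoming n ne)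
      S = Factorization.stability F
      open Stability S
      outcome : Simple s n ⊎ B n ≡ 0ℚ → Simple s′ (T n) ⊎ Factorization.B (factorize-pos F e) (T n) ≡ 0ℚ
      outcome (inj₂ z) = inj₂ (trans (act-head φ′ (ω (T n) β′) dilog β′ {B ∘ T⁻¹} (T n) refl above) (trans (cong B (T⁻¹-T n)) z))
        where
        above : ∀ l → B (T⁻¹ (T n ⊝ suc l · β′)) ≡ 0ℚ
        above l = posB _ (trans (cong sgn (trans (T⁻¹-⊝ (T n) (suc l · β′)) (trans (cong₂ _⊝_ (T⁻¹-T n) (trans (cong T⁻¹ (·-⊖ (suc l) β))
            (trans (T⁻¹-⊖ (suc l · β)) (cong ⊖_ (T⁻¹-fix (suc l · β) (trans (mulᶠ (ωˡ β) (suc l) β) (trans (cong (+ suc l ℤ.*_) (alt β)) (ℤP.*-zeroʳ (+ suc l)))))))))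
            (solveᴸ (n ∷ suc l · β ∷ []) (v₀ :- (:- v₁)) (v₁ ∔ v₀) refl))))
          (pos+nul (pos-· l e) sgn-n))
      outcome (inj₁ (i , zero , n≡)) = ⊥-elim (ne n≡)
      outcome (inj₁ (i , suc l , n≡)) with i Fin.≟ k
      ... | yes refl = case trans (sym (simple-sgn S ne (suc l) n≡)) e of λ ()
      ... | no i≢k   = inj₁ (i , suc l , trans (cong T n≡) (c′-moved i≢k (nonneg-quotient l
              (subst 0≤_ (trans (cong (λ z → ω z β) n≡) (mulᶠ (ωˡ β) (suc l) (c s i))) (ω-nonneg S e))) (suc l)))

    -- Here `n` is a multiple of `β`. A positive multiple lies outside the mutated cone, where `B`
    -- vanishes; a negative one is a multiple of the new c-vector `⊖ β`.
    outcome-nul : ∀ n (ne : n ≢ 𝟎) → Stability.sgn (Factorization.stability (proj₁ (incoming n ne))) β ≡ nul → Outcome n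
    outcome-nul n ne e = factorize-nul F e , outcome (fun φ n) refl
      where
      F = proj₁ (incoming n ne)
      ax : OnAxis n
      ax = axis-of-nul (Factorization.stability F) e
      φ′n : fun φ′ n ≡ ℤ.- fun φ n
      φ′n = trans (φ′-fun n) (trans (cong (λ t → ℤ.- (fun φ n ℤ.+ ℤ.- t)) (degree-axis s k n ax)) (cong ℤ.-_ (ℤP.+-identityʳ (fun φ n))))
      outcome : ∀ z → fun φ n ≡ z → Simple s′ n ⊎ Factorization.B (factorize-nul F e) n ≡ 0ℚ
      outcome (+ zero) eφ = ⊥-elim (ne (trans (axis-form n ax) (trans (cong (_• β) eφ) (0• β))))
      outcome (+ suc l) eφ = inj₂ (Factorization.coneB (factorize-nul F e) k n (subst Negative (sym (trans φ′n (cong ℤ.-_ eφ))) 0≤-nat))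
      outcome -[1+ l ] eφ = inj₁ (k , suc l , trans (axis-form n ax) (trans (cong (_• β) eφ) (trans (•-neg (+ suc l) β)
        (trans (cong ⊖_ (•-nat (suc l) β)) (trans (sym (·-⊖ (suc l) β)) (cong (suc l ·_) (sym c′-k)))))))

    -- The old degree that mutation carries to `n` is `T⁻¹ n` if `ω n β > 0` and `n` itself
    -- otherwise; the old incoming condition is invoked there.
    incoming′ : ∀ n → n ≢ 𝟎 → Outcome n
    incoming′ n ne with sign? (ω n β ℤ.- 1ℤ)
    ... | inj₁ c>0 = by-sign (Stability.sgn S β) refl
      where
      x = T⁻¹ n
      x≢𝟎 : x ≢ 𝟎
      x≢𝟎 e₀ = ne (trans (sym (T-T⁻¹ n)) (trans (cong T e₀) (T-fix 𝟎 (ω-𝟎ˡ β))))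
      S : Stability x
      S = Factorization.stability (proj₁ (incoming x x≢𝟎))
      by-sign : ∀ t → Stability.sgn S β ≡ t → Outcome n
      by-sign pos e = subst Outcome (T-T⁻¹ n) (outcome-pos x x≢𝟎 e)
      by-sign nul e = case subst (λ t → 0≤ t ℤ.- 1ℤ) (trans (sym (ω-T⁻¹ n)) (ω-axis (axis-of-nul S e))) c>0 of λ ()
      by-sign ngt e = ⊥-elim (¬pos-nonpos (subst (λ t → 0≤ t ℤ.- 1ℤ) (sym (ω-T⁻¹ n)) c>0) (ω-nonpos S e))
    ... | inj₂ c≤0 = by-sign (Stability.sgn S β) refl
      where
      S : Stability n
      S = Factorization.stability (proj₁ (incoming n ne))
      by-sign : ∀ t → Stability.sgn S β ≡ t → Outcome n
      by-sign ngt e = outcome-ngt n ne e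
      by-sign nul e = outcome-nul n ne e
      -- Positive sign forces `ω n β ≥ 0`, so it is 0 and `T` fixes `n`.
      by-sign pos e = subst Outcome (T-fix n (0≤-antisym (ω-nonneg S e) (subst 0≤_ (aux (ω n β)) c≤0))) (outcome-pos n ne e)
        where
        aux : ∀ c → ℤ.- 1ℤ ℤ.- (c ℤ.- 1ℤ) ≡ ℤ.- c
        aux = solveℤ

    private
      bad-above : (u : Additive r) → fun u β ≡ 1ℤ → ∀ x → fun u x ≡ 0ℤ → ∀ m → 0≤ fun u (x ⊝ suc m · β′) ℤ.- 1ℤ
      bad-above u uβ x ux m = subst 0≤_ (cong (ℤ._- 1ℤ) (sym (trans (sub-mulᶠ u x (suc m) β′) (cong₂ (λ p q → p ℤ.- + suc m ℤ.* q) ux (trans (negᶠ u β) (cong ℤ.-_ uβ)))))) (subst 0≤_ (aux (+ m)) (0≤-nat {m}))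
        where
        aux : ∀ m → m ≡ 0ℤ ℤ.- (1ℤ ℤ.+ m) ℤ.* ℤ.- 1ℤ ℤ.- 1ℤ
        aux = solveℤ

      below : ∀ i → i ≢ k → ∀ l m → Negative (fun φ (l · c s i ⊝ suc m · β))
      below i ne l m = subst Negative (sym (trans (sub-mulᶠ φ (l · c s i) (suc m) β) (cong₂ (λ p q → p ℤ.- + suc m ℤ.* q)
        (trans (mulᶠ φ l (c s i)) (trans (cong (+ l ℤ.*_) (γ-off s k i (ne ∘ sym))) (ℤP.*-zeroʳ (+ l)))) (γ-diag s k)))) (subst 0≤_ (aux (+ m)) (0≤-nat {m}))
        where
        aux : ∀ m → m ≡ ℤ.- 1ℤ ℤ.- (0ℤ ℤ.- (1ℤ ℤ.+ m) ℤ.* 1ℤ)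
        aux = solveℤ

    -- On the axis the quotient is `unit` and only E(y^(-β)) remains. Off the axis, all shifted
    -- terms lie outside the old cone or in the half-spaces of `quotients-vanish`, so the old value
    -- survives; for `ω (c s i) β ≥ 0` this is read off the second form of Θ′ in `left-right`.
    simple′ : ∀ i l → Θ′ (l · c s′ i) ≡ dilog l
    simple′ i l with i Fin.≟ k
    ... | yes refl = begin
        act φ′ (ω β′ x) dilog β′ rightQ x   ≡⟨ cong (λ κ → act φ′ κ dilog β′ rightQ x) (trans (ω-β′ˡ x) (ω-axis ax)) ⟩
        act φ′ 0ℤ dilog β′ rightQ x         ≡⟨ act-cong φ′ 0ℤ dilog β′ {rightQ} {unit} x (λ m → rightQ-axis _ (λ j ne → trans (subᶠ (γ s j) x (m · β′)) (cong₂ ℤ._-_ (ax j ne) (axβ′ m j ne)))) ⟩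
        act φ′ 0ℤ dilog β′ unit x           ≡⟨ act-unit φ′ dilog β′ φ′β′ l ⟩
        dilog l                             ∎
      where
      open ≡-Reasoning
      x = l · β′
      axβ′ : ∀ m → OnAxis (m · β′)
      axβ′ m j ne = trans (cong (fun (γ s j)) (·-⊖ m β)) (trans (negᶠ (γ s j) (m · β)) (cong ℤ.-_ (axis-· m j ne)))
      ax : OnAxis x
      ax = axβ′ l
    ... | no ne with sign? (ω (c s i) β)
    ... | inj₁ h = trans (cong Θ′ (sym (trans (c′-moved ne h l) (cong (l ·_) (c′-other ne))))) (begin
        Θ′ (T x)                            ≡⟨ left-right (T x) ⟩
        actʳ φ′ dilog β′ twisted (T x)      ≡⟨ act-head φ′ (ω (T x) β′) dilog β′ {twisted} (T x) refl (λ m → leftQ-vanish _ (bad m)) ⟩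
        leftQ (T⁻¹ (T x))                   ≡⟨ cong leftQ (T⁻¹-T x) ⟩
        leftQ x                             ≡⟨ act-head φ (ω β x) dilog⁻¹ β {Θ} x refl (λ m → cone k _ (below i ne l m)) ⟩
        Θ x                                 ≡⟨ simple i l ⟩
        dilog l                             ∎)
      where
      open ≡-Reasoning
      x = l · c s i
      v′x : fun v′ x ≡ 0ℤ
      v′x = trans (mulᶠ v′ l (c s i)) (trans (cong (+ l ℤ.*_) (trans (cong₂ ℤ._+_ (v-c i ne) (sym ([]₊-nonneg h))) (ℤP.+-inverseˡ (+ weight s k i)))) (ℤP.*-zeroʳ (+ l)))
      bad : ∀ m → 0≤ fun v′ (T⁻¹ (T x ⊝ suc m · β′)) ℤ.- 1ℤ
      bad m = subst (λ z → 0≤ fun v′ z ℤ.- 1ℤ) (sym (trans (T⁻¹-⊝ (T x) (suc m · β′)) (cong₂ _⊝_ (T⁻¹-T x) (T⁻¹-fix (suc m · β′)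
          (trans (mulᶠ (ωˡ β) (suc m) β′) (trans (cong (+ suc m ℤ.*_) (trans (negᶠ (ωˡ β) β) (cong ℤ.-_ (alt β)))) (ℤP.*-zeroʳ (+ suc m))))))))
        (bad-above v′ v′-β x v′x m)
    ... | inj₂ h = trans (cong (λ z → Θ′ (l · z)) (trans (sym (c′-other ne)) (c′-fixed ne h′))) (begin
        Θ′ x                                ≡⟨ act-head φ′ (ω β′ x) dilog β′ {rightQ} x refl (λ m → rightQ-vanish _ (bad-above v v-β x vx m)) ⟩
        rightQ x                            ≡⟨ act-head φ (ω x β) dilog⁻¹ β {Θ} x refl (λ m → cone k _ (below i ne l m)) ⟩
        Θ x                                 ≡⟨ simple i l ⟩
        dilog l                             ∎)
      where
      open ≡-Reasoning
      x = l · c s i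
      h′ : 0≤ ℤ.- ω (c s i) β
      h′ = subst 0≤_ (aux (ω (c s i) β)) (0≤-+ h (0≤-nat {1}))
        where
        aux : ∀ z → ℤ.- 1ℤ ℤ.- z ℤ.+ 1ℤ ≡ ℤ.- z
        aux = solveℤ
      vx : fun v x ≡ 0ℤ
      vx = trans (mulᶠ v l (c s i)) (trans (cong (+ l ℤ.*_) (trans (v-c i ne) (cong (λ w → ℤ.- + w) (weight-zero i h′)))) (ℤP.*-zeroʳ (+ l)))

    isDT′ : IsDT s′ Θ′
    isDT′ = record { cone = A′.actˡ-cone dilog rightQ-cone′ ; one = A′.act-one (ω β′ 𝟎) dilog refl rightQ-cone′ rightQ-one
                   ; simple = simple′ ; incoming = incoming′ }

-- Existence of the Donaldson–Thomas element

sgnℤ : ℤ → Sgn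
sgnℤ (+ zero)  = nul
sgnℤ (+ suc _) = pos
sgnℤ -[1+ _ ]  = ngt

sgnℤ-neg : ∀ z → sgnℤ (ℤ.- z) ≡ flip (sgnℤ z)
sgnℤ-neg (+ zero)  = refl
sgnℤ-neg (+ suc _) = refl
sgnℤ-neg -[1+ _ ]  = refl

refine : Sgn → Sgn → Sgn
refine pos _ = pos
refine nul t = t
refine ngt _ = ngt

_⊔ˢ_ : Sgn → Sgn → Sgn
pos ⊔ˢ _ = pos
nul ⊔ˢ t = t
ngt ⊔ˢ t = t

-- The sign of φ₁ + ηφ₂ + η²φ₃ + ... for an infinitesimal η > 0: the first nonzero value decides.
lexSign : ∀ {r} → List (Additive r) → Lattice r → Sgn
lexSign []       a = nul
lexSign (φ ∷ φs) a = refine (sgnℤ (fun φ a)) (lexSign φs a)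

lexSign-⊖ : ∀ {r} (φs : List (Additive r)) a → lexSign φs (⊖ a) ≡ flip (lexSign φs a)
lexSign-⊖ []       a = refl
lexSign-⊖ (φ ∷ φs) a = trans (cong₂ refine (trans (cong sgnℤ (negᶠ φ a)) (sgnℤ-neg (fun φ a))) (lexSign-⊖ φs a)) (push (sgnℤ (fun φ a)) _)
  where
  push : ∀ s t → refine (flip s) (flip t) ≡ flip (refine s t)
  push pos t = refl
  push nul t = refl
  push ngt t = refl

lexSign-⊕ : ∀ {r} (φs : List (Additive r)) a b → lexSign φs a ≢ ngt → lexSign φs b ≢ ngt → lexSign φs (a ⊕ b) ≡ lexSign φs a ⊔ˢ lexSign φs b
lexSign-⊕ []       a b na nb = refl
lexSign-⊕ (φ ∷ φs) a b na nb = trans (cong (λ z → refine (sgnℤ z) (lexSign φs (a ⊕ b))) (add φ a b)) (go (fun φ a) (fun φ b) na nb)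
  where
  go : ∀ p q → refine (sgnℤ p) (lexSign φs a) ≢ ngt → refine (sgnℤ q) (lexSign φs b) ≢ ngt →
    refine (sgnℤ (p ℤ.+ q)) (lexSign φs (a ⊕ b)) ≡ refine (sgnℤ p) (lexSign φs a) ⊔ˢ refine (sgnℤ q) (lexSign φs b)
  go -[1+ _ ]  q         na nb = ⊥-elim (na refl)
  go (+ p)     -[1+ _ ]  na nb = ⊥-elim (nb refl)
  go (+ suc p) (+ q)     na nb = refl
  go (+ zero)  (+ zero)  na nb = lexSign-⊕ φs a b na nb
  go (+ zero)  (+ suc q) na nb with lexSign φs a
  ... | pos = refl
  ... | nul = refl
  ... | ngt = ⊥-elim (na refl)

lexSign-nul : ∀ {r} (φs : List (Additive r)) a → (∀ φ → φ ∈ φs → fun φ a ≡ 0ℤ) → lexSign φs a ≡ nul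
lexSign-nul []       a h = refl
lexSign-nul (φ ∷ φs) a h = trans (cong (λ z → refine (sgnℤ z) (lexSign φs a)) (h φ (here refl))) (lexSign-nul φs a (λ ψ m → h ψ (there m)))

lexSign-nul⁻ : ∀ {r} (φs : List (Additive r)) a → lexSign φs a ≡ nul → ∀ {φ} → φ ∈ φs → fun φ a ≡ 0ℤ
lexSign-nul⁻ (φ ∷ φs) a h m = go (fun φ a) refl h m
  where
  go : ∀ z → fun φ a ≡ z → refine (sgnℤ z) (lexSign φs a) ≡ nul → ∀ {ψ} → ψ ∈ φ ∷ φs → fun ψ a ≡ 0ℤ
  go (+ zero) e h (here refl) = e
  go (+ zero) e h (there m)   = lexSign-nul⁻ φs a h m

module DTExistence {r : ℕ} (W : SkewForm r) where

  open DTTransfer W public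

  private
    L : Set
    L = Lattice r

  e : Fin r → L
  e i = 𝟎 Vec.[ i ]≔ 1ℤ

  lookup-e : ∀ i → lookup (e i) i ≡ 1ℤ
  lookup-e i = VecP.lookup∘updateAt i 𝟎

  lookup-e-off : ∀ i j → i ≢ j → lookup (e j) i ≡ 0ℤ
  lookup-e-off i j ne = trans (VecP.lookup∘updateAt′ i j ne 𝟎) (lookup-𝟎 i)

  standard : Seed
  standard = record { c = e ; γ = lookupᶠ ; γ-diag = lookup-e ; γ-off = lookup-e-off
                    ; complete = λ x h → lattice-ext λ i → trans (h i) (sym (lookup-𝟎 i)) }

  -- The 2 × 2 minors of the pair (n, x). They all vanish at x exactly when n and x are linearly
  -- dependent.
  minor : L → Fin r → Fin r → Additive r
  minor n i j = scaleᶠ (lookup n i) (lookupᶠ j) ⊟ᶠ scaleᶠ (lookup n j) (lookupᶠ i)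

  minors : L → List (Additive r)
  minors n = List.cartesianProductWith (minor n) (List.allFin r) (List.allFin r)

  stability-of : ∀ n → Stability n
  stability-of n = record
    { sgn     = lexSign φs
    ; sgn-⊖   = lexSign-⊖ φs
    ; pos+pos = λ {a} {b} p q → trans (lexSign-⊕ φs a b (λ z → case trans (sym p) z of λ ()) (λ z → case trans (sym q) z of λ ())) (cong₂ _⊔ˢ_ p q)
    ; pos+nul = λ {a} {b} p q → trans (lexSign-⊕ φs a b (λ z → case trans (sym p) z of λ ()) (λ z → case trans (sym q) z of λ ())) (cong₂ _⊔ˢ_ p q)
    ; nul+nul = λ {a} {b} p q → trans (lexSign-⊕ φs a b (λ z → case trans (sym p) z of λ ()) (λ z → case trans (sym q) z of λ ())) (cong₂ _⊔ˢ_ p q)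
    ; sgn-n   = lexSign-nul φs n at-n
    ; aligned = λ a p → first (ω n a) p
    ; line    = λ a p ne φ φa → parallel a (λ i j → lexSign-nul⁻ φs a p (there (minor∈ i j))) ne φ φa }
    where
    φs : List (Additive r)
    -- With `ω n` in first place the sign refines that of `ω n`; the minors break the remaining ties
    -- off the line of `n`.
    φs = ωʳ n ∷ minors n
    minor∈ : ∀ i j → minor n i j ∈ minors n
    minor∈ i j = ∈P.∈-cartesianProductWith⁺ (minor n) (∈P.∈-allFin i) (∈P.∈-allFin j)
    at-n : ∀ φ → φ ∈ φs → fun φ n ≡ 0ℤ
    at-n φ (here refl) = alt n
    at-n φ (there m) with ∈P.∈-cartesianProductWith⁻ (minor n) (List.allFin r) (List.allFin r) m
    ... | i , j , _ , _ , refl = aux (lookup n i) (lookup n j)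
      where
      aux : ∀ p q → p ℤ.* q ℤ.+ ℤ.- (q ℤ.* p) ≡ 0ℤ
      aux = solveℤ
    first : ∀ z {t} → refine (sgnℤ z) t ≡ pos → 0≤ z
    first (+ _) _ = 0≤-nat
    first -[1+ _ ] ()
    nonzero-entry : ∀ {m} (a : Vec ℤ m) → a ≢ 𝟎 → ∃ λ i → lookup a i ≢ 0ℤ
    nonzero-entry []      ne = ⊥-elim (ne refl)
    nonzero-entry (z ∷ a) ne with z ℤP.≟ 0ℤ
    ... | no nz    = zero , nz
    ... | yes refl with nonzero-entry a (λ h → ne (cong (0ℤ ∷_) h))
    ... | i , nz = suc i , nz
    parallel : ∀ a → (∀ i j → fun (minor n i j) a ≡ 0ℤ) → a ≢ 𝟎 → (φ : Additive r) → fun φ a ≡ 0ℤ → fun φ n ≡ 0ℤ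
    parallel a h ne φ φa with nonzero-entry a ne
    ... | i , nz = cancel (lookup a i) nz (trans (sym (mulᶠ-• φ (lookup a i) n)) (trans (cong (fun φ) multiples)
            (trans (mulᶠ-• φ (lookup n i) a) (trans (cong (lookup n i ℤ.*_) φa) (ℤP.*-zeroʳ (lookup n i))))))
      where
      cancel : ∀ p {q} → p ≢ 0ℤ → p ℤ.* q ≡ 0ℤ → q ≡ 0ℤ
      cancel p ne h with ℤP.i*j≡0⇒i≡0∨j≡0 p h
      ... | inj₁ z = ⊥-elim (ne z)
      ... | inj₂ z = z
      multiples : lookup a i • n ≡ lookup n i • a
      multiples = lattice-ext λ j → trans (lookup-• j (lookup a i) n) (trans (aux₁ (lookup n i) (lookup a j) (lookup n j) (lookup a i) (h i j))
        (sym (lookup-• j (lookup n i) a)))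
        where
        aux₁ : ∀ p q s t → p ℤ.* q ℤ.+ ℤ.- (s ℤ.* t) ≡ 0ℤ → t ℤ.* s ≡ p ℤ.* q
        aux₁ p q s t z = sym (trans (aux₂ p q s t) (trans (cong (ℤ._+ t ℤ.* s) z) (ℤP.+-identityˡ _)))
          where
          aux₂ : ∀ p q s t → p ℤ.* q ≡ p ℤ.* q ℤ.+ ℤ.- (s ℤ.* t) ℤ.+ t ℤ.* s
          aux₂ = solveℤ

  Cone : L → Set
  Cone x = InCone standard x

  range : ℤ → List ℤ
  range (+ n)    = List.map +_ (List.upTo (suc n))
  range -[1+ _ ] = []

  below : ∀ {m} → Vec ℤ m → List (Vec ℤ m)
  below []      = [] ∷ []
  below (z ∷ x) = List.cartesianProductWith _∷_ (range z) (below x)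

  ∈-range : ∀ {a z} → 0≤ a → 0≤ z ℤ.- a → a ∈ range z
  ∈-range {+ a} {+ n} _ q = ∈P.∈-map⁺ +_ (∈P.∈-upTo⁺ (s≤s (ℤP.drop‿+≤+ (ℤP.0≤i-j⇒j≤i q))))
  ∈-range {+ a} { -[1+ n ]} _ q = case ℤP.0≤i-j⇒j≤i { -[1+ n ]} {+ a} q of λ ()
  ∈-range { -[1+ a ]} ()

  ∈-below : ∀ {m} (a x : Vec ℤ m) → (∀ i → 0≤ lookup a i) → (∀ i → 0≤ lookup x i ℤ.- lookup a i) → a ∈ below x
  ∈-below []      []      p q = here refl
  ∈-below (a ∷ as) (z ∷ x) p q = ∈P.∈-cartesianProductWith⁺ _∷_ {xs = range z} {ys = below x} (∈-range {a} {z} (p zero) (q zero)) (∈-below as x (p ∘ suc) (q ∘ suc))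

  -- The terms of `A * B` at `x` other than the two trivial ones. Both parts are smaller than `x`,
  -- which makes the recursions on the degree well founded.
  record ProperSplit (σ : L → Sgn) (x a : L) : Set where
    field
      cone₁ : Cone a
      cone₂ : Cone (x ⊝ a)
      a≢𝟎   : a ≢ 𝟎
      a≢x   : a ≢ x
      pos₁  : σ a ≡ pos
      pos₂  : σ (x ⊝ a) ≢ pos

  properSplit? : ∀ σ x a → Dec (ProperSplit σ x a)
  properSplit? σ x a with cone? standard a | cone? standard (x ⊝ a)
  ... | inj₂ (i , q) | _ = no λ P → ¬both (ProperSplit.cone₁ P i) q
  ... | inj₁ _ | inj₂ (i , q) = no λ P → ¬both (ProperSplit.cone₂ P i) q
  ... | inj₁ c₁ | inj₁ c₂ with a ≟ᴸ 𝟎 | a ≟ᴸ x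
  ... | yes z | _ = no λ P → ProperSplit.a≢𝟎 P z
  ... | no _ | yes z = no λ P → ProperSplit.a≢x P z
  ... | no n₁ | no n₂ with pos? (σ a) | pos? (σ (x ⊝ a))
  ... | inj₂ z | _ = no λ P → z (ProperSplit.pos₁ P)
  ... | inj₁ _ | inj₁ z = no λ P → ProperSplit.pos₂ P z
  ... | inj₁ p₁ | inj₂ p₂ = yes record { cone₁ = c₁ ; cone₂ = c₂ ; a≢𝟎 = n₁ ; a≢x = n₂ ; pos₁ = p₁ ; pos₂ = p₂ }

  gate : {P : Set} → Dec P → ℚ → ℚ
  gate (yes _) q = q
  gate (no _)  q = 0ℚ

  gate-cong : {P : Set} (d : Dec P) {p q : ℚ} → (P → p ≡ q) → gate d p ≡ gate d q
  gate-cong (yes h) f = f h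
  gate-cong (no _)  f = refl

  gate-no : {P : Set} (d : Dec P) {q : ℚ} → ¬ P → gate d q ≡ 0ℚ
  gate-no (yes h) n = ⊥-elim (n h)
  gate-no (no _)  n = refl

  gate-yes : {P : Set} (d : Dec P) {q : ℚ} → P → gate d q ≡ q
  gate-yes (yes _) h = refl
  gate-yes (no n)  h = ⊥-elim (n h)

  properTerm : (L → Sgn) → (L → ℚ) → L → L → ℚ
  properTerm σ Y x a = gate (properSplit? σ x a) (summand Y Y x a)

  properSum : (L → Sgn) → (L → ℚ) → L → ℚ
  properSum σ Y x = sumL (dedup (below x)) (properTerm σ Y x)

  properSum-hasSum : ∀ σ Y x → HasSum (properTerm σ Y x) (properSum σ Y x)
  properSum-hasSum σ Y x = record { supp = dedup (below x) ; unique = dedup-unique (below x)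
    ; vanish = λ a n → gate-no (properSplit? σ x a) (λ P → n (∈-dedup (∈-below a x (ProperSplit.cone₁ P)
        (λ i → subst 0≤_ (subᶠ (lookupᶠ i) x a) (ProperSplit.cone₂ P i)))))
    ; value = refl }

  size : L → ℕ
  size x = ∣ fun (height standard) x ∣

  size-split : ∀ {x a} → Cone a → Cone (x ⊝ a) → a ≢ x → size a ℕ.< size x
  size-split {x} {a} ca cb ne = ∣∣-mono {fun (height standard) a} {fun (height standard) x} (sumℤ-nonneg ca) (subst 0≤_ (cong (ℤ._- 1ℤ) (subᶠ (height standard) x a))
    (height-pos standard cb (λ z → ne (sym (⊝-≡𝟎 z)))))
    where
    ∣∣-mono : ∀ {p q} → 0≤ p → 0≤ q ℤ.- p ℤ.- 1ℤ → ∣ p ∣ ℕ.< ∣ q ∣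
    ∣∣-mono {+ p} {+ q} _ h = ℤP.drop‿+≤+ (ℤP.0≤i-j⇒j≤i (subst 0≤_ (aux (+ q) (+ p)) h))
      where
      aux : ∀ q p → q ℤ.- p ℤ.- 1ℤ ≡ q ℤ.- (1ℤ ℤ.+ p)
      aux = solveℤ
    ∣∣-mono {+ p} { -[1+ q ]} _ h = ⊥-elim (¬both {+ p} 0≤-nat (subst 0≤_ (aux (+ q) (+ p)) (0≤-+ h (0≤-nat {suc q}))))
      where
      aux : ∀ q p → ℤ.- (1ℤ ℤ.+ q) ℤ.- p ℤ.- 1ℤ ℤ.+ (1ℤ ℤ.+ q) ≡ ℤ.- 1ℤ ℤ.- p
      aux = solveℤ
    ∣∣-mono { -[1+ p ]} ()

  size-split′ : ∀ {x a} → Cone a → Cone (x ⊝ a) → a ≢ 𝟎 → size (x ⊝ a) ℕ.< size x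
  size-split′ {x} {a} ca cb ne = size-split cb (subst Cone (solveᴸ (x ∷ a ∷ []) v₁ (v₀ :- (v₀ :- v₁)) refl) ca)
    (λ z → ne (trans (solveᴸ (x ∷ a ∷ []) v₁ (v₀ :- (v₀ :- v₁)) refl) (trans (cong (x ⊝_) z) (⊝-self x))))

  Local : ((L → ℚ) → L → ℚ) → Set
  Local step = ∀ f g x → (∀ y → size y ℕ.< size x → f y ≡ g y) → step f x ≡ step g x

  iterate : ((L → ℚ) → L → ℚ) → ℕ → L → ℚ
  iterate step zero    x = 0ℚ
  iterate step (suc n) x = step (iterate step n) x

  module _ {step : (L → ℚ) → L → ℚ} (local : Local step) where

    iterate-stable : ∀ m n x → size x ℕ.< m → size x ℕ.< n → iterate step m x ≡ iterate step n x
    iterate-stable (suc m) (suc n) x (s≤s p) (s≤s q) = local _ _ x λ y y<x →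
      iterate-stable m n y (ℕP.<-≤-trans y<x p) (ℕP.<-≤-trans y<x q)

  opaque
    -- Recursion on the size by fuel: for a step that consults only smaller sizes (`Local`) the
    -- value at `x` is stable after `suc (size x)` rounds.
    fix : ((L → ℚ) → L → ℚ) → L → ℚ
    fix step x = iterate step (suc (size x)) x

    fix-unfold : {step : (L → ℚ) → L → ℚ} → Local step → ∀ x → fix step x ≡ step (fix step) x
    fix-unfold {step} local x = local _ _ x λ y y<x → iterate-stable {step} local (size x) (suc (size y)) y y<x ℕP.≤-refl

  properSum-local : ∀ σ {Y Y′ : L → ℚ} x → (∀ y → size y ℕ.< size x → Y y ≡ Y′ y) → properSum σ Y x ≡ properSum σ Y′ x
  properSum-local σ x h = sumL-cong (dedup (below x)) λ a → gate-cong (properSplit? σ x a) λ P →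
    cong₂ (λ p q → (twist (ω a (x ⊝ a)) ⊠ p) ⊠ q)
      (h a (size-split {x} (ProperSplit.cone₁ P) (ProperSplit.cone₂ P) (ProperSplit.a≢x P)))
      (h (x ⊝ a) (size-split′ {x} (ProperSplit.cone₁ P) (ProperSplit.cone₂ P) (ProperSplit.a≢𝟎 P)))

  -- The solution Y of Θ = A * B, where A is Y on the positive side of σ and B is Y on the other side.
  factorStep : (L → Sgn) → (L → ℚ) → (L → ℚ) → L → ℚ
  factorStep σ Θ Y x = Θ x ⊞ neg (properSum σ Y x)

  factorStep-local : ∀ σ Θ → Local (factorStep σ Θ)
  factorStep-local σ Θ f g x h = cong (λ p → Θ x ⊞ neg p) (properSum-local σ x h)

  factor : (L → Sgn) → (L → ℚ) → L → ℚ
  factor σ Θ = fix (factorStep σ Θ)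

  -- The recursion for `dt` factors `dt` itself. This bound shows that a factor at a smaller degree
  -- uses `dt` only at degrees already known.
  factor-local : ∀ σ {Θ Θ′ : L → ℚ} n x → size x ℕ.< n → (∀ y → size y ℕ.≤ size x → Θ y ≡ Θ′ y) → factor σ Θ x ≡ factor σ Θ′ x
  factor-local σ {Θ} {Θ′} (suc n) x (s≤s q) h = trans (fix-unfold (factorStep-local σ Θ) x) (trans (cong₂ (λ p s → p ⊞ neg s) (h x ℕP.≤-refl)
    (properSum-local σ x λ y y<x → factor-local σ n y (ℕP.<-≤-trans y<x q) (λ z z≤y → h z (ℕP.≤-trans z≤y (ℕP.<⇒≤ y<x)))))
    (sym (fix-unfold (factorStep-local σ Θ′) x)))

  axisIndex? : ∀ x → Dec (∃ λ i → x ≡ ∣ lookup x i ∣ · e i)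
  axisIndex? x = FinP.any? λ i → x ≟ᴸ ∣ lookup x i ∣ · e i

  -- The prescribed coefficients on the incoming walls: those of E along each coordinate axis, and 0
  -- off the axes.
  wallTerm : L → ℚ
  wallTerm x with x ≟ᴸ 𝟎 | axisIndex? x
  ... | yes _ | _            = 1ℚ
  ... | no _  | yes (i , _)  = dilog ∣ lookup x i ∣
  ... | no _  | no _         = 0ℚ

  lookup-·e : ∀ l i → lookup (l · e i) i ≡ + l
  lookup-·e l i = trans (mulᶠ (lookupᶠ i) l (e i)) (trans (cong (+ l ℤ.*_) (lookup-e i)) (ℤP.*-identityʳ (+ l)))

  lookup-·e-off : ∀ l i j → i ≢ j → lookup (l · e j) i ≡ 0ℤ
  lookup-·e-off l i j ne = trans (mulᶠ (lookupᶠ i) l (e j)) (trans (cong (+ l ℤ.*_) (lookup-e-off i j ne)) (ℤP.*-zeroʳ (+ l)))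

  wallTerm-simple : ∀ i l → wallTerm (l · e i) ≡ dilog l
  wallTerm-simple i l with (l · e i) ≟ᴸ 𝟎 | axisIndex? (l · e i)
  ... | yes z | _ = sym (cong dilog (ℤP.+-injective (trans (sym (lookup-·e l i)) (trans (cong (λ x → lookup x i) z) (lookup-𝟎 i)))))
  ... | no _  | no ni = ⊥-elim (ni (i , cong (λ z → ∣ z ∣ · e i) (sym (lookup-·e l i))))
  ... | no nz | yes (j , h) with j Fin.≟ i
  ... | yes refl = cong (λ z → dilog ∣ z ∣) (lookup-·e l i)
  ... | no ne    = ⊥-elim (nz (trans h (cong (λ z → ∣ z ∣ · e j) (lookup-·e-off l j i ne))))

  wallTerm-other : ∀ x → x ≢ 𝟎 → ¬ Simple standard x → wallTerm x ≡ 0ℚ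
  wallTerm-other x ne ns with x ≟ᴸ 𝟎 | axisIndex? x
  ... | yes z | _           = ⊥-elim (ne z)
  ... | no _  | yes (i , h) = ⊥-elim (ns (i , ∣ lookup x i ∣ , h))
  ... | no _  | no _        = refl

  sign : L → L → Sgn
  sign n = Stability.sgn (stability-of n)

  coneDec : ∀ x → Dec (Cone x)
  coneDec x with cone? standard x
  ... | inj₁ h       = yes h
  ... | inj₂ (i , q) = no λ h → ¬both (h i) q

  -- The coefficient at `x` is chosen so that, for the stability condition of `x` itself, the factor
  -- takes the value `wallTerm x` at `x` (`factor-at`). The correction involves only smaller
  -- degrees.
  dtStep : (L → ℚ) → L → ℚ
  dtStep Θ x = gate (coneDec x) (wallTerm x ⊞ properSum (sign x) (factor (sign x) Θ) x)

  dtStep-local : Local dtStep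
  dtStep-local f g x h = cong (λ p → gate (coneDec x) (wallTerm x ⊞ p)) (properSum-local (sign x) x λ y y<x →
    factor-local (sign x) (suc (size y)) y ℕP.≤-refl (λ z z≤y → h z (ℕP.≤-<-trans z≤y y<x)))

  dt : L → ℚ
  dt = fix dtStep

  dt-unfold : ∀ x → Cone x → dt x ≡ wallTerm x ⊞ properSum (sign x) (factor (sign x) dt) x
  dt-unfold x cx = trans (fix-unfold dtStep-local x) (gate-yes (coneDec x) cx)

  dt-outside : ∀ x → ¬ Cone x → dt x ≡ 0ℚ
  dt-outside x nc = trans (fix-unfold dtStep-local x) (gate-no (coneDec x) nc)

  factor-at : ∀ n → Cone n → factor (sign n) dt n ≡ wallTerm n
  factor-at n cn = trans (fix-unfold (factorStep-local (sign n) dt) n) (trans (cong (_⊞ neg S) (dt-unfold n cn))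
    (trans (𝔽.+-assoc (wallTerm n) S (neg S)) (trans (cong (wallTerm n ⊞_) (𝔽.-‿inverseʳ S)) (𝔽.+-identityʳ _))))
    where S = properSum (sign n) (factor (sign n) dt) n

  properSum-none : ∀ σ Y x → (∀ a → ¬ ProperSplit σ x a) → properSum σ Y x ≡ 0ℚ
  properSum-none σ Y x h = sumL-zero (dedup (below x)) (λ a _ → gate-no (properSplit? σ x a) (h a))

  cone-·e : ∀ l i → Cone (l · e i)
  cone-·e l i j with j Fin.≟ i
  ... | yes refl = subst 0≤_ (sym (lookup-·e l i)) 0≤-nat
  ... | no ne    = subst 0≤_ (sym (lookup-·e-off l j i ne)) 0≤-nat

  -- The parts of a multiple of a basis vector inside the cone are again multiples of it, hence of
  -- sign zero, so none can be the positive part of a split.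
  dt-simple : ∀ i l → dt (l · e i) ≡ dilog l
  dt-simple i l = trans (dt-unfold n (cone-·e l i)) (trans (cong₂ _⊞_ (wallTerm-simple i l) (properSum-none (sign n) _ n none)) (𝔽.+-identityʳ _))
    where
    n = l · e i
    S : Stability n
    S = stability-of n
    module S = Stability S
    on-axis : ∀ a → Cone a → Cone (n ⊝ a) → a ≡ ∣ lookup a i ∣ · e i
    on-axis a ca cb = lattice-ext λ j → by-index j (j Fin.≟ i)
      where
      by-index : ∀ j → Dec (j ≡ i) → lookup a j ≡ lookup (∣ lookup a i ∣ · e i) j
      by-index j (yes refl) = trans (sym (ℤP.0≤i⇒+∣i∣≡i (ca i))) (sym (lookup-·e ∣ lookup a i ∣ i))
      by-index j (no ne)    = trans (0≤-antisym (ca j) (subst 0≤_ (trans (subᶠ (lookupᶠ j) n a) (trans (cong (ℤ._- lookup a j) (lookup-·e-off l j i ne)) (ℤP.+-identityˡ _))) (cb j)))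
        (sym (lookup-·e-off ∣ lookup a i ∣ j i ne))
    none : ∀ a → ¬ ProperSplit (sign n) n a
    none a P = go l refl
      where
      open ProperSplit P
      m = ∣ lookup a i ∣
      a≡ : a ≡ m · e i
      a≡ = on-axis a cone₁ cone₂
      go : ∀ l′ → l ≡ l′ → ⊥
      go zero     refl = a≢𝟎 (trans a≡ (cong (λ z → ∣ z ∣ · e i) (0≤-antisym (cone₁ i)
        (subst 0≤_ (trans (subᶠ (lookupᶠ i) n a) (trans (cong (ℤ._- lookup a i) (lookup-𝟎 i)) (ℤP.+-identityˡ _))) (cone₂ i)))))
      go (suc l′) refl = case trans (sym pos₁) (trans (cong S.sgn a≡) (S.nul-· m (S.nul-root l′ S.sgn-n))) of λ ()

  dt-𝟎 : dt 𝟎 ≡ 1ℚ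
  dt-𝟎 = trans (dt-unfold 𝟎 cone-𝟎) (trans (cong₂ _⊞_ wall₀ (properSum-none (sign 𝟎) (factor (sign 𝟎) dt) 𝟎 λ a P →
    ProperSplit.a≢𝟎 P (complete standard a λ i → 0≤-antisym (ProperSplit.cone₁ P i)
      (subst 0≤_ (trans (subᶠ (lookupᶠ i) 𝟎 a) (trans (cong (ℤ._- lookup a i) (lookup-𝟎 i)) (ℤP.+-identityˡ _))) (ProperSplit.cone₂ P i))))) (𝔽.+-identityʳ 1ℚ))
    where
    cone-𝟎 : Cone 𝟎
    cone-𝟎 i = subst 0≤_ (sym (lookup-𝟎 i)) 0≤-nat
    wall₀ : wallTerm 𝟎 ≡ 1ℚ
    wall₀ with 𝟎 {r} ≟ᴸ 𝟎
    ... | yes _ = refl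
    ... | no ne = ⊥-elim (ne refl)

  module Factoring (n : L) where
    σ : L → Sgn
    σ = sign n
    X : L → ℚ
    X = factor σ dt
    InA InB : L → Set
    InA x = Cone x × σ x ≡ pos
    InB x = Cone x × σ x ≢ pos
    inA? : ∀ x → Dec (InA x)
    inA? x with coneDec x | pos? (σ x)
    ... | yes h | inj₁ p = yes (h , p)
    ... | yes h | inj₂ p = no (p ∘ proj₂)
    ... | no h  | _      = no (h ∘ proj₁)
    inB? : ∀ x → Dec (InB x)
    inB? x with coneDec x | pos? (σ x)
    ... | yes h | inj₁ p = no (λ P → proj₂ P p)
    ... | yes h | inj₂ p = yes (h , p)
    ... | no h  | _      = no (h ∘ proj₁)
    A B : L → ℚ
    A x with x ≟ᴸ 𝟎
    ... | yes _ = 1ℚ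
    ... | no _  = gate (inA? x) (X x)
    B x with x ≟ᴸ 𝟎
    ... | yes _ = 1ℚ
    ... | no _  = gate (inB? x) (X x)
    A-𝟎 : A 𝟎 ≡ 1ℚ
    A-𝟎 with 𝟎 {r} ≟ᴸ 𝟎
    ... | yes _ = refl
    ... | no ne = ⊥-elim (ne refl)
    B-𝟎 : B 𝟎 ≡ 1ℚ
    B-𝟎 with 𝟎 {r} ≟ᴸ 𝟎
    ... | yes _ = refl
    ... | no ne = ⊥-elim (ne refl)
    A-off : ∀ x → ¬ InA x → x ≢ 𝟎 → A x ≡ 0ℚ
    A-off x n ne with x ≟ᴸ 𝟎
    ... | yes z = ⊥-elim (ne z)
    ... | no _  = gate-no (inA? x) n
    B-off : ∀ x → ¬ InB x → x ≢ 𝟎 → B x ≡ 0ℚ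
    B-off x n ne with x ≟ᴸ 𝟎
    ... | yes z = ⊥-elim (ne z)
    ... | no _  = gate-no (inB? x) n
    A-on : ∀ x → InA x → x ≢ 𝟎 → A x ≡ X x
    A-on x h ne with x ≟ᴸ 𝟎
    ... | yes z = ⊥-elim (ne z)
    ... | no _  = gate-yes (inA? x) h
    B-on : ∀ x → InB x → x ≢ 𝟎 → B x ≡ X x
    B-on x h ne with x ≟ᴸ 𝟎
    ... | yes z = ⊥-elim (ne z)
    ... | no _  = gate-yes (inB? x) h
    middle : ∀ x a → a ≢ 𝟎 → a ≢ x → properTerm σ X x a ≡ summand A B x a
    middle x a n₀ nx with properSplit? σ x a
    ... | yes P = sym (cong₂ (λ p q → (twist (ω a (x ⊝ a)) ⊠ p) ⊠ q) (A-on a (ProperSplit.cone₁ P , ProperSplit.pos₁ P) n₀)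
                    (B-on (x ⊝ a) (ProperSplit.cone₂ P , ProperSplit.pos₂ P) (λ z → nx (sym (⊝-≡𝟎 z)))))
    ... | no nP with inA? a | inB? (x ⊝ a)
    ... | yes (c₁ , p₁) | yes (c₂ , p₂) = ⊥-elim (nP record { cone₁ = c₁ ; cone₂ = c₂ ; a≢𝟎 = n₀ ; a≢x = nx ; pos₁ = p₁ ; pos₂ = p₂ })
    ... | no n₁ | _ = sym (summand-zero A B x a (⊠-zeroˡ (A-off a n₁ n₀)))
    ... | yes _ | no n₂ = sym (summand-zero A B x a (⊠-zeroʳ (B-off (x ⊝ a) n₂ (λ z → nx (sym (⊝-≡𝟎 z))))))
    product : IsProduct A B dt
    product x with coneDec x
    ... | no nc = subst (HasSum (summand A B x)) (sym (dt-outside x nc)) (hasSum-zero λ a → summand-zero A B x a (off a))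
      where
      off : ∀ a → A a ⊠ B (x ⊝ a) ≡ 0ℚ
      off a with cone? standard a | cone? standard (x ⊝ a)
      ... | inj₂ (i , q) | _ = ⊠-zeroˡ (A-off a (λ P → ¬both (proj₁ P i) q) (λ { refl → ¬both (subst 0≤_ (sym (lookup-𝟎 i)) 0≤-nat) q }))
      ... | inj₁ _ | inj₂ (i , q) = ⊠-zeroʳ (B-off (x ⊝ a) (λ P → ¬both (proj₁ P i) q)
              (λ z → ¬both (subst 0≤_ (sym (trans (cong (λ y → lookup y i) z) (lookup-𝟎 i))) 0≤-nat) q))
      ... | inj₁ ca | inj₁ cb = ⊥-elim (nc λ i → subst 0≤_ (trans (cong (λ t → lookup a i ℤ.+ t) (subᶠ (lookupᶠ i) x a)) (aux (lookup a i) (lookup x i))) (0≤-+ (ca i) (cb i)))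
        where
        aux : ∀ a x → a ℤ.+ (x ℤ.- a) ≡ x
        aux = solveℤ
    ... | yes cx with x ≟ᴸ 𝟎
    ... | yes refl = subst (HasSum (summand A B 𝟎)) (sym dt-𝟎) (hasSum-cong pointwise (hasSum-at 𝟎 1ℚ))
      where
      pointwise : ∀ a → at 𝟎 1ℚ a ≡ summand A B 𝟎 a
      pointwise a with 𝟎 ≟ᴸ a
      ... | yes refl = trans (sym B-𝟎) (sym (summand-first A B 𝟎 A-𝟎))
      ... | no ne    = sym (summand-zero A B 𝟎 a (zero-at (cone? standard a) (cone? standard (𝟎 ⊝ a))))
        where
        zero-at : InCone standard a ⊎ ∃ (λ i → Negative (lookup a i)) → InCone standard (𝟎 ⊝ a) ⊎ ∃ (λ i → Negative (lookup (𝟎 ⊝ a) i)) → A a ⊠ B (𝟎 ⊝ a) ≡ 0ℚ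
        zero-at (inj₂ (i , q)) _ = ⊠-zeroˡ (A-off a (λ P → ¬both (proj₁ P i) q) (ne ∘ sym))
        zero-at (inj₁ _) (inj₂ (i , q)) = ⊠-zeroʳ (B-off (𝟎 ⊝ a) (λ P → ¬both (proj₁ P i) q) (λ z → ne (⊝-≡𝟎 z)))
        zero-at (inj₁ ca) (inj₁ cb) = ⊥-elim (ne (sym (complete standard a λ i → 0≤-antisym (ca i)
          (subst 0≤_ (trans (subᶠ (lookupᶠ i) 𝟎 a) (trans (cong (ℤ._- lookup a i) (lookup-𝟎 i)) (ℤP.+-identityˡ _))) (cb i)))))
    ... | no x≢𝟎 = subst (HasSum (summand A B x)) total (hasSum-cong pointwise
            (hasSum-add (hasSum-add (hasSum-at 𝟎 (B x)) (hasSum-at x (A x))) (properSum-hasSum σ X x)))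
      where
      pointwise : ∀ a → at 𝟎 (B x) a ⊞ at x (A x) a ⊞ properTerm σ X x a ≡ summand A B x a
      pointwise a with 𝟎 ≟ᴸ a | x ≟ᴸ a
      ... | yes refl | yes z    = ⊥-elim (x≢𝟎 z)
      ... | yes refl | no _     = trans (cong (B x ⊞ 0ℚ ⊞_) (gate-no (properSplit? σ x 𝟎) (λ P → ProperSplit.a≢𝟎 P refl)))
                                    (trans (𝔽.+-identityʳ _) (trans (𝔽.+-identityʳ _) (sym (summand-first A B x A-𝟎))))
      ... | no _     | yes refl = trans (cong (0ℚ ⊞ A x ⊞_) (gate-no (properSplit? σ x x) (λ P → ProperSplit.a≢x P refl)))
                                    (trans (𝔽.+-identityʳ _) (trans (𝔽.+-identityˡ _) (sym (summand-last A B x B-𝟎))))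
      ... | no n0    | no nx    = trans (cong (_⊞ properTerm σ X x a) (𝔽.+-identityˡ 0ℚ)) (trans (𝔽.+-identityˡ _) (middle x a (n0 ∘ sym) (nx ∘ sym)))
      S = properSum σ X x
      X-def : X x ≡ dt x ⊞ neg S
      X-def = fix-unfold (factorStep-local σ dt) x
      B+A : B x ⊞ A x ≡ X x
      B+A with pos? (σ x)
      ... | inj₁ p = trans (cong₂ _⊞_ (B-off x (λ P → proj₂ P p) x≢𝟎) (A-on x (cx , p) x≢𝟎)) (𝔽.+-identityˡ _)
      ... | inj₂ p = trans (cong₂ _⊞_ (B-on x (cx , p) x≢𝟎) (A-off x (λ P → p (proj₂ P)) x≢𝟎)) (𝔽.+-identityʳ _)
      total : B x ⊞ A x ⊞ S ≡ dt x
      total = trans (cong (_⊞ S) (trans B+A X-def)) (trans (𝔽.+-assoc (dt x) (neg S) S) (trans (cong (dt x ⊞_) (𝔽.-‿inverseˡ S)) (𝔽.+-identityʳ _)))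

  dt-factorization : ∀ n → Factorization standard n dt
  dt-factorization n = record
    { stability = stability-of n ; A = A ; B = B
    ; coneA = λ i x q → A-off x (λ P → ¬both (proj₁ P i) q) (λ { refl → ¬both (subst 0≤_ (sym (lookup-𝟎 i)) 0≤-nat) q })
    ; coneB = λ i x q → B-off x (λ P → ¬both (proj₁ P i) q) (λ { refl → ¬both (subst 0≤_ (sym (lookup-𝟎 i)) 0≤-nat) q })
    ; oneA = A-𝟎 ; oneB = B-𝟎
    ; posA = λ x ne np → A-off x (λ P → np (proj₂ P)) ne
    ; posB = λ x p → B-off x (λ P → proj₂ P p) (λ { refl → case trans (sym p) (Stability.sgn-𝟎 (stability-of n)) of λ () })
    ; prod = product }
    where open Factoring n

  dt-isDT : IsDT standard dt
  dt-isDT = record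
    { cone     = λ i x q → dt-outside x (λ h → ¬both (h i) q)
    ; one      = dt-𝟎
    ; simple   = dt-simple
    ; incoming = λ n ne → dt-factorization n , incoming n ne (axisIndex? n) }
    where
    incoming : ∀ n → n ≢ 𝟎 → Dec (∃ λ i → n ≡ ∣ lookup n i ∣ · e i) → Simple standard n ⊎ Factoring.B n n ≡ 0ℚ
    incoming n ne (yes (i , h)) = inj₁ (i , ∣ lookup n i ∣ , h)
    incoming n ne (no nh) with coneDec n
    ... | no nc  = inj₂ (Factoring.B-off n n (nc ∘ proj₁) ne)
    ... | yes cn = inj₂ (trans (Factoring.B-on n n (cn , λ p → case trans (sym p) (Stability.sgn-n (stability-of n)) of λ ()) ne)
      (trans (factor-at n cn) (wallTerm-other n ne λ { (i , l , n≡) → nh (i , trans n≡ (cong (_· e i)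
        (cong ∣_∣ (sym (trans (cong (λ x → lookup x i) n≡) (lookup-·e l i)))))) })))

-- Green paths

sumᴸ : ∀ {r n} → (Fin n → Lattice r) → Lattice r
sumᴸ {n = zero}  xs = 𝟎
sumᴸ {n = suc n} xs = xs zero ⊕ sumᴸ (xs ∘ suc)

fun-sumᴸ : ∀ {r n} (φ : Additive r) (xs : Fin n → Lattice r) → fun φ (sumᴸ xs) ≡ sumℤ (fun φ ∘ xs)
fun-sumᴸ {n = zero}  φ xs = zeroᶠ φ
fun-sumᴸ {n = suc n} φ xs = trans (add φ (xs zero) _) (cong (λ t → fun φ (xs zero) ℤ.+ t) (fun-sumᴸ φ (xs ∘ suc)))

NonNeg NonPos : ∀ {r} → Lattice r → Set
NonNeg x = ∀ i → 0≤ lookup x i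
NonPos x = ∀ i → 0≤ ℤ.- lookup x i

nonNeg-nonPos : ∀ {r} {x : Lattice r} → NonNeg x → NonPos x → x ≡ 𝟎
nonNeg-nonPos p q = lattice-ext λ i → trans (0≤-antisym (p i) (q i)) (sym (lookup-𝟎 i))

total : ∀ {r} → Additive r
total = sumᶠ lookupᶠ

total-pos : ∀ {r} {x : Lattice r} → NonNeg x → x ≢ 𝟎 → 0≤ fun total x ℤ.- 1ℤ
total-pos {x = x} p ne with sign? (fun total x ℤ.- 1ℤ)
... | inj₁ h = h
... | inj₂ h = ⊥-elim (ne (nonNeg-nonPos p λ i → subst 0≤_ (aux (fun total x) (lookup x i)) (0≤-+ (sumℤ-dominates p i) h)))
  where
  aux : ∀ t z → t ℤ.- z ℤ.+ (ℤ.- 1ℤ ℤ.- (t ℤ.- 1ℤ)) ≡ ℤ.- z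
  aux = solveℤ

module GreenPaths {r : ℕ} (W : SkewForm r) where

  open DTExistence W public

  private
    L : Set
    L = Lattice r

  -- Maximal green sequences in terms of c-vectors.
  GreenPath : (Fin r → L) → List (Fin r) → Set
  GreenPath cs []       = ∀ i → NonPos (cs i)
  GreenPath cs (k ∷ ks) = NonNeg (cs k) × GreenPath (mutateᶜ cs k) ks

  expansion : ∀ (s : Seed) (φ : Additive r) x → fun φ x ≡ sumℤ (λ i → fun (γ s i) x ℤ.* fun φ (c s i))
  expansion s φ x = trans (cong (fun φ) (⊝-≡𝟎 (complete s (x ⊝ y) λ i → trans (subᶠ (γ s i) x y) (trans (cong (λ t → fun (γ s i) x ℤ.- t) (coordinate i)) (ℤP.+-inverseʳ (fun (γ s i) x))))))
    (trans (fun-sumᴸ φ terms) (sumℤ-cong λ i → mulᶠ-• φ (fun (γ s i) x) (c s i)))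
    where
    terms : Fin r → L
    terms i = fun (γ s i) x • c s i
    y : L
    y = sumᴸ terms
    coordinate : ∀ i → fun (γ s i) y ≡ fun (γ s i) x
    coordinate i = trans (fun-sumᴸ (γ s i) terms) (trans (sumℤ-single {a = fun (γ s i) ∘ terms} i
      (λ j ne → trans (mulᶠ-• (γ s i) (fun (γ s j) x) (c s j)) (trans (cong (fun (γ s j) x ℤ.*_) (γ-off s i j (ne ∘ sym))) (ℤP.*-zeroʳ (fun (γ s j) x)))))
      (trans (mulᶠ-• (γ s i) (fun (γ s i) x) (c s i)) (trans (cong (fun (γ s i) x ℤ.*_) (γ-diag s i)) (ℤP.*-identityʳ _))))

  cone-nonneg : ∀ (s : Seed) (φ : Additive r) → (∀ i → 0≤ fun φ (c s i)) → ∀ {x} → InCone s x → 0≤ fun φ x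
  cone-nonneg s φ h {x} cx = subst 0≤_ (sym (expansion s φ x)) (sumℤ-nonneg λ i → 0≤-* (cx i) (h i))

  PosSupported NegSupported : (L → ℚ) → Set
  PosSupported f = ∀ i → SupportedOn (lookupᶠ i) f
  NegSupported f = ∀ i → SupportedOn (negateᶠ (lookupᶠ i)) f

  posSupported-total : ∀ {f} → PosSupported f → SupportedOn total f
  posSupported-total b x nx with scan (lookup x)
  ... | inj₁ h       = ⊥-elim (¬both (sumℤ-nonneg h) nx)
  ... | inj₂ (i , q) = b i x q

  negSupported-total : ∀ {f} → NegSupported f → SupportedOn (negateᶠ total) f
  negSupported-total b x nx with scan (λ i → ℤ.- lookup x i)
  ... | inj₁ h       = ⊥-elim (¬both (subst 0≤_ (sumℤ-neg (lookup x)) (sumℤ-nonneg h)) nx)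
    where
    sumℤ-neg : ∀ {n} (a : Fin n → ℤ) → sumℤ (λ i → ℤ.- a i) ≡ ℤ.- sumℤ a
    sumℤ-neg {zero}  a = refl
    sumℤ-neg {suc n} a = trans (cong (λ t → ℤ.- a zero ℤ.+ t) (sumℤ-neg (a ∘ suc))) (sym (ℤP.neg-distrib-+ (a zero) (sumℤ (a ∘ suc))))
  ... | inj₂ (i , q) = b i x q

  -- Along a green path Θ factors as S * R into a red and a green part.
  record State (s : Seed) (S R : L → ℚ) : Set where
    field
      Θ     : L → ℚ
      isDT  : IsDT s Θ
      coneS : ConeSupported s S
      coneR : ConeSupported s R
      negS  : NegSupported S
      posR  : PosSupported R
      oneS  : S 𝟎 ≡ 1ℚ
      oneR  : R 𝟎 ≡ 1ℚ
      prod  : IsProduct S R Θ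

    S-nonPos : ∀ {x} → S x ≢ 0ℚ → NonPos x
    S-nonPos {x} ne with scan (λ i → ℤ.- lookup x i)
    ... | inj₁ h       = h
    ... | inj₂ (i , q) = ⊥-elim (ne (negS i x q))

    R-nonNeg : ∀ {x} → R x ≢ 0ℚ → NonNeg x
    R-nonNeg {x} ne with scan (lookup x)
    ... | inj₁ h       = h
    ... | inj₂ (i , q) = ⊥-elim (ne (posR i x q))

    S-cone : ∀ {x} → S x ≢ 0ℚ → InCone s x
    S-cone {x} ne with cone? s x
    ... | inj₁ h       = h
    ... | inj₂ (i , q) = ⊥-elim (ne (coneS i x q))

    R-cone : ∀ {x} → R x ≢ 0ℚ → InCone s x
    R-cone {x} ne with cone? s x
    ... | inj₁ h       = h
    ... | inj₂ (i , q) = ⊥-elim (ne (coneR i x q))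

  state-cong : ∀ {s S S′ R R′} → (∀ x → S x ≡ S′ x) → (∀ x → R x ≡ R′ x) → State s S R → State s S′ R′
  state-cong {s} {S} {S′} {R} {R′} eS eR st = record { Θ = Θ ; isDT = isDT
    ; coneS = λ i x q → trans (sym (eS x)) (coneS i x q) ; coneR = λ i x q → trans (sym (eR x)) (coneR i x q)
    ; negS = λ i x q → trans (sym (eS x)) (negS i x q) ; posR = λ i x q → trans (sym (eR x)) (posR i x q)
    ; oneS = trans (sym (eS 𝟎)) oneS ; oneR = trans (sym (eR 𝟎)) oneR
    ; prod = λ x → hasSum-cong (λ a → cong₂ (λ p q → (twist (ω a (x ⊝ a)) ⊠ p) ⊠ q) (eS a) (eR (x ⊝ a))) (prod x) }
    where open State st

  module _ {s : Seed} {S R : L → ℚ} (st : State s S R) where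
    open State st

    -- The c-vectors are sign-coherent.
    c-supported : ∀ i → S (c s i) ≢ 0ℚ ⊎ R (c s i) ≢ 0ℚ
    c-supported i with S (c s i) ℚP.≟ 0ℚ | R (c s i) ℚP.≟ 0ℚ
    ... | no n  | _     = inj₁ n
    ... | yes _ | no n  = inj₂ n
    ... | yes p | yes q = ⊥-elim (dilog-1≢0 (trans (sym (trans (cong Θ (sym (⊕-identityʳ (c s i)))) (IsDT.simple isDT i 1))) (trans split (trans (cong₂ _⊞_ p q) (𝔽.+-identityˡ 0ℚ)))))
      where
      ht = fun (height s)
      split : Θ (c s i) ≡ S (c s i) ⊞ R (c s i)
      split = trans (hasSum-unique (prod (c s i)) (hasSum-cong pointwise (hasSum-add (hasSum-at 𝟎 (R (c s i))) (hasSum-at (c s i) (S (c s i)))))) (𝔽.+-comm _ _)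
        where
        -- `c s i` has height 1, whereas two nonzero parts in the cone have height at least 2
        -- together.
        zeros : ∀ a → a ≢ 𝟎 → a ≢ c s i → S a ⊠ R (c s i ⊝ a) ≡ 0ℚ
        zeros a n₀ n₁ with cone? s a | cone? s (c s i ⊝ a)
        ... | inj₂ (j , q) | _ = ⊠-zeroˡ (coneS j a q)
        ... | inj₁ _ | inj₂ (j , q) = ⊠-zeroʳ (coneR j _ q)
        ... | inj₁ ca | inj₁ cb = ⊥-elim (¬both (0≤-+ (height-pos s ca n₀) (height-pos s cb (λ z → n₁ (sym (⊝-≡𝟎 z)))))
                (subst Negative (sym (trans (cong (λ t → ht a ℤ.- 1ℤ ℤ.+ (t ℤ.- 1ℤ)) (trans (subᶠ (height s) (c s i) a) (cong (ℤ._- ht a) (height-c s i)))) (aux (ht a)))) 0≤-nat))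
          where
          aux : ∀ h → h ℤ.- 1ℤ ℤ.+ (1ℤ ℤ.- h ℤ.- 1ℤ) ≡ ℤ.- 1ℤ
          aux = solveℤ
        pointwise : ∀ a → at 𝟎 (R (c s i)) a ⊞ at (c s i) (S (c s i)) a ≡ summand S R (c s i) a
        pointwise a with 𝟎 ≟ᴸ a | c s i ≟ᴸ a
        ... | yes refl | yes z    = ⊥-elim (c≢𝟎 s i z)
        ... | yes refl | no _     = trans (𝔽.+-identityʳ _) (sym (summand-first S R (c s i) oneS))
        ... | no _     | yes refl = trans (𝔽.+-identityˡ _) (sym (summand-last S R (c s i) oneR))
        ... | no n0    | no nx    = trans (𝔽.+-identityˡ _) (sym (summand-zero S R (c s i) a (zeros a (n0 ∘ sym) (nx ∘ sym))))

  -- The red part gains E(y^(-β)) on the left, the green part loses E(y^β) on the right. Truncation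
  -- by `total` instead of a functional of the seed makes these formulas restrict from Q to C.
  redPart greenPart : L → (L → ℚ) → L → ℚ
  redPart   β S = actˡ (negateᶠ total) dilog (⊖ β) S
  greenPart β R = actʳ total dilog⁻¹ β R

  negateᶠ-total : ∀ {β : L} → 0≤ fun total β ℤ.- 1ℤ → 0≤ fun (negateᶠ total) (⊖ β) ℤ.- 1ℤ
  negateᶠ-total {β} h = subst 0≤_ (cong (ℤ._- 1ℤ) (sym (trans (cong ℤ.-_ (negᶠ (total {r}) β)) (ℤP.neg-involutive (fun total β))))) h

  -- The quotient of Θ by E(y^β) on the right is `S * R₁`. As `β` is green, `R₁` stays in the
  -- positive orthant; `S` lives in the negative one. So the two are apart and inherit the mutated
  -- cone from the quotient.
  state-step : ∀ {s S R} → State s S R → ∀ k → NonNeg (c s k) → State (mutateˢ s k) (redPart (c s k) S) (greenPart (c s k) R)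
  state-step {s} {S} {R} st k nn = state-cong (λ x → act-switch φ′ (negateᶠ total) (ω β′ x) dilog β′ x φ′β′ (negateᶠ-total {β} tβ) (proj₁ cones k) (negSupported-total negS))
      (λ x → act-switch φ total (ω x β) dilog⁻¹ β x φβ tβ (coneR k) (posSupported-total posR))
      record { Θ = Θ′ ; isDT = isDT′ ; coneS = A′.actˡ-cone dilog (proj₁ cones) ; coneR = proj₂ cones
             ; negS = λ i x q → act-supported φ′ (ω β′ x) dilog β′ (negateᶠ (lookupᶠ i)) (subst 0≤_ (sym (trans (cong ℤ.-_ (lookup-⊖ i β)) (ℤP.neg-involutive (lookup β i)))) (nn i)) (negS i) x q
             ; posR = posR₁
             ; oneS = A′.act-one (ω β′ 𝟎) dilog refl (proj₁ cones) oneS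
             ; oneR = act-one (ω 𝟎 β) dilog⁻¹ refl coneR oneR
             ; prod = product-actˡ φ′ β′ φ′β′ (proj₁ cones k) (proj₂ cones k) dilog prod₁ }
    where
    open State st
    open Quotients s k isDT using (β; φ; φβ; rightQ; actʳ-cone; act-one)
    open Transfer s k isDT
    tβ : 0≤ fun total β ℤ.- 1ℤ
    tβ = total-pos nn (c≢𝟎 s k)
    R₁ : L → ℚ
    R₁ = actʳ φ dilog⁻¹ β R
    posR₁ : PosSupported R₁
    posR₁ i x q = act-supported φ (ω x β) dilog⁻¹ β (lookupᶠ i) (nn i) (posR i) x q
    prod₁ : IsProduct S R₁ rightQ
    prod₁ = product-actʳ φ β φβ (coneS k) (coneR k) dilog⁻¹ prod
    apart : ∀ x → x ≢ 𝟎 → S x ≡ 0ℚ ⊎ R₁ x ≡ 0ℚ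
    apart x ne with scan (lookup x) | scan (λ i → ℤ.- lookup x i)
    ... | inj₂ (i , q) | _            = inj₂ (posR₁ i x q)
    ... | inj₁ _       | inj₂ (i , q) = inj₁ (negS i x q)
    ... | inj₁ p       | inj₁ q       = ⊥-elim (ne (nonNeg-nonPos p q))
    cones : ConeSupported s′ S × ConeSupported s′ R₁
    cones = factors-recone record { coneA = coneS ; coneB = actʳ-cone dilog⁻¹ coneR ; oneA = oneS
      ; oneB = act-one (ω 𝟎 β) dilog⁻¹ refl coneR oneR ; apart = apart ; prod = prod₁ }

  state-start : ∀ {Θ} → IsDT standard Θ → State standard unit Θ
  state-start {Θ} D = record { Θ = Θ ; isDT = D
    ; coneS = λ i → unit-supported (lookupᶠ i) ; coneR = IsDT.cone D
    ; negS = λ i → unit-supported (negateᶠ (lookupᶠ i)) ; posR = IsDT.cone D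
    ; oneS = unit-𝟎 ; oneR = IsDT.one D ; prod = λ x → hasSum-cong (pointwise x) (hasSum-at 𝟎 (Θ x)) }
    where
    pointwise : ∀ x a → at 𝟎 (Θ x) a ≡ summand unit Θ x a
    pointwise x a with 𝟎 ≟ᴸ a
    ... | yes refl = sym (summand-first unit Θ x unit-𝟎)
    ... | no ne    = sym (summand-zero unit Θ x a (⊠-zeroˡ (unit-off (ne ∘ sym))))

  -- If all c-vectors are nonpositive, so is the cone they span, and it meets the positive orthant
  -- only in 𝟎.
  green-exhausted : ∀ {s S R} → State s S R → (∀ i → NonPos (c s i)) → ∀ x → x ≢ 𝟎 → R x ≡ 0ℚ
  green-exhausted {s} {S} {R} st red x ne with R x ℚP.≟ 0ℚ
  ... | yes z = z
  ... | no nz = ⊥-elim (ne (nonNeg-nonPos (R-nonNeg nz) λ p → cone-nonneg s (negateᶠ (lookupᶠ p)) (λ i → red i p) (R-cone nz)))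
    where open State st

-- Restriction to a sublattice

data SplitFin (j m : ℕ) : Fin (j ℕ.+ m) → Set where
  left  : (a : Fin j) → SplitFin j m (a Fin.↑ˡ m)
  right : (b : Fin m) → SplitFin j m (j Fin.↑ʳ b)

splitFin : ∀ j {m} (i : Fin (j ℕ.+ m)) → SplitFin j m i
splitFin zero    i       = right i
splitFin (suc j) zero    = left zero
splitFin (suc j) (suc i) with splitFin j i
... | left a  = left (suc a)
... | right b = right b

↑ˡ≢↑ʳ : ∀ {j m} (a : Fin j) (b : Fin m) → a Fin.↑ˡ m ≢ j Fin.↑ʳ b
↑ˡ≢↑ʳ zero    b ()
↑ˡ≢↑ʳ (suc a) b h = ↑ˡ≢↑ʳ a b (FinP.suc-injective h)

module Embedding (j m : ℕ) where

  ι : Lattice m → Lattice (j ℕ.+ m)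
  ι x = 𝟎 {j} Vec.++ x

  π : Lattice (j ℕ.+ m) → Lattice m
  π y = Vec.tabulate (λ b → lookup y (j Fin.↑ʳ b))

  lookup-π : ∀ y b → lookup (π y) b ≡ lookup y (j Fin.↑ʳ b)
  lookup-π y b = VecP.lookup∘tabulate _ b

  lookup-ιˡ : ∀ x a → lookup (ι x) (a Fin.↑ˡ m) ≡ 0ℤ
  lookup-ιˡ x a = trans (VecP.lookup-++ˡ (𝟎 {j}) x a) (lookup-𝟎 a)

  lookup-ιʳ : ∀ x b → lookup (ι x) (j Fin.↑ʳ b) ≡ lookup x b
  lookup-ιʳ x b = VecP.lookup-++ʳ (𝟎 {j}) x b

  ext-split : ∀ {x y : Lattice (j ℕ.+ m)} → (∀ a → lookup x (a Fin.↑ˡ m) ≡ lookup y (a Fin.↑ˡ m)) →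
    (∀ b → lookup x (j Fin.↑ʳ b) ≡ lookup y (j Fin.↑ʳ b)) → x ≡ y
  ext-split {x} {y} h k = lattice-ext go
    where
    go : ∀ i → lookup x i ≡ lookup y i
    go i with splitFin j {m} i
    ... | left a  = h a
    ... | right b = k b

  π-ι : ∀ x → π (ι x) ≡ x
  π-ι x = lattice-ext λ b → trans (lookup-π (ι x) b) (lookup-ιʳ x b)

  ι-π : ∀ y → (∀ a → lookup y (a Fin.↑ˡ m) ≡ 0ℤ) → ι (π y) ≡ y
  ι-π y h = ext-split (λ a → trans (lookup-ιˡ (π y) a) (sym (h a))) (λ b → trans (lookup-ιʳ (π y) b) (lookup-π y b))

  ι-injective : ∀ {x y} → ι x ≡ ι y → x ≡ y
  ι-injective {x} {y} h = trans (sym (π-ι x)) (trans (cong π h) (π-ι y))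

  ι-⊕ : ∀ x y → ι (x ⊕ y) ≡ ι x ⊕ ι y
  ι-⊕ x y = ext-split (λ a → trans (lookup-ιˡ (x ⊕ y) a) (sym (trans (lookup-⊕ _ (ι x) (ι y)) (cong₂ ℤ._+_ (lookup-ιˡ x a) (lookup-ιˡ y a)))))
    (λ b → trans (lookup-ιʳ (x ⊕ y) b) (trans (lookup-⊕ b x y) (sym (trans (lookup-⊕ _ (ι x) (ι y)) (cong₂ ℤ._+_ (lookup-ιʳ x b) (lookup-ιʳ y b))))))

  ι-⊖ : ∀ x → ι (⊖ x) ≡ ⊖ ι x
  ι-⊖ x = ext-split (λ a → trans (lookup-ιˡ (⊖ x) a) (sym (trans (lookup-⊖ _ (ι x)) (cong ℤ.-_ (lookup-ιˡ x a)))))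
    (λ b → trans (lookup-ιʳ (⊖ x) b) (trans (lookup-⊖ b x) (sym (trans (lookup-⊖ _ (ι x)) (cong ℤ.-_ (lookup-ιʳ x b))))))

  ι-⊝ : ∀ x y → ι (x ⊝ y) ≡ ι x ⊝ ι y
  ι-⊝ x y = trans (ι-⊕ x (⊖ y)) (cong (ι x ⊕_) (ι-⊖ y))

  ι-𝟎 : ι 𝟎 ≡ 𝟎
  ι-𝟎 = ext-split (λ a → trans (lookup-ιˡ 𝟎 a) (sym (lookup-𝟎 (a Fin.↑ˡ m)))) (λ b → trans (lookup-ιʳ 𝟎 b) (trans (lookup-𝟎 b) (sym (lookup-𝟎 (j Fin.↑ʳ b)))))

  ι-· : ∀ l x → ι (l · x) ≡ l · ι x
  ι-· zero    x = ι-𝟎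
  ι-· (suc l) x = trans (ι-⊕ x (l · x)) (cong (ι x ⊕_) (ι-· l x))

  ι-≢𝟎 : ∀ {x} → x ≢ 𝟎 → ι x ≢ 𝟎
  ι-≢𝟎 ne h = ne (ι-injective (trans h (sym ι-𝟎)))

  _∘ι : Additive (j ℕ.+ m) → Additive m
  φ ∘ι = record { fun = λ x → fun φ (ι x) ; add = λ x y → trans (cong (fun φ) (ι-⊕ x y)) (add φ (ι x) (ι y)) }

  _∘π : Additive m → Additive (j ℕ.+ m)
  φ ∘π = record { fun = λ y → fun φ (π y) ; add = λ x y → trans (cong (fun φ) (lattice-ext λ b → trans (lookup-π (x ⊕ y) b)
    (trans (lookup-⊕ _ x y) (sym (trans (lookup-⊕ b (π x) (π y)) (cong₂ ℤ._+_ (lookup-π x b) (lookup-π y b))))))) (add φ (π x) (π y)) }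

  total-ι : ∀ x → fun total (ι x) ≡ fun total x
  total-ι = sum-append j
    where
    sum-append : ∀ k x → sumℤ (lookup (𝟎 {k} Vec.++ x)) ≡ sumℤ (lookup x)
    sum-append zero    x = refl
    sum-append (suc k) x = trans (ℤP.+-identityˡ _) (sum-append k x)

  nonNeg-ι : ∀ {x} → NonNeg (ι x) → NonNeg x
  nonNeg-ι {x} h b = subst 0≤_ (lookup-ιʳ x b) (h (j Fin.↑ʳ b))

  nonPos-ι : ∀ {x} → NonPos (ι x) → NonPos x
  nonPos-ι {x} h b = subst (λ z → 0≤ ℤ.- z) (lookup-ιʳ x b) (h (j Fin.↑ʳ b))

  image? : ∀ y → (ι (π y) ≡ y) ⊎ ∃ λ a → lookup y (a Fin.↑ˡ m) ≢ 0ℤ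
  image? y with FinP.any? (λ a → ¬? (lookup y (a Fin.↑ˡ m) ℤP.≟ 0ℤ))
  ... | yes (a , ne) = inj₂ (a , ne)
  ... | no none      = inj₁ (ι-π y λ a → case lookup y (a Fin.↑ˡ m) ℤP.≟ 0ℤ of λ { (yes z) → z ; (no nz) → ⊥-elim (none (a , nz)) })

module Restriction (j m : ℕ) (WQ : SkewForm (j ℕ.+ m)) (WC : SkewForm m)
  (compat : ∀ x y → SkewForm.ω WQ (Embedding.ι j m x) (Embedding.ι j m y) ≡ SkewForm.ω WC x y) where

  open Embedding j m
  module Q = GreenPaths WQ
  module C = GreenPaths WC

  ≢0-pos : ∀ {z} → z ≢ 0ℤ → 0≤ z → Negative (ℤ.- z)
  ≢0-pos {+ zero}  ne _ = ⊥-elim (ne refl)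
  ≢0-pos {+ suc n} ne _ = 0≤-nat
  ≢0-pos { -[1+ n ]} ne ()

  -- Two degrees with sum in the sublattice have opposite coordinates outside C. Both factors live
  -- in the positive orthant, so these coordinates are 0 in every contributing term.
  restrict-product : ∀ {A B Θ} → Q.ConeSupported Q.standard A → Q.ConeSupported Q.standard B → Q.IsProduct A B Θ → C.IsProduct (A ∘ ι) (B ∘ ι) (Θ ∘ ι)
  restrict-product {A} {B} cA cB P x = hasSum-cong pointwise (hasSum-pull ι π π-ι off (P (ι x)))
    where
    pointwise : ∀ a → Q.summand A B (ι x) (ι a) ≡ C.summand (A ∘ ι) (B ∘ ι) x a
    pointwise a = trans (cong (λ z → (twist (Q.ω (ι a) z) ⊠ A (ι a)) ⊠ B z) (sym (ι-⊝ x a)))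
      (cong (λ t → (twist t ⊠ A (ι a)) ⊠ B (ι (x ⊝ a))) (compat a (x ⊝ a)))
    off : ∀ a → ι (π a) ≢ a → Q.summand A B (ι x) a ≡ 0ℚ
    off a ne with image? a
    ... | inj₁ h = ⊥-elim (ne h)
    ... | inj₂ (p , nz) = Q.summand-zero A B (ι x) a (zero-at (sign? (lookup a (p Fin.↑ˡ m))))
      where
      zero-at : 0≤ lookup a (p Fin.↑ˡ m) ⊎ Negative (lookup a (p Fin.↑ˡ m)) → A a ⊠ B (ι x ⊝ a) ≡ 0ℚ
      zero-at (inj₂ q) = ⊠-zeroˡ (cA (p Fin.↑ˡ m) a q)
      zero-at (inj₁ q) = ⊠-zeroʳ (cB (p Fin.↑ˡ m) (ι x ⊝ a)
        (subst Negative (sym (trans (subᶠ (lookupᶠ (p Fin.↑ˡ m)) (ι x) a) (trans (cong (ℤ._- lookup a (p Fin.↑ˡ m)) (lookup-ιˡ x p)) (ℤP.+-identityˡ (ℤ.- lookup a (p Fin.↑ˡ m)))))) (≢0-pos nz q)))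

  restrict-cone : ∀ {f} → Q.ConeSupported Q.standard f → C.ConeSupported C.standard (f ∘ ι)
  restrict-cone b i x q = b (j Fin.↑ʳ i) (ι x) (subst Negative (sym (lookup-ιʳ x i)) q)

  ι-e : ∀ b → ι (C.e b) ≡ Q.e (j Fin.↑ʳ b)
  ι-e b = ext-split (λ a → trans (lookup-ιˡ (C.e b) a) (sym (Q.lookup-e-off _ _ (↑ˡ≢↑ʳ a b)))) at-right
    where
    at-right : ∀ i → lookup (ι (C.e b)) (j Fin.↑ʳ i) ≡ lookup (Q.e (j Fin.↑ʳ b)) (j Fin.↑ʳ i)
    at-right i with i Fin.≟ b
    ... | yes refl = trans (lookup-ιʳ (C.e b) b) (trans (C.lookup-e b) (sym (Q.lookup-e (j Fin.↑ʳ b))))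
    ... | no ne    = trans (lookup-ιʳ (C.e b) i) (trans (C.lookup-e-off i b ne) (sym (Q.lookup-e-off _ _ (λ h → ne (FinP.↑ʳ-injective j i b h)))))

  restrict-stability : ∀ {n} → Q.Stability (ι n) → C.Stability n
  restrict-stability {n} S = record
    { sgn     = λ x → sgn (ι x)
    ; sgn-⊖   = λ a → trans (cong sgn (ι-⊖ a)) (sgn-⊖ (ι a))
    ; pos+pos = λ {a} {b} p q → trans (cong sgn (ι-⊕ a b)) (pos+pos p q)
    ; pos+nul = λ {a} {b} p q → trans (cong sgn (ι-⊕ a b)) (pos+nul p q)
    ; nul+nul = λ {a} {b} p q → trans (cong sgn (ι-⊕ a b)) (nul+nul p q)
    ; sgn-n   = sgn-n
    ; aligned = λ a p → subst 0≤_ (compat n a) (aligned (ι a) p)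
    ; line    = λ a p ne φ h → trans (cong (fun φ) (sym (π-ι n))) (line (ι a) p (ι-≢𝟎 ne) (φ ∘π) (trans (cong (fun φ) (π-ι a)) h)) }
    where open Q.Stability S

  -- The stability condition `ω (ι n)` restricts to `ω n` by `compat`; its sign function, the
  -- factorization and the value at `n` restrict with it.
  restrict-isDT : ∀ {Θ} → Q.IsDT Q.standard Θ → C.IsDT C.standard (Θ ∘ ι)
  restrict-isDT {Θ} D = record
    { cone     = restrict-cone cone
    ; one      = trans (cong Θ ι-𝟎) one
    ; simple   = λ b l → trans (cong Θ (trans (ι-· l (C.e b)) (cong (l ·_) (ι-e b)))) (simple (j Fin.↑ʳ b) l)
    ; incoming = incoming′ }
    where
    open Q.IsDT D
    incoming′ : ∀ n → n ≢ 𝟎 → Σ (C.Factorization C.standard n (Θ ∘ ι)) λ F → C.Simple C.standard n ⊎ C.Factorization.B F n ≡ 0ℚ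
    incoming′ n ne with incoming (ι n) (ι-≢𝟎 ne)
    ... | F , val = record
          { stability = restrict-stability stability ; A = A ∘ ι ; B = B ∘ ι
          ; coneA = restrict-cone coneA ; coneB = restrict-cone coneB
          ; oneA = trans (cong A ι-𝟎) oneA ; oneB = trans (cong B ι-𝟎) oneB
          ; posA = λ x ne → posA (ι x) (ι-≢𝟎 ne) ; posB = λ x → posB (ι x)
          ; prod = restrict-product coneA coneB prod } , value′ val
      where
      open Q.Factorization F
      value′ : Q.Simple Q.standard (ι n) ⊎ B (ι n) ≡ 0ℚ → C.Simple C.standard n ⊎ B (ι n) ≡ 0ℚ
      value′ (inj₂ z) = inj₂ z
      value′ (inj₁ (i , l , h)) with splitFin j {m} i
      ... | right b = inj₁ (b , l , ι-injective (trans h (sym (trans (ι-· l (C.e b)) (cong (l ·_) (ι-e b))))))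
      ... | left a  = ⊥-elim (ι-≢𝟎 ne (trans h (cong (_· Q.e (a Fin.↑ˡ m)) (ℤP.+-injective (trans (sym (Q.lookup-·e l (a Fin.↑ˡ m)))
                        (trans (cong (λ x → lookup x (a Fin.↑ˡ m)) (sym h)) (lookup-ιˡ n a)))))))

  act-ι : ∀ κ κ′ → κ ≡ κ′ → (φ : Additive (j ℕ.+ m)) (ψ : Additive m) → (∀ x → fun φ (ι x) ≡ fun ψ x) → ∀ g d (f : Lattice (j ℕ.+ m) → ℚ) x →
    act φ κ g (ι d) f (ι x) ≡ act ψ κ′ g d (f ∘ ι) x
  act-ι κ .κ refl φ ψ h g d f x = trans (cong (λ z → sumN (suc ∣ z ∣) (term κ g (ι d) f (ι x))) (h x))
    (sumN-cong (suc ∣ fun ψ x ∣) λ l → cong (λ z → (g l ⊠ twist (κ ℤ.* + l)) ⊠ f z) (trans (cong (ι x ⊝_) (sym (ι-· l d))) (sym (ι-⊝ x (l · d)))))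

  module _ {s : Q.Seed} {t : C.Seed} {S R : Lattice (j ℕ.+ m) → ℚ} (sq : Q.State s S R) (sc : C.State t (S ∘ ι) (R ∘ ι)) where

    private
      module SQ = Q.State sq
      module SC = C.State sc

    -- A c-vector of C is in the support of the restricted `S` or `R`, and these series are also
    -- supported in the cone of `s`. The shared series are the only link between the two seeds.
    ι-c-cone : ∀ a → Q.InCone s (ι (C.c t a))
    ι-c-cone a with C.c-supported sc a
    ... | inj₁ h = SQ.S-cone h
    ... | inj₂ h = SQ.R-cone h

    -- A c-vector of Q inside the sublattice is one of the c-vectors of C, because the cone of t lies
    -- in that of s, where c-vectors are indecomposable.
    matching : ∀ k {β} → Q.c s k ≡ ι β → NonNeg (Q.c s k) → ∃ λ b → C.c t b ≡ β
    matching k {β} eq nn = find (scan (λ a → ℤ.- n a))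
      where
      β≢𝟎 : β ≢ 𝟎
      β≢𝟎 h = Q.c≢𝟎 s k (trans eq (trans (cong ι h) ι-𝟎))
      -- A nonzero nonnegative c-vector is not in the support of `S`, so it has to be in that of
      -- `R`.
      S≡0 : S (Q.c s k) ≡ 0ℚ
      S≡0 with S (Q.c s k) ℚP.≟ 0ℚ
      ... | yes z = z
      ... | no nz = ⊥-elim (Q.c≢𝟎 s k (nonNeg-nonPos nn (SQ.S-nonPos nz)))
      R≢0 : R (ι β) ≢ 0ℚ
      R≢0 h with Q.c-supported sq k
      ... | inj₁ u = u S≡0
      ... | inj₂ u = u (trans (cong R eq) h)
      βcone : C.InCone t β
      βcone = SC.R-cone R≢0
      n : Fin m → ℤ
      n a = fun (C.γ t a) β
      ht : Additive m
      ht = (Q.height s) ∘ι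
      ht-c : ∀ a → 0≤ fun ht (C.c t a) ℤ.- 1ℤ
      ht-c a = Q.height-pos s (ι-c-cone a) (ι-≢𝟎 (C.c≢𝟎 t a))
      ht-β : fun ht β ≡ 1ℤ
      ht-β = trans (cong (fun (Q.height s)) (sym eq)) (Q.height-c s k)
      find : (∀ a → 0≤ ℤ.- n a) ⊎ (∃ λ b → Negative (ℤ.- n b)) → ∃ λ b → C.c t b ≡ β
      find (inj₁ h) = ⊥-elim (β≢𝟎 (C.complete t β λ a → 0≤-antisym (βcone a) (h a)))
      find (inj₂ (b , q)) = b , sym (C.⊝-≡𝟎 (y≡𝟎 (y ≟ᴸ 𝟎)))
        where
        y : Lattice m
        y = β ⊝ C.c t b
        y-cone : C.InCone t y
        y-cone a with a Fin.≟ b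
        ... | yes refl = subst 0≤_ (trans (aux (n a)) (sym (trans (subᶠ (C.γ t a) β (C.c t a)) (cong (λ z → n a ℤ.- z) (C.γ-diag t a))))) q
          where
          aux : ∀ z → ℤ.- 1ℤ ℤ.- ℤ.- z ≡ z ℤ.- 1ℤ
          aux = solveℤ
        ... | no ne    = subst 0≤_ (sym (trans (subᶠ (C.γ t a) β (C.c t b)) (trans (cong (λ z → n a ℤ.- z) (C.γ-off t a b ne)) (ℤP.+-identityʳ (n a))))) (βcone a)
        ιy-cone : Q.InCone s (ι y)
        ιy-cone i = C.cone-nonneg t ((Q.γ s i) ∘ι) (λ a → ι-c-cone a i) y-cone
        y≡𝟎 : Dec (y ≡ 𝟎) → y ≡ 𝟎
        y≡𝟎 (yes z) = z
        y≡𝟎 (no nz) = ⊥-elim (¬both (0≤-+ (Q.height-pos s ιy-cone (ι-≢𝟎 nz)) (ht-c b))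
          (subst Negative (sym (trans (cong (λ z → z ℤ.- 1ℤ ℤ.+ (fun ht (C.c t b) ℤ.- 1ℤ)) (trans (subᶠ ht β (C.c t b)) (cong (ℤ._- fun ht (C.c t b)) ht-β))) (aux (fun ht (C.c t b))))) 0≤-nat))
          where
          aux : ∀ h → 1ℤ ℤ.- h ℤ.- 1ℤ ℤ.+ (h ℤ.- 1ℤ) ≡ ℤ.- 1ℤ
          aux = solveℤ

    -- Translation by a nonzero multiple of `β` moves the coordinate at `a`, which is 0 on the
    -- sublattice, to the side where `S` or `R` vanishes. Only the untranslated term is left, so the
    -- restricted series do not change.
    outside : ∀ β a → lookup β (a Fin.↑ˡ m) ≢ 0ℤ → NonNeg β → C.State t (Q.redPart β S ∘ ι) (Q.greenPart β R ∘ ι)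
    outside β a nz nn = C.state-cong
      (λ x → sym (act-head (negateᶠ total) (Q.ω (⊖ β) (ι x)) dilog (⊖ β) {S} (ι x) refl (λ l → SQ.negS (a Fin.↑ˡ m) _ (up x l))))
      (λ x → sym (act-head total (Q.ω (ι x) β) dilog⁻¹ β {R} (ι x) refl (λ l → SQ.posR (a Fin.↑ˡ m) _ (down x l)))) sc
      where
      i = a Fin.↑ˡ m
      βi : 0≤ lookup β i ℤ.- 1ℤ
      βi = subst 0≤_ (aux (lookup β i)) (≢0-pos nz (nn i))
        where
        aux : ∀ z → ℤ.- 1ℤ ℤ.- ℤ.- z ≡ z ℤ.- 1ℤ
        aux = solveℤ
      down : ∀ x l → Negative (lookup (ι x ⊝ suc l · β) i)
      down x l = subst Negative (sym (trans (sub-mulᶠ (lookupᶠ i) (ι x) (suc l) β) (cong (ℤ._- + suc l ℤ.* lookup β i) (lookup-ιˡ x a))))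
        (subst 0≤_ (aux (+ l) (lookup β i)) (0≤-+ βi (0≤-* {+ l} 0≤-nat (nn i))))
        where
        aux : ∀ l b → b ℤ.- 1ℤ ℤ.+ l ℤ.* b ≡ ℤ.- 1ℤ ℤ.- (0ℤ ℤ.- (1ℤ ℤ.+ l) ℤ.* b)
        aux = solveℤ
      up : ∀ x l → Negative (ℤ.- lookup (ι x ⊝ suc l · (⊖ β)) i)
      up x l = subst (λ z → Negative (ℤ.- z)) (sym (trans (sub-mulᶠ (lookupᶠ i) (ι x) (suc l) (⊖ β)) (cong₂ (λ p q → p ℤ.- + suc l ℤ.* q) (lookup-ιˡ x a) (lookup-⊖ i β))))
        (subst 0≤_ (aux (+ l) (lookup β i)) (0≤-+ βi (0≤-* {+ l} 0≤-nat (nn i))))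
        where
        aux : ∀ l b → b ℤ.- 1ℤ ℤ.+ l ℤ.* b ≡ ℤ.- 1ℤ ℤ.- ℤ.- (0ℤ ℤ.- (1ℤ ℤ.+ l) ℤ.* ℤ.- b)
        aux = solveℤ

    inside : ∀ b → NonNeg (C.c t b) → C.State (C.mutateˢ t b) (Q.redPart (ι (C.c t b)) S ∘ ι) (Q.greenPart (ι (C.c t b)) R ∘ ι)
    inside b nn = C.state-cong
      (λ x → sym (trans (cong (λ d → act (negateᶠ total) (Q.ω d (ι x)) dilog d S (ι x)) (sym (ι-⊖ β)))
         (act-ι (Q.ω (ι (⊖ β)) (ι x)) (C.ω (⊖ β) x) (compat (⊖ β) x) (negateᶠ total) (negateᶠ total) (λ z → cong ℤ.-_ (total-ι z)) dilog (⊖ β) S x)))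
      (λ x → sym (act-ι (Q.ω (ι x) (ι β)) (C.ω x β) (compat x β) total total total-ι dilog⁻¹ β R x)) (C.state-step sc b nn)
      where β = C.c t b

    -- `green-exhausted` leaves nothing of `R` but its value at 𝟎, so all c-vectors of C are in the
    -- support of `S`.
    all-red : (∀ i → NonPos (Q.c s i)) → ∀ a → NonPos (C.c t a)
    all-red h a with C.c-supported sc a
    ... | inj₁ u = nonPos-ι (SQ.S-nonPos u)
    ... | inj₂ u = ⊥-elim (u (Q.green-exhausted sq h _ (ι-≢𝟎 (C.c≢𝟎 t a))))

  -- C stands still whenever the c-vector mutated in Q leaves the sublattice; the invariant is that
  -- the series of C are the restrictions of those of Q.
  restrict-path : ∀ {s t S R} → Q.State s S R → C.State t (S ∘ ι) (R ∘ ι) → ∀ ks → Q.GreenPath (Q.c s) ks → ∃ λ ks′ → C.GreenPath (C.c t) ks′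
  restrict-path sq sc [] red = [] , all-red sq sc red
  restrict-path {s} {t} {S} {R} sq sc (k ∷ ks) (nn , p) with image? (Q.c s k)
  ... | inj₂ (a , nz) = restrict-path (Q.state-step sq k nn) (outside sq sc (Q.c s k) a nz nn) ks p
  ... | inj₁ h with matching sq sc k (sym h) nn
  ... | b , eb = b ∷ proj₁ rest , nnb , proj₂ rest
    where
    ιb : ι (C.c t b) ≡ Q.c s k
    ιb = trans (cong ι eb) h
    nnb : NonNeg (C.c t b)
    nnb = nonNeg-ι (subst NonNeg (sym ιb) nn)
    rest : ∃ λ ks′ → C.GreenPath (C.c (C.mutateˢ t b)) ks′
    rest = restrict-path (Q.state-step sq k nn)
      (subst (λ β → C.State (C.mutateˢ t b) (Q.redPart β S ∘ ι) (Q.greenPart β R ∘ ι)) ιb (inside sq sc b nnb)) ks p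

  restrict-green : ∀ ks → Q.GreenPath Q.e ks → ∃ λ ks′ → C.GreenPath C.e ks′
  restrict-green ks p = restrict-path (Q.state-start Q.dt-isDT)
    (C.state-cong (λ x → sym (unit-ι x)) (λ _ → refl) (C.state-start (restrict-isDT Q.dt-isDT))) ks p
    where
    unit-ι : ∀ x → unit (ι x) ≡ unit x
    unit-ι x with x ≟ᴸ 𝟎
    ... | yes refl = trans (cong unit ι-𝟎) (trans unit-𝟎 (sym unit-𝟎))
    ... | no ne    = trans (unit-off (ι-≢𝟎 ne)) (sym (unit-off ne))

-- Ice quivers and c-vectors

sumℤ-scale : ∀ {n} k (a : Fin n → ℤ) → sumℤ (λ i → k ℤ.* a i) ≡ k ℤ.* sumℤ a
sumℤ-scale {zero}  k a = sym (ℤP.*-zeroʳ k)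
sumℤ-scale {suc n} k a = trans (cong (λ t → k ℤ.* a zero ℤ.+ t) (sumℤ-scale k (a ∘ suc))) (sym (ℤP.*-distribˡ-+ k (a zero) _))

sumℤ-swap : ∀ {m n} (a : Fin m → Fin n → ℤ) → sumℤ (λ i → sumℤ (a i)) ≡ sumℤ (λ k → sumℤ (λ i → a i k))
sumℤ-swap {zero} {n} a = sym (sumℤ-zero {n} {λ _ → 0ℤ} (λ _ → refl))
sumℤ-swap {suc m} a = trans (cong (λ t → sumℤ (a zero) ℤ.+ t) (sumℤ-swap (a ∘ suc))) (sym (sumℤ-add (a zero) (λ k → sumℤ (λ i → a (suc i) k))))

sumℤ-append : ∀ j {m} (a : Fin (j ℕ.+ m) → ℤ) → sumℤ a ≡ sumℤ (λ i → a (i Fin.↑ˡ m)) ℤ.+ sumℤ (λ i → a (j Fin.↑ʳ i))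
sumℤ-append zero    a = sym (ℤP.+-identityˡ _)
sumℤ-append (suc j) a = trans (cong (λ t → a zero ℤ.+ t) (sumℤ-append j (a ∘ suc))) (sym (ℤP.+-assoc (a zero) _ _))

module _ {n : ℕ} (Q : Quiver n) where

  exchange : Fin n → Fin n → ℤ
  exchange i k = + arr Q i k ℤ.- + arr Q k i

  exchange-skew : ∀ i k → exchange i k ≡ ℤ.- exchange k i
  exchange-skew i k = aux (+ arr Q i k) (+ arr Q k i)
    where
    aux : ∀ p q → p ℤ.- q ≡ ℤ.- (q ℤ.- p)
    aux = solveℤ

  opaque
    row : Lattice n → Fin n → ℤ
    row y i = sumℤ (λ k → exchange i k ℤ.* lookup y k)
    eulerω : Lattice n → Lattice n → ℤ
    eulerω x y = sumℤ (λ i → lookup x i ℤ.* row y i)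
    eulerω-add : ∀ x y z → eulerω (x ⊕ y) z ≡ eulerω x z ℤ.+ eulerω y z
    eulerω-add x y z = trans (sumℤ-cong λ i → trans (cong (ℤ._* row z i) (lookup-⊕ i x y)) (ℤP.*-distribʳ-+ (row z i) (lookup x i) (lookup y i)))
      (sumℤ-add (λ i → lookup x i ℤ.* row z i) (λ i → lookup y i ℤ.* row z i))
    eulerω-skew : ∀ x y → eulerω x y ≡ ℤ.- eulerω y x
    eulerω-skew x y = begin
      sumℤ (λ i → lookup x i ℤ.* row y i)
        ≡⟨ sumℤ-cong (λ i → sym (sumℤ-scale (lookup x i) (λ k → exchange i k ℤ.* lookup y k))) ⟩
      sumℤ (λ i → sumℤ (λ k → lookup x i ℤ.* (exchange i k ℤ.* lookup y k)))
        ≡⟨ sumℤ-swap (λ i k → lookup x i ℤ.* (exchange i k ℤ.* lookup y k)) ⟩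
      sumℤ (λ k → sumℤ (λ i → lookup x i ℤ.* (exchange i k ℤ.* lookup y k)))
        ≡⟨ sumℤ-cong (λ k → trans (sumℤ-cong (λ i → trans (cong (λ t → lookup x i ℤ.* (t ℤ.* lookup y k)) (exchange-skew i k)) (aux (lookup x i) (exchange k i) (lookup y k))))
             (trans (sumℤ-scale (ℤ.- lookup y k) (λ i → exchange k i ℤ.* lookup x i)) (sym (aux′ (lookup y k) (row x k))))) ⟩
      sumℤ (λ k → ℤ.- 1ℤ ℤ.* (lookup y k ℤ.* row x k))
        ≡⟨ trans (sumℤ-scale (ℤ.- 1ℤ) (λ k → lookup y k ℤ.* row x k)) (aux″ (eulerω y x)) ⟩
      ℤ.- eulerω y x ∎
      where
      open ≡-Reasoning
      aux : ∀ a b c → a ℤ.* (ℤ.- b ℤ.* c) ≡ ℤ.- c ℤ.* (b ℤ.* a)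
      aux = solveℤ
      aux′ : ∀ a b → ℤ.- 1ℤ ℤ.* (a ℤ.* b) ≡ ℤ.- a ℤ.* b
      aux′ = solveℤ
      aux″ : ∀ a → ℤ.- 1ℤ ℤ.* a ≡ ℤ.- a
      aux″ = solveℤ

    eulerω-rows : ∀ x y → eulerω x y ≡ sumℤ (λ i → lookup x i ℤ.* sumℤ (λ k → exchange i k ℤ.* lookup y k))
    eulerω-rows x y = refl

  eulerForm : SkewForm n
  eulerForm = record { ω = eulerω ; ω-add = eulerω-add ; skew = eulerω-skew ; alt = λ x → self-negative (eulerω-skew x x) }
    where
    self-negative : ∀ {z} → z ≡ ℤ.- z → z ≡ 0ℤ
    self-negative {+ zero}  _ = refl
    self-negative {+ suc _} ()
    self-negative { -[1+ _ ]} ()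

  open GreenPaths eulerForm

  ω-eʳ : ∀ x k → ω x (e k) ≡ sumℤ (λ i → lookup x i ℤ.* exchange i k)
  ω-eʳ x k = trans (eulerω-rows x (e k)) (sumℤ-cong λ i → cong (lookup x i ℤ.*_) (trans (sumℤ-single {a = λ l → exchange i l ℤ.* lookup (e k) l} k
    (λ l ne → trans (cong (exchange i l ℤ.*_) (lookup-e-off l k ne)) (ℤP.*-zeroʳ (exchange i l))))
    (trans (cong (exchange i k ℤ.*_) (lookup-e k)) (ℤP.*-identityʳ _))))

  ω-e-e : ∀ i k → ω (e i) (e k) ≡ exchange i k
  ω-e-e i k = trans (ω-eʳ (e i) k) (trans (sumℤ-single {a = λ l → lookup (e i) l ℤ.* exchange l k} i
    (λ l ne → trans (cong (ℤ._* exchange l k) (lookup-e-off l i ne)) (ℤP.*-zeroˡ (exchange l k))))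
    (trans (cong (ℤ._* exchange i k) (lookup-e i)) (ℤP.*-identityˡ _)))

  -- By `reduced`, signed entries lose no information about arrow counts. By `b-entry` the exchange
  -- matrix is the Gram matrix of the c-vectors, so these determine all arrows at non-frozen
  -- vertices.
  record Encodes (A : IceQuiver n) (cs : Fin n → Lattice n) : Set where
    field
      reduced : ∀ x y → A x y ≡ 0 ⊎ A y x ≡ 0
      c-entry : ∀ i f → lookup (cs i) f ≡ + A (inj₁ i) (inj₂ f) ℤ.- + A (inj₂ f) (inj₁ i)
      b-entry : ∀ i k → ω (cs i) (cs k) ≡ + A (inj₁ i) (inj₁ k) ℤ.- + A (inj₁ k) (inj₁ i)

  framed-encodes : Encodes (framed Q) e
  framed-encodes = record { reduced = red ; c-entry = ce ; b-entry = ω-e-e }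
    where
    red : ∀ x y → framed Q x y ≡ 0 ⊎ framed Q y x ≡ 0
    red (inj₁ i) (inj₁ k) = no2cyc Q i k
    red (inj₁ i) (inj₂ f) = inj₂ refl
    red (inj₂ f) (inj₁ i) = inj₁ refl
    red (inj₂ f) (inj₂ g) = inj₁ refl
    ce : ∀ i f → lookup (e i) f ≡ + indic (i Fin.≟ f) ℤ.- 0ℤ
    ce i f with i Fin.≟ f
    ... | yes refl = lookup-e i
    ... | no ne    = lookup-e-off f i (ne ∘ sym)

  module _ {A : IceQuiver n} {cs : Fin n → Lattice n} (E : Encodes A cs) where
    open Encodes E

    green⇒ : ∀ {k} → Green A k → NonNeg (cs k)
    green⇒ {k} g f = subst 0≤_ (sym (trans (c-entry k f) (trans (cong (λ t → + A (inj₁ k) (inj₂ f) ℤ.- + t) (g f)) (ℤP.+-identityʳ _)))) 0≤-nat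

    green⇐ : ∀ {k} → NonNeg (cs k) → Green A k
    green⇐ {k} h f with reduced (inj₂ f) (inj₁ k)
    ... | inj₁ z = z
    ... | inj₂ z = nonpos (subst 0≤_ (trans (c-entry k f) (trans (cong (λ t → + t ℤ.- + A (inj₂ f) (inj₁ k)) z) (ℤP.+-identityˡ _))) (h f))
      where
      nonpos : ∀ {a} → 0≤ ℤ.- + a → a ≡ 0
      nonpos {zero} _ = refl
      nonpos {suc a} ()

    red⇒ : ∀ {k} → Red A k → NonPos (cs k)
    red⇒ {k} g f = subst (λ z → 0≤ ℤ.- z) (sym (trans (c-entry k f) (trans (cong (λ t → + t ℤ.- + A (inj₂ f) (inj₁ k)) (g f)) (ℤP.+-identityˡ (ℤ.- + A (inj₂ f) (inj₁ k))))))
      (subst 0≤_ (sym (ℤP.neg-involutive (+ A (inj₂ f) (inj₁ k)))) 0≤-nat)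

    red⇐ : ∀ {k} → NonPos (cs k) → Red A k
    red⇐ {k} h f with reduced (inj₁ k) (inj₂ f)
    ... | inj₁ z = z
    ... | inj₂ z = nonpos (subst (λ y → 0≤ ℤ.- y) (trans (c-entry k f) (trans (cong (λ t → + A (inj₁ k) (inj₂ f) ℤ.- + t) z) (ℤP.+-identityʳ _))) (h f))
      where
      nonpos : ∀ {a} → 0≤ ℤ.- + a → a ≡ 0
      nonpos {zero} _ = refl
      nonpos {suc a} ()

    module _ (k : Fin n) (g : Green A k) where

      private
        v : Fin n → Vtx n
        v = inj₁

        ∸-diff : ∀ p q → + (p ℕ.∸ q) ℤ.- + (q ℕ.∸ p) ≡ + p ℤ.- + q
        ∸-diff zero    zero    = refl
        ∸-diff zero    (suc q) = refl
        ∸-diff (suc p) zero    = refl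
        ∸-diff (suc p) (suc q) = trans (∸-diff p q) (aux (+ p) (+ q))
          where
          aux : ∀ p q → p ℤ.- q ≡ 1ℤ ℤ.+ p ℤ.- (1ℤ ℤ.+ q)
          aux = solveℤ

        cancel-diff : ∀ x y → + composeCancel k A x y ℤ.- + composeCancel k A y x ≡
          (+ A x y ℤ.- + A y x) ℤ.+ (+ A x (v k) ℤ.* + A (v k) y ℤ.- + A y (v k) ℤ.* + A (v k) x)
        cancel-diff x y = trans (∸-diff (A x y ℕ.+ A x (v k) ℕ.* A (v k) y) (A y x ℕ.+ A y (v k) ℕ.* A (v k) x))
          (trans (cong₂ (λ p q → + A x y ℤ.+ p ℤ.- (+ A y x ℤ.+ q)) (ℤP.pos-* (A x (v k)) (A (v k) y)) (ℤP.pos-* (A y (v k)) (A (v k) x)))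
            (aux (+ A x y) (+ A y x) (+ A x (v k) ℤ.* + A (v k) y) (+ A y (v k) ℤ.* + A (v k) x)))
          where
          aux : ∀ a b p q → a ℤ.+ p ℤ.- (b ℤ.+ q) ≡ (a ℤ.- b) ℤ.+ (p ℤ.- q)
          aux = solveℤ

        cancel-reduced : ∀ x y → composeCancel k A x y ≡ 0 ⊎ composeCancel k A y x ≡ 0
        cancel-reduced x y with ℕP.≤-total (A x y ℕ.+ A x (v k) ℕ.* A (v k) y) (A y x ℕ.+ A y (v k) ℕ.* A (v k) x)
        ... | inj₁ q = inj₁ (ℕP.m≤n⇒m∸n≡0 q)
        ... | inj₂ q = inj₂ (ℕP.m≤n⇒m∸n≡0 q)

        weight-entry : ∀ i → [ ω (cs i) (cs k) ]₊ ≡ A (v i) (v k)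
        weight-entry i with reduced (v i) (v k)
        ... | inj₁ z = trans (cong [_]₊ (trans (b-entry i k) (trans (cong (λ t → + t ℤ.- + A (v k) (v i)) z) (ℤP.+-identityˡ (ℤ.- + A (v k) (v i)))))) (trans (neg-part (A (v k) (v i))) (sym z))
          where
          neg-part : ∀ a → [ ℤ.- + a ]₊ ≡ 0
          neg-part zero    = refl
          neg-part (suc a) = refl
        ... | inj₂ z = trans (cong [_]₊ (b-entry i k)) (trans (cong (λ t → [ + A (v i) (v k) ℤ.- + t ]₊) z) (cong [_]₊ {y = + A (v i) (v k)} (ℤP.+-identityʳ (+ A (v i) (v k)))))

        lookup-moved : ∀ i f → lookup (cs i ⊕ [ ω (cs i) (cs k) ]₊ · cs k) f ≡ lookup (cs i) f ℤ.+ + A (v i) (v k) ℤ.* lookup (cs k) f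
        lookup-moved i f = trans (lookup-⊕ f (cs i) _) (cong (λ t → lookup (cs i) f ℤ.+ t) (trans (mulᶠ (lookupᶠ f) [ ω (cs i) (cs k) ]₊ (cs k))
          (cong (λ w → + w ℤ.* lookup (cs k) f) (weight-entry i))))

        ω-moved : ∀ (φ : Additive n) i → fun φ (cs i ⊕ [ ω (cs i) (cs k) ]₊ · cs k) ≡ fun φ (cs i) ℤ.+ + A (v i) (v k) ℤ.* fun φ (cs k)
        ω-moved φ i = trans (add φ (cs i) _) (cong (λ t → fun φ (cs i) ℤ.+ t) (trans (mulᶠ φ [ ω (cs i) (cs k) ]₊ (cs k)) (cong (λ w → + w ℤ.* fun φ (cs k)) (weight-entry i))))

      -- Greenness leaves no arrows from frozen vertices to `k`, so the paths through `k` between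
      -- `i` and a frozen vertex all start at `i`, and c_i gains one copy of c_k for each arrow i →
      -- k. The exchange matrix then follows by bilinearity.
      mutate-encodes : Encodes (mutate k A) (mutateᶜ cs k)
      mutate-encodes = record { reduced = red ; c-entry = ce ; b-entry = be }
        where
        red : ∀ x y → mutate k A x y ≡ 0 ⊎ mutate k A y x ≡ 0
        red (inj₁ x) (inj₁ y) with x Fin.≟ k | y Fin.≟ k
        ... | yes _ | yes _ = reduced (v y) (v x)
        ... | yes _ | no _  = reduced (v y) (v x)
        ... | no _  | yes _ = reduced (v y) (v x)
        ... | no _  | no _  = cancel-reduced (v x) (v y)
        red (inj₁ x) (inj₂ f) with x Fin.≟ k
        ... | yes _ = reduced (inj₂ f) (v x)
        ... | no _  = cancel-reduced (v x) (inj₂ f)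
        red (inj₂ f) (inj₁ y) with y Fin.≟ k
        ... | yes _ = reduced (v y) (inj₂ f)
        ... | no _  = cancel-reduced (inj₂ f) (v y)
        red (inj₂ f) (inj₂ _) = inj₁ refl
        swap : ∀ p q → ℤ.- (p ℤ.- q) ≡ q ℤ.- p
        swap = solveℤ
        ce : ∀ i f → lookup (mutateᶜ cs k i) f ≡ + mutate k A (inj₁ i) (inj₂ f) ℤ.- + mutate k A (inj₂ f) (inj₁ i)
        ce i f with i Fin.≟ k
        ... | yes refl = trans (lookup-⊖ f (cs k)) (trans (cong ℤ.-_ (c-entry k f)) (swap (+ A (v k) (inj₂ f)) (+ A (inj₂ f) (v k))))
        ... | no ne    = trans (lookup-moved i f) (trans (cong₂ (λ p q → p ℤ.+ + A (v i) (v k) ℤ.* q) (c-entry i f) (c-entry k f))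
                (trans (cong (λ t → + A (v i) (inj₂ f) ℤ.- + A (inj₂ f) (v i) ℤ.+ + A (v i) (v k) ℤ.* (+ A (v k) (inj₂ f) ℤ.- + t)) (g f))
                (trans (aux (+ A (v i) (inj₂ f) ℤ.- + A (inj₂ f) (v i)) (+ A (v i) (v k)) (+ A (v k) (inj₂ f)) (+ A (v k) (v i)))
                (trans (cong (λ t → + A (v i) (inj₂ f) ℤ.- + A (inj₂ f) (v i) ℤ.+ (+ A (v i) (v k) ℤ.* + A (v k) (inj₂ f) ℤ.- + t ℤ.* + A (v k) (v i))) (sym (g f)))
                  (sym (cancel-diff (v i) (inj₂ f)))))))
          where
          aux : ∀ d w c u → d ℤ.+ w ℤ.* (c ℤ.- 0ℤ) ≡ d ℤ.+ (w ℤ.* c ℤ.- 0ℤ ℤ.* u)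
          aux = solveℤ
        from-k : ∀ y → ω (⊖ cs k) (cs y ⊕ [ ω (cs y) (cs k) ]₊ · cs k) ≡ + A (v y) (v k) ℤ.- + A (v k) (v y)
        from-k y = trans (negᶠ (ωˡ _) (cs k)) (trans (cong ℤ.-_ (trans (ω-moved (ωʳ (cs k)) y)
          (trans (cong₂ (λ p q → p ℤ.+ + A (v y) (v k) ℤ.* q) (b-entry k y) (alt (cs k))) (aux (+ A (v k) (v y) ℤ.- + A (v y) (v k)) (+ A (v y) (v k)))))) (swap (+ A (v k) (v y)) (+ A (v y) (v k))))
          where
          aux : ∀ p q → p ℤ.+ q ℤ.* 0ℤ ≡ p
          aux = solveℤ
        be : ∀ x y → ω (mutateᶜ cs k x) (mutateᶜ cs k y) ≡ + mutate k A (inj₁ x) (inj₁ y) ℤ.- + mutate k A (inj₁ y) (inj₁ x)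
        be x y with x Fin.≟ k | y Fin.≟ k
        ... | yes refl | yes refl = trans (alt (⊖ cs k)) (sym (ℤP.+-inverseʳ (+ A (v k) (v k))))
        ... | yes refl | no ny    = from-k y
        ... | no nx    | yes refl = trans (skew _ (⊖ cs k)) (trans (cong ℤ.-_ (from-k x)) (swap (+ A (v x) (v k)) (+ A (v k) (v x))))
        ... | no nx    | no ny    = trans (ω-moved (ωˡ _) x) (trans (cong₂ (λ p q → p ℤ.+ + A (v x) (v k) ℤ.* q) (ω-moved (ωʳ (cs x)) y) (ω-moved (ωʳ (cs k)) y))
              (trans (cong₂ (λ p q → p ℤ.+ + A (v x) (v k) ℤ.* q)
                  (cong₂ (λ p q → p ℤ.+ + A (v y) (v k) ℤ.* q) (b-entry x y) (b-entry x k))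
                  (cong₂ (λ p q → p ℤ.+ + A (v y) (v k) ℤ.* q) (b-entry k y) (alt (cs k))))
              (trans (aux (+ A (v x) (v y) ℤ.- + A (v y) (v x)) (+ A (v y) (v k)) (+ A (v x) (v k)) (+ A (v k) (v x)) (+ A (v k) (v y)))
                (sym (cancel-diff (v x) (v y))))))
          where
          aux : ∀ d yk xk kx ky → d ℤ.+ yk ℤ.* (xk ℤ.- kx) ℤ.+ xk ℤ.* (ky ℤ.- yk ℤ.+ yk ℤ.* 0ℤ) ≡ d ℤ.+ (xk ℤ.* ky ℤ.- yk ℤ.* kx)
          aux = solveℤ

  path⇒ : ∀ {A cs} → Encodes A cs → ∀ ks → GreenSeqToRed A ks → GreenPath cs ks
  path⇒ E []       red     = λ i → red⇒ E (red i)
  path⇒ E (k ∷ ks) (g , p) = green⇒ E g , path⇒ (mutate-encodes E k g) ks p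

  path⇐ : ∀ {A cs} → Encodes A cs → ∀ ks → GreenPath cs ks → GreenSeqToRed A ks
  path⇐ E []       red     = λ i → red⇐ E (red i)
  path⇐ E (k ∷ ks) (g , p) = green⇐ E g , path⇐ (mutate-encodes E k (green⇐ E g)) ks p

  mgs⇒path : ∀ ks → IsMaximalGreenSequence Q ks → GreenPath e ks
  mgs⇒path = path⇒ framed-encodes

  path⇒mgs : ∀ ks → GreenPath e ks → IsMaximalGreenSequence Q ks
  path⇒mgs = path⇐ framed-encodes

induced-form : ∀ j {m} (Q : Quiver (j ℕ.+ m)) (x y : Lattice m) →
  SkewForm.ω (eulerForm Q) (Embedding.ι j m x) (Embedding.ι j m y) ≡ SkewForm.ω (eulerForm (induced j Q)) x y
induced-form j {m} Q x y = trans (eulerω-rows Q (ι x) (ι y)) (trans (sumℤ-append j (λ i → lookup (ι x) i ℤ.* rowQ i)) (trans (cong₂ ℤ._+_ (sumℤ-zero {a = λ a → lookup (ι x) (a Fin.↑ˡ m) ℤ.* rowQ (a Fin.↑ˡ m)} λ a → trans (cong (ℤ._* rowQ (a Fin.↑ˡ m)) (lookup-ιˡ x a)) (ℤP.*-zeroˡ (rowQ (a Fin.↑ˡ m))))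
    (sumℤ-cong λ b → cong₂ ℤ._*_ (lookup-ιʳ x b) (row-induced b))) (trans (ℤP.+-identityˡ _) (sym (eulerω-rows (induced j Q) x y)))))
  where
  open Embedding j m
  rowQ : Fin (j ℕ.+ m) → ℤ
  rowQ i = sumℤ (λ k → exchange Q i k ℤ.* lookup (ι y) k)
  row-induced : ∀ b → rowQ (j Fin.↑ʳ b) ≡ sumℤ (λ k → exchange (induced j Q) b k ℤ.* lookup y k)
  row-induced b = trans (sumℤ-append j (λ k → exchange Q (j Fin.↑ʳ b) k ℤ.* lookup (ι y) k)) (trans (cong₂ ℤ._+_ (sumℤ-zero {a = λ a → exchange Q (j Fin.↑ʳ b) (a Fin.↑ˡ m) ℤ.* lookup (ι y) (a Fin.↑ˡ m)} λ a → trans (cong (exchange Q (j Fin.↑ʳ b) (a Fin.↑ˡ m) ℤ.*_) (lookup-ιˡ y a)) (ℤP.*-zeroʳ (exchange Q (j Fin.↑ʳ b) (a Fin.↑ˡ m))))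
    (sumℤ-cong λ k → cong (exchange Q (j Fin.↑ʳ b) (j Fin.↑ʳ k) ℤ.*_) (lookup-ιʳ y k))) (ℤP.+-identityˡ _))

induced-mgs : ∀ j {m} (Q : Quiver (j ℕ.+ m)) → HasMGS Q → HasMGS (induced j Q)
induced-mgs j {m} Q (ks , p) with Restriction.restrict-green j m (eulerForm Q) (eulerForm (induced j Q)) (induced-form j Q) ks (mgs⇒path Q ks p)
... | ks′ , p′ = ks′ , path⇒mgs (induced j Q) ks′ p′

-- A maximal green sequence for Q from one for C

-- The Kronecker delta and the indicator of `p ≤ t`: the coordinates of one cycle vertex and of a
-- final segment of the cycle vertices.
δ step : ℕ → ℕ → ℤ
δ zero    zero    = 1ℤ
δ zero    (suc t) = 0ℤ
δ (suc s) zero    = 0ℤ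
δ (suc s) (suc t) = δ s t
step zero    t       = 1ℤ
step (suc p) zero    = 0ℤ
step (suc p) (suc t) = step p t

δ-same : ∀ s → δ s s ≡ 1ℤ
δ-same zero    = refl
δ-same (suc s) = δ-same s

δ-off : ∀ s t → s ≢ t → δ s t ≡ 0ℤ
δ-off zero    zero    ne = ⊥-elim (ne refl)
δ-off zero    (suc t) ne = refl
δ-off (suc s) zero    ne = refl
δ-off (suc s) (suc t) ne = δ-off s t (ne ∘ cong suc)

δ-nonneg : ∀ s t → 0≤ δ s t
δ-nonneg zero    zero    = 0≤-nat
δ-nonneg zero    (suc t) = 0≤-nat
δ-nonneg (suc s) zero    = 0≤-nat
δ-nonneg (suc s) (suc t) = δ-nonneg s t

step-≥ : ∀ {p t} → p ℕ.≤ t → step p t ≡ 1ℤ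
step-≥ z≤n     = refl
step-≥ (s≤s q) = step-≥ q

step-< : ∀ {p t} → t ℕ.< p → step p t ≡ 0ℤ
step-< {suc p} {zero}  _       = refl
step-< {suc p} {suc t} (s≤s q) = step-< q

step-nonneg : ∀ p t → 0≤ step p t
step-nonneg zero    t       = 0≤-nat
step-nonneg (suc p) zero    = 0≤-nat
step-nonneg (suc p) (suc t) = step-nonneg p t

δ+step : ∀ p t → δ p t ℤ.+ step (suc p) t ≡ step p t
δ+step zero    zero    = refl
δ+step zero    (suc t) = refl
δ+step (suc p) zero    = refl
δ+step (suc p) (suc t) = δ+step p t

-- The differences have stride two, so two terms survive at each end. With `f` the coordinates
-- `cyc x` this evaluates `ω x (Ε p)`.
telescope : ∀ (f : ℕ → ℤ) j p → p ℕ.≤ j →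
  sumℤ {j} (λ a → step p (Fin.toℕ a) ℤ.* (f (Fin.toℕ a) ℤ.- f (2 ℕ.+ Fin.toℕ a))) ≡ f p ℤ.+ f (suc p) ℤ.- f j ℤ.- f (suc j)
telescope f zero    .zero z≤n = aux (f 0) (f 1)
  where
  aux : ∀ a b → 0ℤ ≡ a ℤ.+ b ℤ.- a ℤ.- b
  aux = solveℤ
telescope f (suc j) zero z≤n = trans (cong (λ t → 1ℤ ℤ.* (f 0 ℤ.- f 2) ℤ.+ t) (telescope (f ∘ suc) j zero z≤n)) (aux (f 0) (f 1) (f 2) (f (suc j)) (f (suc (suc j))))
  where
  aux : ∀ a b c d e → 1ℤ ℤ.* (a ℤ.- c) ℤ.+ (b ℤ.+ c ℤ.- d ℤ.- e) ≡ a ℤ.+ b ℤ.- d ℤ.- e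
  aux = solveℤ
telescope f (suc j) (suc p) (s≤s q) = trans (ℤP.+-identityˡ _) (telescope (f ∘ suc) j p q)

-- The cycle vertices 1 , … , k-1 are the indices 0 , … , j₁ with j₁ = k - 2, and k is v.
module CycleSequence (j₁ m : ℕ) (v : Fin m) (Q : Quiver (suc j₁ ℕ.+ m)) (hyp : CycleHyp (suc j₁) m v Q) (1≤j₁ : 1 ℕ.≤ j₁) where

  private
    j : ℕ
    j = suc j₁
    V : Set
    V = Lattice (j ℕ.+ m)

  open Embedding j m
  open GreenPaths (eulerForm Q)
  module Cᵖ = GreenPaths (eulerForm (induced j Q))

  -- Coordinates along the cycle k , 1 , 2 , … , k-1 , k.
  cyc : V → ℕ → ℤ
  cyc x zero = lookup x (j Fin.↑ʳ v)
  cyc x (suc t) with t ℕ.<? j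
  ... | yes q = lookup x (Fin.fromℕ< q Fin.↑ˡ m)
  ... | no _  = lookup x (j Fin.↑ʳ v)

  cyc-< : ∀ x {t} (q : t ℕ.< j) → cyc x (suc t) ≡ lookup x (Fin.fromℕ< q Fin.↑ˡ m)
  cyc-< x {t} q with t ℕ.<? j
  ... | yes _ = refl
  ... | no n  = ⊥-elim (n q)

  cyc-≥ : ∀ x {t} → j ℕ.≤ t → cyc x (suc t) ≡ lookup x (j Fin.↑ʳ v)
  cyc-≥ x {t} q with t ℕ.<? j
  ... | yes p = ⊥-elim (ℕP.<-irrefl refl (ℕP.<-≤-trans p q))
  ... | no _  = refl

  -- Position t + 1 in `cyc` holds the cycle vertex with index t, so the two neighbours of index `a`
  -- stand at positions `a` and `a + 2`.
  ω-cycle : ∀ x (a : Fin j) → ω x (e (a Fin.↑ˡ m)) ≡ cyc x (Fin.toℕ a) ℤ.- cyc x (2 ℕ.+ Fin.toℕ a)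
  ω-cycle x a = trans (ω-eʳ Q x (a Fin.↑ˡ m)) (trans (sumℤ-cong λ i →
      trans (cong₂ (λ p q → lookup x i ℤ.* (+ p ℤ.- + q)) (proj₁ (hyp a i)) (proj₂ (hyp a i))) (aux (lookup x i) (+ indic (i Fin.≟ prevV m v a)) (+ indic (i Fin.≟ nextV m v a))))
    (trans (sumℤ-add (λ i → pick (prevV m v a) i) (λ i → ℤ.- 1ℤ ℤ.* pick (nextV m v a) i))
      (trans (cong (λ t → sumℤ (pick (prevV m v a)) ℤ.+ t) (sumℤ-scale (ℤ.- 1ℤ) (pick (nextV m v a))))
        (trans (cong₂ (λ p q → p ℤ.+ ℤ.- 1ℤ ℤ.* q) (trans (pick-sum (prevV m v a)) (at-prev a)) (trans (pick-sum (nextV m v a)) (at-next a))) (aux′ (cyc x (Fin.toℕ a)) (cyc x (2 ℕ.+ Fin.toℕ a)))))))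
    where
    pick : Fin (j ℕ.+ m) → Fin (j ℕ.+ m) → ℤ
    pick u i = lookup x i ℤ.* + indic (i Fin.≟ u)
    pick-sum : ∀ u → sumℤ (pick u) ≡ lookup x u
    pick-sum u = trans (sumℤ-single {a = pick u} u off) (on (u Fin.≟ u))
      where
      off : ∀ i → i ≢ u → pick u i ≡ 0ℤ
      off i ne with i Fin.≟ u
      ... | yes z = ⊥-elim (ne z)
      ... | no _  = ℤP.*-zeroʳ (lookup x i)
      on : (d : Dec (u ≡ u)) → lookup x u ℤ.* + indic d ≡ lookup x u
      on (yes _) = ℤP.*-identityʳ (lookup x u)
      on (no ne) = ⊥-elim (ne refl)
    aux : ∀ x p q → x ℤ.* (p ℤ.- q) ≡ x ℤ.* p ℤ.+ ℤ.- 1ℤ ℤ.* (x ℤ.* q)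
    aux = solveℤ
    aux′ : ∀ p q → p ℤ.+ ℤ.- 1ℤ ℤ.* q ≡ p ℤ.- q
    aux′ = solveℤ
    at-prev : ∀ a → lookup x (prevV m v a) ≡ cyc x (Fin.toℕ a)
    at-prev zero    = refl
    at-prev (suc i) = sym (trans (cyc-< x q) (cong (λ z → lookup x (z Fin.↑ˡ m)) (FinP.toℕ-injective (trans (FinP.toℕ-fromℕ< q) (sym (FinP.toℕ-inject₁ i))))))
      where
      q : Fin.toℕ i ℕ.< j
      q = ℕP.m<n⇒m<1+n (FinP.toℕ<n i)
    at-next : ∀ a → lookup x (nextV m v a) ≡ cyc x (2 ℕ.+ Fin.toℕ a)
    at-next a with suc (Fin.toℕ a) ℕ.<? j
    ... | yes _ = refl
    ... | no _  = refl

  opaque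
    cycVec : (ℕ → ℤ) → V
    cycVec g = Vec.tabulate {n = j} (g ∘ Fin.toℕ) Vec.++ 𝟎 {m}

    lookup-cycˡ : ∀ g a → lookup (cycVec g) (a Fin.↑ˡ m) ≡ g (Fin.toℕ a)
    lookup-cycˡ g a = trans (VecP.lookup-++ˡ (Vec.tabulate (g ∘ Fin.toℕ)) 𝟎 a) (VecP.lookup∘tabulate (g ∘ Fin.toℕ) a)

    lookup-cycʳ : ∀ g b → lookup (cycVec g) (j Fin.↑ʳ b) ≡ 0ℤ
    lookup-cycʳ g b = trans (VecP.lookup-++ʳ (Vec.tabulate {n = j} (g ∘ Fin.toℕ)) 𝟎 b) (lookup-𝟎 b)

  cyc-cycVec : ∀ g {t} → t ℕ.< j → cyc (cycVec g) (suc t) ≡ g t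
  cyc-cycVec g q = trans (cyc-< (cycVec g) q) (trans (lookup-cycˡ g (Fin.fromℕ< q)) (cong g (FinP.toℕ-fromℕ< q)))

  cyc-cycVec-≥ : ∀ g {t} → j ℕ.≤ t → cyc (cycVec g) (suc t) ≡ 0ℤ
  cyc-cycVec-≥ g q = trans (cyc-≥ (cycVec g) q) (lookup-cycʳ g v)

  cyc-ι : ∀ y {t} → t ℕ.< j → cyc (ι y) (suc t) ≡ 0ℤ
  cyc-ι y q = trans (cyc-< (ι y) q) (lookup-ιˡ y (Fin.fromℕ< q))

  cyc-ι-zero : ∀ y → cyc (ι y) 0 ≡ lookup y v
  cyc-ι-zero y = lookup-ιʳ y v

  cyc-ι-≥ : ∀ y {t} → j ℕ.≤ t → cyc (ι y) (suc t) ≡ lookup y v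
  cyc-ι-≥ y q = trans (cyc-≥ (ι y) q) (lookup-ιʳ y v)

  ω-cycVec : ∀ x h → ω x (cycVec h) ≡ sumℤ {j} (λ a → h (Fin.toℕ a) ℤ.* (cyc x (Fin.toℕ a) ℤ.- cyc x (2 ℕ.+ Fin.toℕ a)))
  ω-cycVec x h = trans (expansion standard (ωʳ x) (cycVec h)) (trans (sumℤ-append j (λ i → lookup (cycVec h) i ℤ.* ω x (e i)))
    (trans (cong₂ ℤ._+_ (sumℤ-cong λ a → cong₂ ℤ._*_ (lookup-cycˡ h a) (ω-cycle x a))
      (sumℤ-zero {a = λ b → lookup (cycVec h) (j Fin.↑ʳ b) ℤ.* ω x (e (j Fin.↑ʳ b))} λ b → trans (cong (ℤ._* ω x (e (j Fin.↑ʳ b))) (lookup-cycʳ h b)) (ℤP.*-zeroˡ (ω x (e (j Fin.↑ʳ b)))))) (ℤP.+-identityʳ _)))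

  -- `ε s` is the basis vector of the cycle vertex with index `s` (`e-ε`), and `Ε p` is the sum of
  -- those with indices p, ..., j₁.
  ε Ε : ℕ → V
  ε s = cycVec (δ s)
  Ε p = cycVec (step p)

  ω-ε : ∀ x {s} → s ℕ.< j → ω x (ε s) ≡ cyc x s ℤ.- cyc x (2 ℕ.+ s)
  ω-ε x {s} q = trans (ω-cycVec x (δ s)) (trans (sumℤ-single {a = F} (Fin.fromℕ< q) off)
      (trans (cong G (FinP.toℕ-fromℕ< q)) (trans (cong (ℤ._* (cyc x s ℤ.- cyc x (2 ℕ.+ s))) (δ-same s)) (ℤP.*-identityˡ _))))
    where
    G : ℕ → ℤ
    G t = δ s t ℤ.* (cyc x t ℤ.- cyc x (2 ℕ.+ t))
    F : Fin j → ℤ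
    F a = G (Fin.toℕ a)
    off : ∀ a → a ≢ Fin.fromℕ< q → F a ≡ 0ℤ
    off a ne = trans (cong (ℤ._* (cyc x (Fin.toℕ a) ℤ.- cyc x (2 ℕ.+ Fin.toℕ a))) (δ-off s (Fin.toℕ a) (λ z → ne (FinP.toℕ-injective (trans (sym z) (sym (FinP.toℕ-fromℕ< q)))))))
      (ℤP.*-zeroˡ (cyc x (Fin.toℕ a) ℤ.- cyc x (2 ℕ.+ Fin.toℕ a)))

  ω-Ε : ∀ x {p} → p ℕ.≤ j → ω x (Ε p) ≡ cyc x p ℤ.+ cyc x (suc p) ℤ.- cyc x j ℤ.- cyc x (suc j)
  ω-Ε x {p} q = trans (ω-cycVec x (step p)) (telescope (cyc x) j p q)

  cyc-ε : ∀ {s} → s ℕ.< j → ∀ t → cyc (ε s) (suc t) ≡ δ s t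
  cyc-ε {s} q t with ℕP.<-≤-connex t j
  ... | inj₁ t<j = cyc-cycVec (δ s) t<j
  ... | inj₂ j≤t = trans (cyc-cycVec-≥ (δ s) j≤t) (sym (δ-off s t (λ z → ℕP.<-irrefl z (ℕP.<-≤-trans q j≤t))))

  cyc-vec-zero : ∀ g → cyc (cycVec g) 0 ≡ 0ℤ
  cyc-vec-zero g = lookup-cycʳ g v

  cyc-ε-off : ∀ {s} → s ℕ.< j → ∀ p → p ≢ suc s → cyc (ε s) p ≡ 0ℤ
  cyc-ε-off {s} q zero    ne = cyc-vec-zero (δ s)
  cyc-ε-off {s} q (suc p) ne = trans (cyc-ε q p) (δ-off s p (λ z → ne (cong suc (sym z))))

  cyc-Ε-≤ : ∀ p t → t ℕ.≤ p → t ℕ.≤ j → cyc (Ε p) t ≡ 0ℤ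
  cyc-Ε-≤ p zero    _ _ = cyc-vec-zero (step p)
  cyc-Ε-≤ p (suc t) q r = trans (cyc-cycVec (step p) r) (step-< q)

  four : ∀ {a b c d a′ b′ c′ d′} → a ≡ a′ → b ≡ b′ → c ≡ c′ → d ≡ d′ → a ℤ.+ b ℤ.- c ℤ.- d ≡ a′ ℤ.+ b′ ℤ.- c′ ℤ.- d′
  four refl refl refl refl = refl

  ε-Ε-next : ∀ {p} → suc p ℕ.< j → ω (ε p) (Ε (suc p)) ≡ 1ℤ
  ε-Ε-next {p} q@(s≤s p<j₁) = trans (ω-Ε (ε p) (ℕP.<⇒≤ q)) (four {a′ = 1ℤ} {0ℤ} {0ℤ} {0ℤ} (trans (cyc-ε p<j p) (δ-same p)) (cyc-ε-off p<j (suc (suc p)) (λ ()))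
      (cyc-ε-off p<j j (λ z → ℕP.<-irrefl (sym (ℕP.suc-injective z)) p<j₁)) (cyc-ε-off p<j (suc j) (λ z → ℕP.<-irrefl (sym (ℕP.suc-injective z)) p<j)))
    where
    p<j : p ℕ.< j
    p<j = ℕP.<⇒≤ q

  ε-Ε-far : ∀ {s p} → s ℕ.< j₁ → p ℕ.≤ j → p ≢ suc s → suc p ≢ suc s → ω (ε s) (Ε p) ≡ 0ℤ
  ε-Ε-far {s} {p} q r n₁ n₂ = trans (ω-Ε (ε s) r) (four {a′ = 0ℤ} {0ℤ} {0ℤ} {0ℤ} (cyc-ε-off s<j p n₁) (cyc-ε-off s<j (suc p) n₂)
      (cyc-ε-off s<j j (λ z → ℕP.<-irrefl (sym (ℕP.suc-injective z)) q)) (cyc-ε-off s<j (suc j) (λ z → ℕP.<-irrefl (sym (ℕP.suc-injective z)) s<j)))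
    where
    s<j : s ℕ.< j
    s<j = ℕP.m<n⇒m<1+n q

  Ε-Ε : ∀ {p} → suc p ℕ.< j → ω (Ε (suc p)) (Ε p) ≡ ℤ.- 1ℤ
  Ε-Ε {p} q@(s≤s p<j₁) = trans (ω-Ε (Ε (suc p)) (ℕP.<⇒≤ (ℕP.<-trans (ℕP.n<1+n p) q))) (four {a′ = 0ℤ} {0ℤ} {1ℤ} {0ℤ}
    (cyc-Ε-≤ (suc p) p (ℕP.n≤1+n p) (ℕP.<⇒≤ (ℕP.<-trans (ℕP.n<1+n p) q))) (cyc-Ε-≤ (suc p) (suc p) ℕP.≤-refl (ℕP.<⇒≤ q))
    (trans (cyc-cycVec (step (suc p)) (ℕP.n<1+n j₁)) (step-≥ p<j₁)) (cyc-cycVec-≥ (step (suc p)) ℕP.≤-refl))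

  ι-Ε : ∀ y {p} → suc p ℕ.< j → ω (ι y) (Ε (suc p)) ≡ ℤ.- lookup y v
  ι-Ε y {p} q = trans (ω-Ε (ι y) (ℕP.<⇒≤ q)) (trans (four (cyc-ι y (ℕP.<-trans (ℕP.n<1+n p) q)) (cyc-ι y q) (cyc-ι y (ℕP.n<1+n j₁)) (cyc-ι-≥ y ℕP.≤-refl)) (aux (lookup y v)))
    where
    aux : ∀ a → 0ℤ ℤ.+ 0ℤ ℤ.- 0ℤ ℤ.- a ≡ ℤ.- a
    aux = solveℤ

  -- Taken together, the vertices 1, ..., k-1 have one arrow from k and one to k, which cancel. So
  -- mutations in C leave the class `Ε 0` alone, and mutation at it leaves C alone.
  ι-Ε-zero : ∀ y → ω (ι y) (Ε 0) ≡ 0ℤ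
  ι-Ε-zero y = trans (ω-Ε (ι y) z≤n) (trans (four (cyc-ι-zero y) (cyc-ι y (s≤s z≤n)) (cyc-ι y (ℕP.n<1+n j₁)) (cyc-ι-≥ y ℕP.≤-refl)) (aux (lookup y v)))
    where
    aux : ∀ a → a ℤ.+ 0ℤ ℤ.- 0ℤ ℤ.- a ≡ 0ℤ
    aux = solveℤ

  ι-ε : ∀ y {s} → suc (suc s) ℕ.< j → ω (ι y) (ε (suc s)) ≡ 0ℤ
  ι-ε y {s} q = trans (ω-ε (ι y) (ℕP.<⇒≤ q)) (cong₂ ℤ._-_ (cyc-ι y (ℕP.<-trans (ℕP.n<1+n s) (ℕP.<⇒≤ q))) (cyc-ι y q))

  ι-ε-zero : ∀ y → ω (ι y) (ε 0) ≡ lookup y v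
  ι-ε-zero y = trans (ω-ε (ι y) (s≤s z≤n)) (trans (cong₂ ℤ._-_ (cyc-ι-zero y) (cyc-ι y (s≤s 1≤j₁))) (ℤP.+-identityʳ _))

  Ε-ε : ∀ {s} → suc s ℕ.< j → ω (Ε s) (ε s) ≡ ℤ.- 1ℤ
  Ε-ε {s} q = trans (ω-ε (Ε s) s<j) (cong₂ ℤ._-_ (cyc-Ε-≤ s s ℕP.≤-refl (ℕP.<⇒≤ s<j)) (trans (cyc-cycVec (step s) q) (step-≥ (ℕP.n≤1+n s))))
    where
    s<j : s ℕ.< j
    s<j = ℕP.<-trans (ℕP.n<1+n s) q

  ε-ε-below : ∀ {l i} → l ℕ.< i → i ℕ.< j → 0≤ ω (ε l) (ε i)
  ε-ε-below {l} {suc i} l<i i<j = subst 0≤_ (sym (trans (ω-ε (ε l) i<j) (trans (cong₂ ℤ._-_ (cyc-ε l<j i) (trans (cyc-ε l<j (suc (suc i))) (δ-off l (suc (suc i)) (λ z → ℕP.<-irrefl z (ℕP.m<n⇒m<1+n l<i))))) (ℤP.+-identityʳ _)))) (δ-nonneg l i)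
    where
    l<j : l ℕ.< j
    l<j = ℕP.<-trans l<i i<j

  ε-ε-above : ∀ {l i} → i ℕ.< l → l ℕ.< j → 0≤ ℤ.- ω (ε l) (ε i)
  ε-ε-above {l} {i} i<l l<j = subst (λ z → 0≤ ℤ.- z) (sym (trans (ω-ε (ε l) (ℕP.<-trans i<l l<j)) (trans (cong₂ ℤ._-_ (cyc-ε-off l<j i (λ z → ℕP.<-asym i<l (ℕP.≤-reflexive (sym z)))) (cyc-ε l<j (suc i))) (ℤP.+-identityˡ _))))
    (subst 0≤_ (sym (ℤP.neg-involutive (δ l (suc i)))) (δ-nonneg l (suc i)))

  cycVec-⊕ : ∀ g h f → (∀ t → g t ℤ.+ h t ≡ f t) → cycVec g ⊕ cycVec h ≡ cycVec f
  cycVec-⊕ g h f eq = ext-split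
    (λ a → trans (lookup-⊕ (a Fin.↑ˡ m) (cycVec g) (cycVec h)) (trans (cong₂ ℤ._+_ (lookup-cycˡ g a) (lookup-cycˡ h a)) (trans (eq (Fin.toℕ a)) (sym (lookup-cycˡ f a)))))
    (λ b → trans (lookup-⊕ (j Fin.↑ʳ b) (cycVec g) (cycVec h)) (trans (cong₂ ℤ._+_ (lookup-cycʳ g b) (lookup-cycʳ h b)) (sym (lookup-cycʳ f b))))

  ε⊕Ε : ∀ p → ε p ⊕ Ε (suc p) ≡ Ε p
  ε⊕Ε p = cycVec-⊕ (δ p) (step (suc p)) (step p) (δ+step p)

  ⊖Ε⊕Ε : ∀ p → ⊖ Ε (suc p) ⊕ Ε p ≡ ε p
  ⊖Ε⊕Ε p = trans (cong (⊖ Ε (suc p) ⊕_) (sym (ε⊕Ε p))) (solveᴸ (ε p ∷ Ε (suc p) ∷ []) (:- v₁ ∔ (v₀ ∔ v₁)) v₀ refl)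

  ⊖Ε⊕ε : ∀ p → ⊖ Ε p ⊕ ε p ≡ ⊖ Ε (suc p)
  ⊖Ε⊕ε p = trans (cong (λ z → ⊖ z ⊕ ε p) (sym (ε⊕Ε p))) (solveᴸ (ε p ∷ Ε (suc p) ∷ []) (:- (v₀ ∔ v₁) ∔ v₀) (:- v₁) refl)

  cycVec-nonneg : ∀ {g} → (∀ t → 0≤ g t) → NonNeg (cycVec g)
  cycVec-nonneg {g} h i with splitFin j {m} i
  ... | left a  = subst 0≤_ (sym (lookup-cycˡ g a)) (h (Fin.toℕ a))
  ... | right b = subst 0≤_ (sym (lookup-cycʳ g b)) 0≤-nat

  ⊖-nonpos : ∀ {x : V} → NonNeg x → NonPos (⊖ x)
  ⊖-nonpos {x} h i = subst 0≤_ (sym (trans (cong ℤ.-_ (lookup-⊖ i x)) (ℤP.neg-involutive (lookup x i)))) (h i)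

  ι-nonneg : ∀ {y} → NonNeg y → NonNeg (ι y)
  ι-nonneg {y} h i with splitFin j {m} i
  ... | left a  = subst 0≤_ (sym (lookup-ιˡ y a)) 0≤-nat
  ... | right b = subst 0≤_ (sym (lookup-ιʳ y b)) (h b)

  ι-nonpos : ∀ {y} → NonPos y → NonPos (ι y)
  ι-nonpos {y} h i with splitFin j {m} i
  ... | left a  = subst (λ z → 0≤ ℤ.- z) (sym (lookup-ιˡ y a)) 0≤-nat
  ... | right b = subst (λ z → 0≤ ℤ.- z) (sym (lookup-ιʳ y b)) (h b)

  vtx : (l : ℕ) → l ℕ.< j → Fin (j ℕ.+ m)
  vtx l q = Fin.fromℕ< q Fin.↑ˡ m

  vtx-≢ : ∀ {l l′} q q′ → l ≢ l′ → vtx l q ≢ vtx l′ q′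
  vtx-≢ q q′ ne h = ne (trans (sym (FinP.toℕ-fromℕ< q)) (trans (cong Fin.toℕ (FinP.↑ˡ-injective m _ _ h)) (FinP.toℕ-fromℕ< q′)))

  module _ (cs : Fin (j ℕ.+ m) → V) where

    still : ∀ {l k x β} → cs l ≡ x → cs k ≡ β → l ≢ k → 0≤ ℤ.- ω x β → mutateᶜ cs k l ≡ x
    still {l} {k} refl refl ne h = trans (mutateᶜ-other cs k ne) (trans (cong (λ w → cs l ⊕ w · cs k) ([]₊-nonpos h)) (⊕-identityʳ (cs l)))

    once : ∀ {l k x β} → cs l ≡ x → cs k ≡ β → l ≢ k → ω x β ≡ 1ℤ → mutateᶜ cs k l ≡ x ⊕ β
    once {l} {k} refl refl ne h = trans (mutateᶜ-other cs k ne) (cong (cs l ⊕_) (trans (cong (λ z → [ z ]₊ · cs k) h) (⊕-identityʳ (cs k))))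

    turned : ∀ {k β} → cs k ≡ β → mutateᶜ cs k k ≡ ⊖ β
    turned {k} refl = mutateᶜ-same cs k

  still-zero : ∀ {z} → z ≡ 0ℤ → 0≤ ℤ.- z
  still-zero refl = 0≤-nat

  -- The c-vectors after mutating at the indices j₁ , … , p+1 and inside C.
  record Descending (p : ℕ) (cs : Fin (j ℕ.+ m) → V) (ys : Fin m → Lattice m) : Set where
    field
      low   : ∀ l q → l ℕ.< p → cs (vtx l q) ≡ ε l
      mid   : ∀ q → cs (vtx p q) ≡ Ε p
      nxt   : ∀ q → cs (vtx (suc p) q) ≡ ⊖ Ε (suc p)
      high  : ∀ l q → p ℕ.< l → cs (vtx (suc l) q) ≡ ε l
      outer : ∀ b → cs (j Fin.↑ʳ b) ≡ ι (ys b)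

  -- The vertex with the next lower index grows to `Ε p` and the one turned just before becomes a
  -- basis vector. All other vertices pair non-positively with `Ε (suc p)`, those of C because their
  -- coordinate at k is nonnegative.
  descend : ∀ {p cs ys} → Descending (suc p) cs ys → (q : suc p ℕ.< j) → (∀ b → NonNeg (ys b)) → Descending p (mutateᶜ cs (vtx (suc p) q)) ys
  descend {p} {cs} {ys} S q nn = record
    { low   = λ l r l<p → still cs (low l r (ℕP.m<n⇒m<1+n l<p)) β (vtx-≢ r q (λ { refl → ℕP.<-asym l<p (ℕP.n<1+n p) }))
                (still-zero (ε-Ε-far (ℕP.<-trans l<p (ℕP.≤-pred q)) (ℕP.<⇒≤ q) (λ { refl → ℕP.<-irrefl refl l<p }) (λ { refl → ℕP.<-asym l<p (ℕP.n<1+n p) })))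
    ; mid   = λ r → trans (once cs (low p r (ℕP.n<1+n p)) β (vtx-≢ r q (λ z → ℕP.<-irrefl z (ℕP.n<1+n p))) (ε-Ε-next q)) (ε⊕Ε p)
    ; nxt   = λ r → turned cs β
    ; high  = above
    ; outer = λ b → still cs (outer b) β (λ z → ↑ˡ≢↑ʳ _ b (sym z)) (subst 0≤_ (sym (trans (cong ℤ.-_ (ι-Ε (ys b) q)) (ℤP.neg-involutive _))) (nn b v)) }
    where
    open Descending S
    β : cs (vtx (suc p) q) ≡ Ε (suc p)
    β = mid q
    above : ∀ l r → p ℕ.< l → mutateᶜ cs (vtx (suc p) q) (vtx (suc l) r) ≡ ε l
    above l r p<l with suc p ℕP.≟ l
    -- The sum of -Ε(p+2) and Ε(p+1) is ε(p+1): from now on the vertex with index l + 1 carries the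
    -- basis vector with index l.
    ... | yes refl = trans (once cs (nxt r) β (vtx-≢ r q (λ z → ℕP.<-irrefl (sym z) (ℕP.n<1+n (suc p))))
                       (trans (negᶠ (ωˡ (Ε (suc p))) (Ε (suc (suc p)))) (cong ℤ.-_ (Ε-Ε r)))) (⊖Ε⊕Ε (suc p))
    ... | no ne    = still cs (high l r p+1<l) β (vtx-≢ r q (λ z → ℕP.<-irrefl (sym z) (ℕP.m<n⇒m<1+n p+1<l)))
                       (still-zero (ε-Ε-far (ℕP.≤-pred r) (ℕP.<⇒≤ q) (λ z → ℕP.<-irrefl z (ℕP.m<n⇒m<1+n p+1<l)) (λ z → ℕP.<-irrefl (ℕP.suc-injective z) p+1<l)))
      where
      p+1<l : suc p ℕ.< l
      p+1<l = ℕP.≤∧≢⇒< p<l ne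

  -- A green `ys b` has a nonnegative coordinate at k. It pairs to 0 with `Ε 0` and with `ε l` for l
  -- ≥ 1, and `⊖ Ε 1` pairs non-positively with it, so no cycle vertex moves.
  inner : ∀ {cs ys} → Descending 0 cs ys → ∀ b → NonNeg (ys b) → Descending 0 (mutateᶜ cs (j Fin.↑ʳ b)) (Cᵖ.mutateᶜ ys b)
  inner {cs} {ys} S b nn = record
    { low   = λ l q ()
    ; mid   = λ q → still cs (mid q) β (↑ˡ≢↑ʳ _ b) (still-zero (trans (skew (Ε 0) (ι (ys b))) (cong ℤ.-_ (ι-Ε-zero (ys b)))))
    ; nxt   = λ q → still cs (nxt q) β (↑ˡ≢↑ʳ _ b) (subst (λ z → 0≤ ℤ.- z) (sym (trans (negᶠ (ωˡ (ι (ys b))) (Ε 1)) (trans (sym (skew (ι (ys b)) (Ε 1))) (ι-Ε (ys b) q))))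
                (subst 0≤_ (sym (ℤP.neg-involutive _)) (nn v)))
    ; high  = λ { (suc l) q 0<l → still cs (high (suc l) q 0<l) β (↑ˡ≢↑ʳ _ b) (still-zero (trans (skew (ε (suc l)) (ι (ys b))) (cong ℤ.-_ (ι-ε (ys b) q)))) }
    ; outer = outer′ }
    where
    open Descending S
    β : cs (j Fin.↑ʳ b) ≡ ι (ys b)
    β = outer b
    outer′ : ∀ a → mutateᶜ cs (j Fin.↑ʳ b) (j Fin.↑ʳ a) ≡ ι (Cᵖ.mutateᶜ ys b a)
    outer′ a with a Fin.≟ b
    ... | yes refl = trans (turned cs β) (sym (ι-⊖ (ys b)))
    ... | no ne    = trans (mutateᶜ-other cs (j Fin.↑ʳ b) (λ z → ne (FinP.↑ʳ-injective j a b z)))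
      (trans (cong₂ (λ x y → x ⊕ [ ω x y ]₊ · y) (outer a) β) (trans (cong (λ w → ι (ys a) ⊕ [ w ]₊ · ι (ys b)) (induced-form j Q (ys a) (ys b)))
        (sym (trans (ι-⊕ (ys a) _) (cong (ι (ys a) ⊕_) (ι-· [ Cᵖ.ω (ys a) (ys b) ]₊ (ys b)))))))

  -- The c-vectors after mutating finally at the indices 0 , … , i.
  record Ascending (i : ℕ) (cs : Fin (j ℕ.+ m) → V) (ys : Fin m → Lattice m) : Set where
    field
      first : ∀ q → cs (vtx 0 q) ≡ ⊖ Ε i
      done  : ∀ l q → l ℕ.< i → cs (vtx (suc l) q) ≡ ⊖ ε l
      todo  : ∀ l q → i ℕ.≤ l → cs (vtx (suc l) q) ≡ ε l
      outer : ∀ b → cs (j Fin.↑ʳ b) ≡ ι (ys b)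

  turn : ∀ {cs ys} → Descending 0 cs ys → Ascending 0 (mutateᶜ cs (vtx 0 (s≤s z≤n))) ys
  turn {cs} {ys} S = record
    { first = λ q → turned cs β
    ; done  = λ l q ()
    ; todo  = todo
    ; outer = λ b → still cs (outer b) β (λ z → ↑ˡ≢↑ʳ _ b (sym z)) (still-zero (ι-Ε-zero (ys b))) }
    where
    open Descending S
    β : cs (vtx 0 (s≤s z≤n)) ≡ Ε 0
    β = mid (s≤s z≤n)
    todo : ∀ l q → 0 ℕ.≤ l → mutateᶜ cs (vtx 0 (s≤s z≤n)) (vtx (suc l) q) ≡ ε l
    todo zero    q _ = trans (once cs (nxt q) β (λ ()) (trans (negᶠ (ωˡ (Ε 0)) (Ε 1)) (cong ℤ.-_ (Ε-Ε q)))) (⊖Ε⊕Ε 0)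
    todo (suc l) q _ = still cs (high (suc l) q (s≤s z≤n)) β (λ ()) (still-zero (ε-Ε-far (ℕP.≤-pred q) z≤n (λ ()) (λ ())))

  ascend : ∀ {i cs ys} → Ascending i cs ys → (q : suc i ℕ.< j) → (∀ b → NonPos (ys b)) → Ascending (suc i) (mutateᶜ cs (vtx (suc i) q)) ys
  ascend {i} {cs} {ys} S q np = record
    { first = λ r → trans (once cs (first r) β (vtx-≢ r q (λ ())) (trans (negᶠ (ωˡ (ε i)) (Ε i)) (cong ℤ.-_ (Ε-ε q)))) (⊖Ε⊕ε i)
    ; done  = done′
    ; todo  = λ l r i<l → still cs (todo l r (ℕP.<⇒≤ i<l)) β (vtx-≢ r q (λ z → ℕP.<-irrefl (sym (ℕP.suc-injective z)) i<l)) (ε-ε-above i<l (ℕP.<-trans (ℕP.n<1+n l) r))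
    ; outer = λ b → still cs (outer b) β (λ z → ↑ˡ≢↑ʳ _ b (sym z)) (inside b q) }
    where
    open Ascending S
    β : cs (vtx (suc i) q) ≡ ε i
    β = todo i q ℕP.≤-refl
    done′ : ∀ l r → l ℕ.< suc i → mutateᶜ cs (vtx (suc i) q) (vtx (suc l) r) ≡ ⊖ ε l
    done′ l r l≤i with l ℕP.≟ i
    ... | yes refl = turned cs β
    ... | no ne    = still cs (done l r l<i) β (vtx-≢ r q (ne ∘ ℕP.suc-injective)) (subst 0≤_ (sym (trans (cong ℤ.-_ (negᶠ (ωˡ (ε i)) (ε l))) (ℤP.neg-involutive _)))
                       (ε-ε-below l<i (ℕP.<-trans (ℕP.n<1+n i) q)))
      where
      l<i : l ℕ.< i
      l<i = ℕP.≤∧≢⇒< (ℕP.≤-pred l≤i) ne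
    inside : ∀ b → suc i ℕ.< j → 0≤ ℤ.- ω (ι (ys b)) (ε i)
    inside b q = by-case i q
      where
      by-case : ∀ i → suc i ℕ.< j → 0≤ ℤ.- ω (ι (ys b)) (ε i)
      -- Among the classes mutated in this phase only `ε 0`, the vertex that k points to, meets C.
      -- The pairing is the coordinate at k, nonpositive because C is already red.
      by-case zero    q = subst (λ z → 0≤ ℤ.- z) (sym (ι-ε-zero (ys b))) (np b v)
      by-case (suc i) q = still-zero (ι-ε (ys b) q)

  down : (p : ℕ) → p ℕ.< j → List (Fin (j ℕ.+ m))
  down zero    _ = []
  down (suc p) q = vtx (suc p) q ∷ down p (ℕP.<-trans (ℕP.n<1+n p) q)

  up-bound : ∀ d i → i ℕ.+ suc d ≡ j₁ → suc i ℕ.< j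
  up-bound d i h = s≤s (subst (suc i ℕ.≤_) h (ℕP.≤-trans (s≤s (ℕP.m≤m+n i d)) (ℕP.≤-reflexive (sym (ℕP.+-suc i d)))))

  -- The vertices with indices i + 1, ..., j₁; the recursion is on the number `d` of those left.
  up : (d i : ℕ) → i ℕ.+ d ≡ j₁ → List (Fin (j ℕ.+ m))
  up zero    i _ = []
  up (suc d) i h = vtx (suc i) (up-bound d i h) ∷ up d (suc i) (trans (sym (ℕP.+-suc i d)) h)

  sequence : List (Fin m) → List (Fin (j ℕ.+ m))
  sequence s = down j₁ (ℕP.n<1+n j₁) ++ (List.map (j Fin.↑ʳ_) s ++ (vtx 0 (s≤s z≤n) ∷ up j₁ 0 refl))

  finish : ∀ d i h {cs ys} → Ascending i cs ys → (∀ b → NonPos (ys b)) → GreenPath cs (up d i h)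
  finish zero i h {cs} {ys} S np k with splitFin j {m} k
  ... | right b = subst NonPos (sym (Ascending.outer S b)) (ι-nonpos (np b))
  ... | left a  = subst (λ z → NonPos (cs (z Fin.↑ˡ m))) (FinP.fromℕ<-toℕ a (FinP.toℕ<n a)) (red (Fin.toℕ a) (FinP.toℕ<n a))
    where
    red : ∀ l q → NonPos (cs (vtx l q))
    red zero    q = subst NonPos (sym (Ascending.first S q)) (⊖-nonpos {Ε i} (cycVec-nonneg (step-nonneg i)))
    red (suc l) q = subst NonPos (sym (Ascending.done S l q (subst (l ℕ.<_) (trans (sym h) (ℕP.+-identityʳ i)) (ℕP.≤-pred q)))) (⊖-nonpos {ε l} (cycVec-nonneg (δ-nonneg l)))
  finish (suc d) i h S np = subst NonNeg (sym (Ascending.todo S i (up-bound d i h) ℕP.≤-refl)) (cycVec-nonneg (δ-nonneg i)) , finish d (suc i) _ (ascend S (up-bound d i h) np) np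

  run-inner : ∀ s {cs ys} → Descending 0 cs ys → Cᵖ.GreenPath ys s → GreenPath cs (List.map (j Fin.↑ʳ_) s ++ (vtx 0 (s≤s z≤n) ∷ up j₁ 0 refl))
  run-inner [] S red = subst NonNeg (sym (Descending.mid S (s≤s z≤n))) (cycVec-nonneg (step-nonneg 0)) , finish j₁ 0 refl (turn S) red
  run-inner (b ∷ s) S (g , p) = subst NonNeg (sym (Descending.outer S b)) (ι-nonneg g) , run-inner s (inner S b g) p

  run-down : ∀ p q {cs ys} rest → Descending p cs ys → (∀ b → NonNeg (ys b)) → (∀ {cs} → Descending 0 cs ys → GreenPath cs rest) → GreenPath cs (down p q ++ rest)
  run-down zero    q rest S nn k = k S
  run-down (suc p) q rest S nn k = subst NonNeg (sym (Descending.mid S q)) (cycVec-nonneg (step-nonneg (suc p))) , run-down p _ rest (descend S q nn) nn k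

  e-ε : ∀ l q → e (vtx l q) ≡ ε l
  e-ε l q = ext-split left-entry (λ b → trans (lookup-e-off (j Fin.↑ʳ b) (vtx l q) (λ z → ↑ˡ≢↑ʳ (Fin.fromℕ< q) b (sym z))) (sym (lookup-cycʳ (δ l) b)))
    where
    left-entry : ∀ a → lookup (e (vtx l q)) (a Fin.↑ˡ m) ≡ lookup (ε l) (a Fin.↑ˡ m)
    left-entry a with a Fin.≟ Fin.fromℕ< q
    ... | yes refl = trans (lookup-e (vtx l q)) (sym (trans (lookup-cycˡ (δ l) a) (trans (cong (δ l) (FinP.toℕ-fromℕ< q)) (δ-same l))))
    ... | no ne    = trans (lookup-e-off (a Fin.↑ˡ m) (vtx l q) (λ z → ne (FinP.↑ˡ-injective m a (Fin.fromℕ< q) z))) (sym (trans (lookup-cycˡ (δ l) a)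
                       (δ-off l (Fin.toℕ a) (λ z → ne (FinP.toℕ-injective (trans (sym z) (sym (FinP.toℕ-fromℕ< q))))))))

  ε-last : ε j₁ ≡ Ε j₁
  ε-last = ext-split (λ a → trans (lookup-cycˡ (δ j₁) a) (trans (trans (sym (ℤP.+-identityʳ _))
      (trans (cong (λ t → δ j₁ (Fin.toℕ a) ℤ.+ t) (sym (step-< (FinP.toℕ<n a)))) (δ+step j₁ (Fin.toℕ a)))) (sym (lookup-cycˡ (step j₁) a))))
    (λ b → trans (lookup-cycʳ (δ j₁) b) (sym (lookup-cycʳ (step j₁) b)))

  start : Descending j₁ e Cᵖ.e
  start = record
    { low   = λ l q _ → e-ε l q
    ; mid   = λ q → trans (e-ε j₁ q) ε-last
    ; nxt   = λ q → ⊥-elim (ℕP.<-irrefl refl q)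
    ; high  = λ l q r → ⊥-elim (ℕP.<-asym r (ℕP.≤-pred q))
    ; outer = λ b → sym (Restriction.ι-e j m (eulerForm Q) (eulerForm (induced j Q)) (induced-form j Q) b) }

  e-nonneg : ∀ b → NonNeg (Cᵖ.e b)
  e-nonneg b i with i Fin.≟ b
  ... | yes refl = subst 0≤_ (sym (Cᵖ.lookup-e b)) 0≤-nat
  ... | no ne    = subst 0≤_ (sym (Cᵖ.lookup-e-off i b ne)) 0≤-nat

  sequence-mgs : ∀ s → IsMaximalGreenSequence (induced j Q) s → IsMaximalGreenSequence Q (sequence s)
  sequence-mgs s p = path⇒mgs Q (sequence s) (run-down j₁ (ℕP.n<1+n j₁) _ start e-nonneg (λ S → run-inner s S (mgs⇒path (induced j Q) s p)))

theorem2p17 : (j' m : ℕ) (v : Fin m) (Q : Quiver (suc (suc j') + m)) →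
    CycleHyp (suc (suc j')) m v Q →
    (HasMGS Q ⇔ HasMGS (induced (suc (suc j')) Q)) ×
    (j' ≡ 0 → (s : List (Fin m)) →
    IsMaximalGreenSequence (induced (suc (suc j')) Q) s →
    IsMaximalGreenSequence Q
    (((suc zero) ↑ˡ m) ∷ (map ((suc (suc j')) ↑ʳ_) s ++ ((zero ↑ˡ m) ∷ ((suc zero) ↑ˡ m) ∷ []))))
theorem2p17 j' m v Q hyp =
  -- For k = 3 the general sequence computes to the stated list, so the last component is the same
  -- lemma.
  mk⇔ (induced-mgs (suc (suc j')) Q) (λ { (s , p) → S.sequence s , S.sequence-mgs s p }) , λ { refl s p → S.sequence-mgs s p }
  where module S = CycleSequence (suc j') m v Q hyp (s≤s z≤n)
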